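{- Let $G$ be a Hamiltonian cubic graph with a given Hamiltonian cycle. Then a connected proportionally dense subgraph of maximum size in $G$ can be found in linear time.
   Context: All graphs are finite, simple, undirected and connected. A cubic graph is a 3-regular graph. For a graph $G=(V,E)$, $d(v)$ is the degree of $v\in V$, $N(v)$ its set of neighbors, and for $S\subset V$, $d_S(v)=|N(v)\cap S|$, $\overline{S}=V\setminus S$, and $G[S]$ is the subgraph induced by $S$. For $S\subset V$ with $2\le |S|<|V|$, the induced subgraph $G[S]$ is a proportionally dense subgraph (PDS) if every $u\in S$ satisfies $\frac{d_S(u)}{|S|-1}\ge \frac{d(u)}{|V|-1}$ (equivalently $\frac{d_S(u)}{|S|-1}\ge\frac{d_{\overline{S}}(u)}{|\overline{S}|}$). Its size is $|S|$. It is a connected PDS if $G[S]$ is connected. The Hamiltonian cycle of $G$ is part of the input of the algorithm. -}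

module Defs where

open import Level using (0ℓ)
open import Data.Bool using (Bool; true; false; if_then_else_)
open import Data.Nat using (ℕ; suc; _+_; _*_; _∸_; _≤_; _<_; _≡ᵇ_; _<ᵇ_; _≤ᵇ_; >-nonZero)
open import Data.Nat.Properties using (m<n⇒0<n∸m; <-trans)
open import Data.Integer using (+_)
open import Data.Rational.Unnormalised as ℚᵘ using (ℚᵘ; _/_)
open import Data.Fin using (Fin; toℕ)
open import Data.Fin.Permutation using (Permutation′; _⟨$⟩ʳ_)
open import Data.Fin.Subset using (Subset; _∈_; _∩_; ∣_∣; ⊤)
open import Data.Product using (_×_; ∃-syntax)
open import Data.Unit using () renaming (⊤ to Unit)
open import Data.Vec using (tabulate; lookup)
open import Function.Bundles using (_⇔_)
open import Relation.Binary using (Rel; Decidable; Symmetric; Irreflexive)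
open import Relation.Binary.Construct.Closure.ReflexiveTransitive using (Star)
open import Relation.Binary.PropositionalEquality using (_≡_)
open import Relation.Nullary using (does)

record Graph (n : ℕ) : Set₁ where
  field
    Adj         : Rel (Fin n) 0ℓ
    adj?        : Decidable Adj
    symmetric   : Symmetric Adj
    irreflexive : Irreflexive _≡_ Adj

module _ {n : ℕ} (G : Graph n) where
  open Graph G

  neighbours : Fin n → Subset n
  neighbours v = tabulate λ u → does (adj? v u)

  degree : Fin n → ℕ
  degree v = ∣ neighbours v ∣

  degreeIn : Subset n → Fin n → ℕ
  degreeIn S v = ∣ neighbours v ∩ S ∣

  Cubic : Set
  Cubic = ∀ v → degree v ≡ 3

  InducedAdj : Subset n → Rel (Fin n) 0ℓ
  InducedAdj S u v = u ∈ S × v ∈ S × Adj u v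

  ConnectedOn : Subset n → Set
  ConnectedOn S = ∀ {u v} → u ∈ S → v ∈ S → Star (InducedAdj S) u v

  Connected : Set
  Connected = ConnectedOn ⊤

  -- The cycle is vertexAt 0, vertexAt 1, …, vertexAt (n - 1), vertexAt 0.
  record HamiltonianCycle : Set where
    field
      3≤n   : 3 ≤ n
      order : Permutation′ n

    vertexAt : Fin n → Fin n
    vertexAt i = order ⟨$⟩ʳ i

    field
      consecutive : ∀ i j → toℕ j ≡ suc (toℕ i) → Adj (vertexAt i) (vertexAt j)
      closing     : ∀ i j → suc (toℕ i) ≡ n → toℕ j ≡ 0 → Adj (vertexAt i) (vertexAt j)

-- k / (m - 1)
_/pred_⟨_⟩ : ℕ → (m : ℕ) → 1 < m → ℚᵘ
k /pred m ⟨ 1<m ⟩ = (+ k / (m ∸ 1)) {{>-nonZero (m<n⇒0<n∸m 1<m)}}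

module _ {n : ℕ} (G : Graph n) where

  record IsPDS (S : Subset n) : Set where
    field
      2≤∣S∣ : 2 ≤ ∣ S ∣
      ∣S∣<n : ∣ S ∣ < n
      proportional : ∀ {u} → u ∈ S →
        degreeIn G S u /pred ∣ S ∣ ⟨ 2≤∣S∣ ⟩ ℚᵘ.≥ degree G u /pred n ⟨ <-trans 2≤∣S∣ ∣S∣<n ⟩

  -- Maximality is over all proportionally dense subgraphs, connected or not.
  record IsConnectedMaximumPDS (S : Subset n) : Set where
    field
      isPDS     : IsPDS S
      connected : ConnectedOn G S
      maximum   : ∀ T → IsPDS T → ∣ T ∣ ≤ ∣ S ∣

-- A word RAM with structured control: finitely many registers are mentioned
-- by a program; there is a read-only random-access input and a read-write
-- random-access memory.  Every instruction and every test costs one unit.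

Reg : Set
Reg = ℕ

data Operand : Set where
  reg : Reg → Operand
  lit : ℕ → Operand

data Expr : Set where
  val      : Operand → Expr
  _⊞_ _⊟_  : Operand → Operand → Expr
  input[_] : Operand → Expr
  mem[_]   : Operand → Expr

data Test : Set where
  _≐_ _≺_ _≼_ : Operand → Operand → Test

data Program : Set where
  skip             : Program
  _≔_              : Reg → Expr → Program
  mem[_]≔_         : Operand → Operand → Program
  _⨾_              : Program → Program → Program
  If_Then_Else_End : Test → Program → Program → Program
  While_Do_End     : Test → Program → Program

infix  6 _⊞_ _⊟_ _≐_ _≺_ _≼_
infix  5 _≔_ mem[_]≔_
infixr 4 _⨾_

record State : Set where
  constructor ⟨_,_⟩
  field
    regs : Reg → ℕ
    mem  : ℕ → ℕ

open State public

initial : State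
initial = ⟨ (λ _ → 0) , (λ _ → 0) ⟩

_[_↦_] : (ℕ → ℕ) → ℕ → ℕ → (ℕ → ℕ)
(f [ i ↦ x ]) j = if j ≡ᵇ i then x else f j

⟦_⟧ᵒ : Operand → State → ℕ
⟦ reg r ⟧ᵒ σ = regs σ r
⟦ lit k ⟧ᵒ σ = k

⟦_⟧ᵗ : Test → State → Bool
⟦ a ≐ b ⟧ᵗ σ = ⟦ a ⟧ᵒ σ ≡ᵇ ⟦ b ⟧ᵒ σ
⟦ a ≺ b ⟧ᵗ σ = ⟦ a ⟧ᵒ σ <ᵇ ⟦ b ⟧ᵒ σ
⟦ a ≼ b ⟧ᵗ σ = ⟦ a ⟧ᵒ σ ≤ᵇ ⟦ b ⟧ᵒ σ

-- w is the largest number that fits in a machine word.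
module Machine (inp : ℕ → ℕ) (w : ℕ) where

  ⟦_⟧ᵉ : Expr → State → ℕ
  ⟦ val a ⟧ᵉ      σ = ⟦ a ⟧ᵒ σ
  ⟦ a ⊞ b ⟧ᵉ      σ = ⟦ a ⟧ᵒ σ + ⟦ b ⟧ᵒ σ
  ⟦ a ⊟ b ⟧ᵉ      σ = ⟦ a ⟧ᵒ σ ∸ ⟦ b ⟧ᵒ σ
  ⟦ input[ a ] ⟧ᵉ σ = inp (⟦ a ⟧ᵒ σ)
  ⟦ mem[ a ] ⟧ᵉ   σ = mem σ (⟦ a ⟧ᵒ σ)

  -- Addition is the only operation whose result can exceed all the literals,
  -- input words and stored words it is computed from.
  NoOverflow : Expr → State → Set
  NoOverflow (a ⊞ b) σ = ⟦ a ⟧ᵒ σ + ⟦ b ⟧ᵒ σ ≤ w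
  NoOverflow _       σ = Unit

  -- Run p σ σ′ t: started in σ, p halts in σ′ after exactly t steps.
  -- An overflowing addition has no run.
  data Run : Program → State → State → ℕ → Set where

    run-skip : ∀ {σ} → Run skip σ σ 0

    run-assign : ∀ {r e σ} → NoOverflow e σ →
      Run (r ≔ e) σ ⟨ regs σ [ r ↦ ⟦ e ⟧ᵉ σ ] , mem σ ⟩ 1

    run-store : ∀ {a b σ} →
      Run (mem[ a ]≔ b) σ ⟨ regs σ , mem σ [ ⟦ a ⟧ᵒ σ ↦ ⟦ b ⟧ᵒ σ ] ⟩ 1

    run-seq : ∀ {p q σ σ′ σ″ s t} →
      Run p σ σ′ s → Run q σ′ σ″ t → Run (p ⨾ q) σ σ″ (s + t)

    run-then : ∀ {b p q σ σ′ t} → ⟦ b ⟧ᵗ σ ≡ true →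
      Run p σ σ′ t → Run (If b Then p Else q End) σ σ′ (suc t)

    run-else : ∀ {b p q σ σ′ t} → ⟦ b ⟧ᵗ σ ≡ false →
      Run q σ σ′ t → Run (If b Then p Else q End) σ σ′ (suc t)

    run-stop : ∀ {b p σ} → ⟦ b ⟧ᵗ σ ≡ false →
      Run (While b Do p End) σ σ 1

    run-loop : ∀ {b p σ σ′ σ″ s t} → ⟦ b ⟧ᵗ σ ≡ true →
      Run p σ σ′ s → Run (While b Do p End) σ′ σ″ t →
      Run (While b Do p End) σ σ″ (suc (s + t))

open Machine public using (Run)

-- The input is n, then the adjacency lists (three entries per vertex, in
-- arbitrary order), then the vertices in the order of the Hamiltonian cycle.
-- Nothing is assumed about the cells after these.
record EncodesInput {n : ℕ} (G : Graph n) (H : HamiltonianCycle G) (inp : ℕ → ℕ) : Set where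
  open Graph G
  open HamiltonianCycle H
  field
    neighbour       : Fin n → Fin 3 → Fin n
    adjacencyList   : ∀ v u → Adj v u ⇔ (∃[ j ] neighbour v j ≡ u)
    size-cell       : inp 0 ≡ n
    adjacency-cells : ∀ v j → inp (1 + (3 * toℕ v + toℕ j)) ≡ toℕ (neighbour v j)
    cycle-cells     : ∀ i → inp (1 + (3 * n + toℕ i)) ≡ toℕ (vertexAt i)

-- The output is the characteristic vector of S in the first n memory cells.
EncodesOutput : ∀ {n} → Subset n → (ℕ → ℕ) → Set
EncodesOutput {n} S out = ∀ (v : Fin n) → out (toℕ v) ≡ (if lookup S v then 1 else 0)

{-# OPTIONS --safe #-}

-- A proportionally dense subgraph of a cubic graph with n vertices has at most
-- K = ⌊(2 n + 1) / 3⌋ vertices, since one of its vertices has a neighbour outside and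
-- hence at most two inside.  Conversely, a connected set of K vertices each of which
-- keeps two neighbours is optimal.  On the Hamiltonian cycle such sets are the arcs
-- of K vertices whose two ends have their chords inside the arc, and suitable arcs
-- of K + 1 vertices without one inner vertex.
--
-- Suppose that no arc of K vertices works.  Then every chord is short, and whether
-- the chord at a position leads forwards or backwards is periodic with period 3, 2 or
-- 4 according to n mod 3.  Chords exchange the two directions, so the directions
-- alternate singly or in pairs.  In both cases one of five places for the removed
-- vertex works for some arc, unless n = 8 and the graph is the cube or a necklace of
-- two diamonds; these have no solution with 5 vertices, but an arc of 4.  Thus it
-- suffices to make six tests of constant cost at each position of the cycle.

module Submission where

open import Defs
open import Data.Nat hiding (_≤′_; ∣_-_∣; parity)
open import Data.Fin.Subset
  using (Subset; _∈_; _∉_; ∣_∣; _-_; ⁅_⁆; _∩_; ⊤; inside)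
  renaming (⊥ to ∅)
open import Data.Product using (_×_; _,_; ∃-syntax; Σ-syntax; proj₁; proj₂)
open import Data.Bool using (Bool; true; false; T; not; _∧_; _∨_; if_then_else_)
open import Data.Bool.ListAction using (any)
open import Data.Bool.Properties using (not-involutive; ¬-not; not-¬; T-≡)
open import Data.Empty using (⊥; ⊥-elim)
open import Data.Fin using (Fin; zero; suc; toℕ; fromℕ<)
open import Data.Fin.Permutation using (_⟨$⟩ˡ_; inverseˡ; inverseʳ)
open import Data.Fin.Properties
  using (any?; pigeonhole; toℕ<n; toℕ-fromℕ<; toℕ-injective; fromℕ<-cong)
  renaming (_≟_ to _≟ᶠ_)
open import Data.Fin.Subset.Properties
  using (x∈p∧x≢y⇒x∈p-y; x∈p⇒∣p-x∣<∣p∣; p─q⊆p; p─⊥≡p; Empty-unique; ∣⊥∣≡0; ∣⊤∣≡n; x∈p∩q⁺;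
         x∈p∩q⁻; p∩q⊆p; ∈⊤; ∉⊥; p⊂q⇒∣p∣<∣q∣; p⊆q⇒∣p∣≤∣q∣; _∈?_; nonempty?)
import Data.Integer as ℤ
import Data.Integer.Properties as ℤ
open import Data.List using (List; []; _∷_; length; filter; applyUpTo; upTo)
import Data.List as List
open import Data.List.Membership.Propositional using () renaming (_∈_ to _∈ˡ_)
open import Data.List.Membership.Propositional.Properties using (∈-filter⁺; ∈-applyUpTo⁺)
open import Data.List.Relation.Unary.All as All using (All; []; _∷_)
import Data.List.Relation.Unary.All.Properties as All
open import Data.List.Relation.Unary.AllPairs using ([]; _∷_)
open import Data.List.Relation.Unary.Any using (here; there)
open import Data.List.Relation.Unary.Unique.Propositional using (Unique)
open import Data.List.Relation.Unary.Unique.Propositional.Properties using (applyUpTo⁺₁; filter⁺)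
open import Data.Maybe using (Maybe; just; nothing; is-just; to-witness-T; _<∣>_)
open import Data.Nat.ListAction using (sum)
open import Data.Nat.DivMod
open import Data.Nat.Properties
open import Data.Nat.Solver using (module +-*-Solver)
import Data.Rational.Unnormalised as ℚᵘ
open import Data.Sum using (_⊎_; inj₁; inj₂; [_,_]′)
open import Data.Unit using (tt)
open import Data.Vec as Vec
  using (Vec; []; _∷_; lookup; replicate; zipWith; tabulate; _[_]≔_; here; there)
open import Data.Vec.N-ary using (N-ary; _$ⁿ_)
open import Data.Vec.Properties
  using (lookup∘tabulate; []=⇒lookup; lookup⇒[]=; []≔-updates; lookup∘update; lookup∘update′;
         lookup-replicate)
open import Function using (_∘_; case_of_; id; Equivalence)
open import Relation.Binary.Construct.Closure.ReflexiveTransitive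
  using (Star; ε; _◅_; _◅◅_; reverse)
open import Relation.Binary.Definitions using (tri<; tri≈; tri>)
open import Relation.Binary.PropositionalEquality
open import Relation.Nullary
open import Relation.Nullary.Decidable using (_×-dec_; ¬?; dec-true)
open import Relation.Unary using (Decidable; Pred)

-- Linear arithmetic on ℕ

-- Put d = K - 1. If the chord at i ends inside the arc from i to i + d, the failure of this arc
-- makes the chord at i + d lead forwards by at most n - 1 - d, hence by at most d, and the argument
-- repeats. Three such steps advance by 3 d = 2 n - δ, which is -δ on the cycle, with δ = 3, 2, 4
-- for n mod 3 = 0, 1, 2; going round the cycle turns this implication into periodicity. Since
-- chords pair forward with backward positions, the classes modulo δ split evenly between the two
-- directions if δ divides n. This excludes δ = 3.
--
-- The five places are not interchangeable: some of them force chord lengths by failing. If the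
-- directions alternate singly, failure for `k = 2` gives every forward chord length 3, and then
-- `k = 4` works; n = 10 is too small for this and needs `k = 1`. If they alternate in pairs,
-- failure for `k = m - 3`, where m = ⌊n / 3⌋, determines the chords at two of the four classes
-- modulo 4, and then `k = m + 1` works.

infix  8 #_
infixl 7 _⊗_
infixl 6 _⊕_

-- There is no subtraction, so all coefficients stay natural; what would be negative is written on
-- the other side of the relation.
data Lin (k : ℕ) : Set where
  var : Fin k → Lin k
  #_  : ℕ → Lin k
  _⊕_ : Lin k → Lin k → Lin k
  _⊗_ : ℕ → Lin k → Lin k

eval : ∀ {k} → Lin k → Vec ℕ k → ℕ
eval (var i)   ρ = lookup ρ i
eval (# c)     ρ = c
eval (e ⊕ e′)  ρ = eval e ρ + eval e′ ρ
eval (c ⊗ e)   ρ = c * eval e ρ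

unit : ∀ {k} → Fin k → Vec ℕ k
unit zero    = 1 ∷ replicate _ 0
unit (suc i) = 0 ∷ unit i

dot : ∀ {k} → Vec ℕ k → Vec ℕ k → ℕ
dot []       []       = 0
dot (c ∷ cs) (x ∷ xs) = c * x + dot cs xs

-- The constant term comes first, as the coefficient of an additional variable whose value is 1.
coeffs : ∀ {k} → Lin k → Vec ℕ (suc k)
coeffs (var i)  = 0 ∷ unit i
coeffs (# c)    = c ∷ replicate _ 0
coeffs (e ⊕ e′) = zipWith _+_ (coeffs e) (coeffs e′)
coeffs (c ⊗ e)  = Vec.map (c *_) (coeffs e)

dot-0 : ∀ {k} (xs : Vec ℕ k) → dot (replicate k 0) xs ≡ 0
dot-0 []       = refl
dot-0 (x ∷ xs) = dot-0 xs

dot-unit : ∀ {k} i (xs : Vec ℕ k) → dot (unit i) xs ≡ lookup xs i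
dot-unit zero    (x ∷ xs) rewrite dot-0 xs | +-identityʳ x = +-identityʳ x
dot-unit (suc i) (x ∷ xs) = dot-unit i xs

dot-+ : ∀ {k} (cs ds xs : Vec ℕ k) → dot (zipWith _+_ cs ds) xs ≡ dot cs xs + dot ds xs
dot-+ []       []       []       = refl
dot-+ (c ∷ cs) (d ∷ ds) (x ∷ xs) rewrite dot-+ cs ds xs =
  solve 5 (λ c d x a b → (c :+ d) :* x :+ (a :+ b) := (c :* x :+ a) :+ (d :* x :+ b))
    refl c d x (dot cs xs) (dot ds xs)
  where open +-*-Solver

dot-* : ∀ {k} c (cs xs : Vec ℕ k) → dot (Vec.map (c *_) cs) xs ≡ c * dot cs xs
dot-* c []       []       = sym (*-zeroʳ c)
dot-* c (d ∷ ds) (x ∷ xs) rewrite dot-* c ds xs =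
  solve 4 (λ c d x a → c :* d :* x :+ c :* a := c :* (d :* x :+ a)) refl c d x (dot ds xs)
  where open +-*-Solver

coeffs-correct : ∀ {k} (e : Lin k) ρ → dot (coeffs e) (1 ∷ ρ) ≡ eval e ρ
coeffs-correct (var i)  ρ = dot-unit i ρ
coeffs-correct (# c)    ρ rewrite dot-0 ρ | *-identityʳ c = +-identityʳ c
coeffs-correct (e ⊕ e′) ρ = trans (dot-+ (coeffs e) (coeffs e′) (1 ∷ ρ))
                                  (cong₂ _+_ (coeffs-correct e ρ) (coeffs-correct e′ ρ))
coeffs-correct (c ⊗ e)  ρ = trans (dot-* c (coeffs e) (1 ∷ ρ)) (cong (c *_) (coeffs-correct e ρ))

Below : ∀ {k} → Vec ℕ k → Vec ℕ k → Set
Below cs ds = ∀ xs → dot cs xs ≤ dot ds xs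

-- Values are natural, so comparing coefficientwise is sufficient. A failure reports the first
-- offending index, which tells the search where to act.
compareCoeffs : ∀ {k} (cs ds : Vec ℕ k) → Below cs ds ⊎ Fin k
compareCoeffs []       []       = inj₁ λ { [] → z≤n }
compareCoeffs (c ∷ cs) (d ∷ ds) with c ≤? d
... | no _ = inj₂ zero
... | yes c≤d with compareCoeffs cs ds
...   | inj₁ cs≤ds = inj₁ λ { (x ∷ xs) → +-mono-≤ (*-monoˡ-≤ x c≤d) (cs≤ds xs) }
...   | inj₂ i     = inj₂ (suc i)

Ineq : ℕ → Set
Ineq k = Lin k × Lin k

Holds : ∀ {k} → Vec ℕ k → Ineq k → Set
Holds ρ (l , r) = eval l ρ ≤ eval r ρ

-- Depth-first search for a multiset of hypotheses l′ ≤ r′ such that the goal follows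
-- coefficientwise after adding each r′ on its left and l′ on its right; every step
-- repairs the first coefficient that is too large.
search : ∀ {k} → ℕ → (hs : List (Ineq k)) (g : Ineq k) →
         Maybe (∀ ρ → All (Holds ρ) hs → Holds ρ g)
search fuel hs (l , r) with compareCoeffs (coeffs l) (coeffs r)
... | inj₁ l≤r = just λ ρ _ →
        subst₂ _≤_ (coeffs-correct l ρ) (coeffs-correct r ρ) (l≤r (1 ∷ ρ))
search zero       hs (l , r) | inj₂ i = nothing
search (suc fuel) hs (l , r) | inj₂ i = go hs (λ _ → λ z → z)
  where
  lack : ℕ
  lack = Vec.lookup (coeffs l) i ∸ Vec.lookup (coeffs r) i

  use : ℕ → (h : Ineq _) → Maybe (∀ ρ → All (Holds ρ) hs → Holds ρ h → Holds ρ (l , r))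
  use c (l′ , r′) with search fuel hs (l ⊕ c ⊗ r′ , r ⊕ c ⊗ l′)
  ... | nothing = nothing
  ... | just p  = just λ ρ all l′≤r′ → +-cancelʳ-≤ (c * eval r′ ρ) (eval l ρ) (eval r ρ)
                    (≤-trans (p ρ all) (+-monoʳ-≤ (eval r ρ) (*-monoʳ-≤ c l′≤r′)))

  go : ∀ gs → (∀ ρ → All (Holds ρ) hs → All (Holds ρ) gs) →
       Maybe (∀ ρ → All (Holds ρ) hs → Holds ρ (l , r))
  go []               _  = nothing
  go ((l′ , r′) ∷ gs) gs⊆ with Vec.lookup (coeffs l′) i ∸ Vec.lookup (coeffs r′) i
  ... | zero = go gs (λ ρ → All.tail ∘ gs⊆ ρ)
  -- The whole quotient is tried before a single copy, so that a large multiple of one hypothesis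
  -- costs only one unit of fuel.
  ... | gain@(suc _) with (if 2 ≤ᵇ lack / gain then use (lack / gain) (l′ , r′) else nothing) <∣> use 1 (l′ , r′)
  ...   | nothing = go gs (λ ρ → All.tail ∘ gs⊆ ρ)
  ...   | just p  = just λ ρ all → p ρ all (All.head (gs⊆ ρ all))

data Problem (k : ℕ) : Set where
  goal≤ goal≡ : Lin k → Lin k → Problem k
  hyp≤ hyp≡   : Lin k → Lin k → Problem k → Problem k

⟦_⟧ᵖ : ∀ {k} → Problem k → Vec ℕ k → Set
⟦ goal≤ l r ⟧ᵖ  ρ = eval l ρ ≤ eval r ρ
⟦ goal≡ l r ⟧ᵖ  ρ = eval l ρ ≡ eval r ρ
⟦ hyp≤ l r p ⟧ᵖ ρ = eval l ρ ≤ eval r ρ → ⟦ p ⟧ᵖ ρ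
⟦ hyp≡ l r p ⟧ᵖ ρ = eval l ρ ≡ eval r ρ → ⟦ p ⟧ᵖ ρ

solveWith : ∀ {k} (hs : List (Ineq k)) (p : Problem k) →
            Maybe (∀ ρ → All (Holds ρ) hs → ⟦ p ⟧ᵖ ρ)
-- Nine successive repairs are enough for every linear fact of this development.
solveWith hs (goal≤ l r) = search 9 hs (l , r)
solveWith hs (goal≡ l r) with search 9 hs (l , r) | search 9 hs (r , l)
... | just p | just q = just λ ρ all → ≤-antisym (p ρ all) (q ρ all)
... | _      | _      = nothing
solveWith hs (hyp≤ l r p) with solveWith ((l , r) ∷ hs) p
... | just s  = just λ ρ all l≤r → s ρ (l≤r ∷ all)
... | nothing = nothing
solveWith hs (hyp≡ l r p) with solveWith ((l , r) ∷ (r , l) ∷ hs) p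
... | just s  = just λ ρ all l≡r → s ρ (≤-reflexive l≡r ∷ ≤-reflexive (sym l≡r) ∷ all)
... | nothing = nothing

-- The hidden argument has a type that evaluates to the unit type when the search succeeds. A use
-- thus states hypotheses and conclusion only, and contradictions are obtained from the conclusion 1
-- ≤ 0.
linear : ∀ {k} (ρ : Vec ℕ k) (p : N-ary k (Lin k) (Problem k)) →
         let q = p $ⁿ Vec.map var (Vec.allFin k) in
         {_ : T (is-just (solveWith [] q))} → ⟦ q ⟧ᵖ ρ
linear {k} ρ p {ok} = to-witness-T (solveWith [] (p $ⁿ Vec.map var (Vec.allFin k))) ok ρ []

infix  3 ⊢_
infixr 3 _⇒_

Rel : ℕ → Set
Rel k = Bool × Lin k × Lin k

_≤′_ _≡′_ : ∀ {k} → Lin k → Lin k → Rel k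
l ≤′ r = false , l , r
l ≡′ r = true  , l , r

infix 4 _≤′_ _≡′_

⊢_ : ∀ {k} → Rel k → Problem k
⊢ (false , l , r) = goal≤ l r
⊢ (true  , l , r) = goal≡ l r

_⇒_ : ∀ {k} → Rel k → Problem k → Problem k
(false , l , r) ⇒ p = hyp≤ l r p
(true  , l , r) ⇒ p = hyp≡ l r p

-- Chords of a cycle

-- f i is the distance, in the direction of the cycle, from position i to the
-- other end of the chord at i; positions are natural numbers modulo n.
record Chords (n : ℕ) (f : ℕ → ℕ) : Set where
  field
    periodic : ∀ i → f (i + n) ≡ f i
    2≤f      : ∀ i → 2 ≤ f i
    f+2≤n    : ∀ i → f i + 2 ≤ n
    back     : ∀ i → f i + f (i + f i) ≡ n

-- Both ends of the arc a, …, a + d have their chords inside it.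
ClosedArc : ℕ → (ℕ → ℕ) → ℕ → ℕ → Set
ClosedArc n f d a = f a ≤ d × n ≤ d + f (a + d)

-- Removing a + (1 + k) from the arc a, …, a + e leaves a connected set of
-- vertices that all keep at least two neighbours.
PuncturedArc : ℕ → (ℕ → ℕ) → ℕ → ℕ → ℕ → Set
PuncturedArc n f e k a =
  f a ≤ e × f a ≢ suc k ×
  n ≤ e + f (a + e) × e + f (a + e) ≢ n + suc k ×
  1 ≤ k × k + 3 ≤ e ×
  k + f (a + k) ≤ e ×
  (2 + k + f (a + (2 + k)) ≤ e ⊎ n ≤ 2 + k + f (a + (2 + k)))

cube : ℕ → ℕ
cube 0             = 3
cube 1             = 5
cube (suc (suc i)) = cube i

diamonds : ℕ → ℕ
diamonds 0 = 2
diamonds 1 = 2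
diamonds 2 = 6
diamonds 3 = 6
diamonds (suc (suc (suc (suc i)))) = diamonds i

-- The two cubic Hamiltonian graphs without a proportionally dense subgraph of
-- the generic maximum size.
Exceptional : ℕ → (ℕ → ℕ) → Set
Exceptional n f = n ≡ 8 × ∃[ j ] ((∀ i → f (j + i) ≡ cube i) ⊎ (∀ i → f (j + i) ≡ diamonds i))

-- Periodicity of chord directions when no arc is closed

module Shape (n : ℕ) (f : ℕ → ℕ) (C : Chords n f) where
  open Chords C

  4≤n : 4 ≤ n
  4≤n = linear (f 0 ∷ n ∷ []) (λ f n → # 2 ≤′ f ⇒ f ⊕ # 2 ≤′ n ⇒ ⊢ # 4 ≤′ n) (2≤f 0) (f+2≤n 0)

  0<n : 0 < n
  0<n = ≤-trans (s≤s z≤n) 4≤n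

  instance
    n≢0 : NonZero n
    n≢0 = >-nonZero 0<n

  periodic* : ∀ k i → f (i + k * n) ≡ f i
  periodic* zero    i = cong f (+-identityʳ i)
  periodic* (suc k) i = begin
    f (i + (n + k * n)) ≡⟨ cong (λ x → f (i + x)) (+-comm n (k * n)) ⟩
    f (i + (k * n + n)) ≡⟨ cong f (sym (+-assoc i (k * n) n)) ⟩
    f (i + k * n + n)   ≡⟨ periodic (i + k * n) ⟩
    f (i + k * n)       ≡⟨ periodic* k i ⟩
    f i                 ∎
    where open ≡-Reasoning

  f-% : ∀ i → f (i % n) ≡ f i
  f-% i = trans (sym (periodic* (i / n) (i % n))) (cong f (sym (m≡m%n+[m/n]*n i n)))

  partner-involutive : ∀ i → (i + f i + f (i + f i)) ≡ i + n
  partner-involutive i = trans (+-assoc i _ _) (cong (i +_) (back i))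

  partner-injective : ∀ i j → (i + f i) % n ≡ (j + f j) % n → i % n ≡ j % n
  partner-injective i j eq = begin
    i % n                                ≡⟨ sym ([m+n]%n≡m%n i n) ⟩
    (i + n) % n                          ≡⟨ cong (_% n) (sym (partner-involutive i)) ⟩
    (i + f i + f (i + f i)) % n          ≡⟨ step i ⟩
    ((i + f i) % n + f ((i + f i) % n)) % n ≡⟨ cong (λ p → (p + f p) % n) eq ⟩
    ((j + f j) % n + f ((j + f j) % n)) % n ≡⟨ sym (step j) ⟩
    (j + f j + f (j + f j)) % n          ≡⟨ cong (_% n) (partner-involutive j) ⟩
    (j + n) % n                          ≡⟨ [m+n]%n≡m%n j n ⟩
    j % n                                ∎
    where
    open ≡-Reasoning
    step : ∀ i → (i + f i + f (i + f i)) % n ≡ ((i + f i) % n + f ((i + f i) % n)) % n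
    step i = begin
      (p + f p) % n             ≡⟨ %-distribˡ-+ p (f p) n ⟩
      (p % n + f p % n) % n     ≡⟨ cong (λ x → (x + f p % n) % n) (sym (m%n%n≡m%n p n)) ⟩
      (p % n % n + f p % n) % n ≡⟨ sym (%-distribˡ-+ (p % n) (f p) n) ⟩
      (p % n + f p) % n         ≡⟨ cong (λ x → (p % n + x) % n) (sym (f-% p)) ⟩
      (p % n + f (p % n)) % n   ∎
      where p = i + f i

  two-or-three : ∀ x → 2 ≤ x → x ≤ 3 → x ≡ 2 ⊎ x ≡ 3
  two-or-three 1 (s≤s ()) _
  two-or-three 2 _ _ = inj₁ refl
  two-or-three 3 _ _ = inj₂ refl
  two-or-three (suc (suc (suc (suc _)))) _ (s≤s (s≤s (s≤s ())))

  module _ (d : ℕ) where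

    -- Whether the chord at i is short and leads forwards: f i ≤ n ∸ (1 + d).
    side : ℕ → Bool
    side i = f i + d <ᵇ n

    side-true : ∀ {i} → side i ≡ true → f i + d < n
    side-true {i} eq = <ᵇ⇒< (f i + d) n (subst T (sym eq) _)

    side-is-true : ∀ {i} → f i + d < n → side i ≡ true
    side-is-true {i} p with side i | <⇒<ᵇ p
    ... | true | _ = refl

    side-periodic* : ∀ k i → side (i + k * n) ≡ side i
    side-periodic* k i = cong (λ x → x + d <ᵇ n) (periodic* k i)

    module NoClosedArc (n≤1+2d : n ≤ 1 + 2 * d) (fails : ∀ a → ¬ ClosedArc n f d a) where

      push : ∀ i → f i ≤ d → side (i + d) ≡ true
      push i fi≤d = side-is-true (≰⇒> λ n≤ →
        fails i (fi≤d , ≤-trans n≤ (≤-reflexive (+-comm (f (i + d)) d))))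

      short : ∀ {i} → side i ≡ true → f i ≤ d
      short {i} eq = linear (f i ∷ d ∷ n ∷ [])
        (λ f d n → f ⊕ d ⊕ # 1 ≤′ n ⇒ n ≤′ # 1 ⊕ 2 ⊗ d ⇒ ⊢ f ≤′ d)
        (≤-trans (≤-reflexive (+-comm (f i + d) 1)) (side-true eq)) n≤1+2d

      push³ : ∀ i → f i ≤ d → side (i + 3 * d) ≡ true
      push³ i p = subst (λ x → side x ≡ true)
        (linear (i ∷ d ∷ []) λ i d → ⊢ i ⊕ d ⊕ d ⊕ d ≡′ i ⊕ 3 ⊗ d)
        (push _ (short (push _ (short (push i p)))))

      module Periodic (δ : ℕ) (3d : 3 * d + δ ≡ 2 * n) where

        wrap : ∀ i → i + δ + 3 * d ≡ i + 2 * n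
        wrap i = linear (i ∷ δ ∷ d ∷ n ∷ [])
          (λ i δ d n → 3 ⊗ d ⊕ δ ≡′ 2 ⊗ n ⇒ ⊢ i ⊕ δ ⊕ 3 ⊗ d ≡′ i ⊕ 2 ⊗ n) 3d

        down : ∀ i → side (i + δ) ≡ true → side i ≡ true
        down i eq = trans (sym (side-periodic* 2 i))
          (subst (λ x → side x ≡ true) (wrap i) (push³ (i + δ) (short eq)))

        down* : ∀ k i → side (i + k * δ) ≡ true → side i ≡ true
        down* zero    i eq = subst (λ x → side x ≡ true) (+-identityʳ i) eq
        down* (suc k) i eq = down i (down* k (i + δ)
          (subst (λ x → side x ≡ true) (sym (+-assoc i δ (k * δ))) eq))

        -- The position `i + n * δ` is `i` again on the cycle, and `pred n` steps down from it lead
        -- to `i + δ`.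
        up : ∀ i → side i ≡ true → side (i + δ) ≡ true
        up i eq = down* (pred n) (i + δ) (begin
          side (i + δ + pred n * δ) ≡⟨ cong side (+-assoc i δ _) ⟩
          side (i + suc (pred n) * δ) ≡⟨ cong (λ x → side (i + x * δ)) (suc-pred n) ⟩
          side (i + n * δ)            ≡⟨ cong (λ x → side (i + x)) (*-comm n δ) ⟩
          side (i + δ * n)            ≡⟨ side-periodic* δ i ⟩
          side i                      ≡⟨ eq ⟩
          true                        ∎)
          where open ≡-Reasoning

        side-δ : ∀ i → side (i + δ) ≡ side i
        side-δ i with side i in e | side (i + δ) in e′
        ... | true  | true  = refl
        ... | false | false = refl
        ... | true  | false = trans (sym e′) (up i e)
        ... | false | true  = trans (sym (down i e′)) e

        -- Three pushes lead to `i + 3 * d`, and one period further is `i + 2 * n`. Consequently no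
        -- chord has a length from `n - d` to `d`: what is not short exceeds `d`.
        short⇒true : ∀ i → f i ≤ d → side i ≡ true
        short⇒true i p = trans (sym (side-periodic* 2 i)) (trans (cong side eq) (up (i + 3 * d) (push³ i p)))
          where
          eq : i + 2 * n ≡ i + 3 * d + δ
          eq = linear (i ∷ δ ∷ d ∷ n ∷ [])
            (λ i δ d n → 3 ⊗ d ⊕ δ ≡′ 2 ⊗ n ⇒ ⊢ i ⊕ 2 ⊗ n ≡′ i ⊕ 3 ⊗ d ⊕ δ) 3d

        long : ∀ {i} → side i ≡ false → d < f i
        long {i} eq = ≰⇒> λ p → case trans (sym eq) (short⇒true i p) of λ ()

        -- The lengths seen from the two ends add up to `n`, but by `n ≤ 1 + 2 * d` two short
        -- lengths stay below `n` and two long ones exceed it.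
        opposite : ∀ i → side (i + f i) ≡ not (side i)
        opposite i with side i in e | side (i + f i) in e′
        ... | true  | false = refl
        ... | false | true  = refl
        ... | true  | true  = ⊥-elim (case impossible (side-true e) (side-true e′) (back i) n≤1+2d of λ ())
          where
          impossible = linear (f i ∷ f (i + f i) ∷ d ∷ n ∷ [])
            λ x y d n → # 1 ⊕ (x ⊕ d) ≤′ n ⇒ # 1 ⊕ (y ⊕ d) ≤′ n ⇒ x ⊕ y ≡′ n ⇒ n ≤′ # 1 ⊕ 2 ⊗ d ⇒ ⊢ # 1 ≤′ # 0
        ... | false | false = ⊥-elim (case impossible (long e) (long e′) (back i) n≤1+2d of λ ())
          where
          impossible = linear (f i ∷ f (i + f i) ∷ d ∷ n ∷ [])
            λ x y d n → # 1 ⊕ d ≤′ x ⇒ # 1 ⊕ d ≤′ y ⇒ x ⊕ y ≡′ n ⇒ n ≤′ # 1 ⊕ 2 ⊗ d ⇒ ⊢ # 1 ≤′ # 0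

        -- This is how particular chord lengths are excluded later: they would end in a class of the
        -- wrong direction. The factor `k` allows for the chord passing the origin of the cycle.
        same-side : ∀ {b} i j k → side i ≡ b → side j ≡ b → i + f i ≢ j + k * n
        same-side {b} i j k sᵢ sⱼ eq = not-fixed b (begin
          b                ≡⟨ sym sⱼ ⟩
          side j           ≡⟨ sym (side-periodic* k j) ⟩
          side (j + k * n) ≡⟨ cong side (sym eq) ⟩
          side (i + f i)   ≡⟨ opposite i ⟩
          not (side i)     ≡⟨ cong not sᵢ ⟩
          not b            ∎)
          where
          open ≡-Reasoning
          not-fixed : ∀ b → b ≢ not b
          not-fixed true  ()
          not-fixed false ()

        side-δ* : ∀ k i → side (i + k * δ) ≡ side i
        side-δ* zero    i = cong side (+-identityʳ i)
        side-δ* (suc k) i = trans (cong side (sym (+-assoc i δ (k * δ))))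
                                  (trans (side-δ* k (i + δ)) (side-δ i))

        not-constant : ∀ i → ¬ (∀ k → side (i + k) ≡ side i)
        not-constant i const = same-side i (i + f i) 0 refl (const (f i)) (sym (+-identityʳ _))

        not-1-periodic : ¬ (∀ i → side (i + 1) ≡ side i)
        not-1-periodic p = not-constant 0 go
          where
          go : ∀ k → side (0 + k) ≡ side 0
          go zero    = refl
          go (suc k) = trans (cong side (+-comm 1 k)) (trans (p k) (go k))

        2-periodic⇒alternating : (∀ i → side (i + 2) ≡ side i) → ∀ i → side (i + 1) ≡ not (side i)
        2-periodic⇒alternating p i = ¬-not λ eq → not-constant i (go eq)
          where
          go : side (i + 1) ≡ side i → ∀ k → side (i + k) ≡ side i
          go eq 0 = cong side (+-identityʳ i)
          go eq 1 = eq
          go eq (suc (suc k)) = trans (cong side (linear (i ∷ k ∷ []) λ i k → ⊢ i ⊕ (# 2 ⊕ k) ≡′ i ⊕ k ⊕ # 2))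
                                      (trans (p (i + k)) (go eq k))

        -- The chords inject two classes mod δ of one side into the single class
        -- of the other side.
        unbalanced : .{{_ : NonZero δ}} → ∀ q → n ≡ q * δ → ∀ b {l₁ l₂} ρ →
          l₁ < δ → l₂ < δ → l₁ ≢ l₂ → side l₁ ≡ b → side l₂ ≡ b →
          (∀ j → j < δ → j ≡ ρ ⊎ side j ≡ b) → ⊥
        unbalanced q n≡qδ b {l₁} {l₂} ρ l₁<δ l₂<δ l₁≢l₂ side₁ side₂ only =
          case pigeonhole (n<1+n q) target of λ
            { (x , y , x<y , eq) → distinct x y x<y (target-injective x y eq) }
          where
          -- All `q` positions of class `l₁` and a single one of class `l₂` are already too many for
          -- the `q` places in class `ρ`.
          position : Fin (suc q) → ℕ
          position zero    = l₂
          position (suc k) = l₁ + toℕ k * δ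

          position<n : ∀ x → position x < q * δ
          position<n zero    = <-≤-trans l₂<δ (m≤n*m δ q {{>-nonZero (0<q q n≡qδ)}})
            where
            0<q : ∀ q → n ≡ q * δ → 0 < q
            0<q zero    eq = ⊥-elim (<-irrefl (sym eq) 0<n)
            0<q (suc q) eq = s≤s z≤n
          position<n (suc k) = <-≤-trans (+-monoˡ-< (toℕ k * δ) l₁<δ) (*-monoˡ-≤ δ (toℕ<n k))

          side-position : ∀ x → side (position x) ≡ b
          side-position zero    = side₂
          side-position (suc k) = trans (side-δ* (toℕ k) l₁) side₁

          end : Fin (suc q) → ℕ
          end x = (position x + f (position x)) % n

          end<n : ∀ x → end x < q * δ
          end<n x = <-≤-trans (m%n<n _ n) (≤-reflexive n≡qδ)

          side-% : ∀ j → side (j % δ) ≡ side j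
          side-% j = trans (sym (side-δ* (j / δ) (j % δ))) (cong side (sym (m≡m%n+[m/n]*n j δ)))

          side-end : ∀ x → side (end x % δ) ≡ not b
          side-end x = begin
            side (end x % δ)                   ≡⟨ side-% (end x) ⟩
            side (end x)                       ≡⟨ cong (λ y → y + d <ᵇ n) (f-% _) ⟩
            side (position x + f (position x)) ≡⟨ opposite (position x) ⟩
            not (side (position x))            ≡⟨ cong not (side-position x) ⟩
            not b                              ∎
            where open ≡-Reasoning

          end%δ : ∀ x → end x % δ ≡ ρ
          end%δ x = [ id , (λ eq → ⊥-elim (not-¬ eq (side-end x))) ]′ (only (end x % δ) (m%n<n (end x) δ))

          end/δ<q : ∀ x → end x / δ < q
          end/δ<q x = m<n*o⇒m/o<n (end<n x)

          target : Fin (suc q) → Fin q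
          target x = fromℕ< (end/δ<q x)

          target-injective : ∀ x y → target x ≡ target y → position x ≡ position y
          target-injective x y eq = begin
            position x     ≡⟨ sym (m<n⇒m%n≡m (<-≤-trans (position<n x) (≤-reflexive (sym n≡qδ)))) ⟩
            position x % n ≡⟨ partner-injective (position x) (position y) ends ⟩
            position y % n ≡⟨ m<n⇒m%n≡m (<-≤-trans (position<n y) (≤-reflexive (sym n≡qδ))) ⟩
            position y     ∎
            where
            open ≡-Reasoning
            quotients : end x / δ ≡ end y / δ
            quotients = trans (sym (toℕ-fromℕ< (end/δ<q x)))
                              (trans (cong toℕ eq) (toℕ-fromℕ< (end/δ<q y)))
            ends : end x ≡ end y
            ends = trans (m≡m%n+[m/n]*n (end x) δ)
              (trans (cong₂ (λ r t → r + t * δ) (trans (end%δ x) (sym (end%δ y))) quotients)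
                     (sym (m≡m%n+[m/n]*n (end y) δ)))

          distinct : ∀ x y → toℕ x < toℕ y → position x ≢ position y
          distinct zero    (suc k) _        eq = l₁≢l₂ (begin
            l₁                   ≡⟨ sym (m<n⇒m%n≡m l₁<δ) ⟩
            l₁ % δ               ≡⟨ sym ([m+kn]%n≡m%n l₁ (toℕ k) δ) ⟩
            (l₁ + toℕ k * δ) % δ ≡⟨ cong (_% δ) (sym eq) ⟩
            l₂ % δ               ≡⟨ m<n⇒m%n≡m l₂<δ ⟩
            l₂                   ∎)
            where open ≡-Reasoning
          distinct (suc k) (suc k′) (s≤s k<k′) eq =
            <-irrefl (*-cancelʳ-≡ (toℕ k) (toℕ k′) δ (+-cancelˡ-≡ l₁ _ _ eq)) k<k′

        -- Directions alternating singly

        module Alternating (alt : ∀ i → side (i + 1) ≡ not (side i)) where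

          even : ∀ j i → side (i + 2 * j) ≡ side i
          even zero    i = cong side (+-identityʳ i)
          even (suc j) i = begin
            side (i + 2 * suc j)     ≡⟨ cong side (linear (i ∷ j ∷ [])
                                          λ i j → ⊢ i ⊕ 2 ⊗ (# 1 ⊕ j) ≡′ i ⊕ 2 ⊗ j ⊕ # 1 ⊕ # 1) ⟩
            side (i + 2 * j + 1 + 1) ≡⟨ alt _ ⟩
            not (side (i + 2 * j + 1)) ≡⟨ cong not (alt _) ⟩
            not (not (side (i + 2 * j))) ≡⟨ not-involutive _ ⟩
            side (i + 2 * j)         ≡⟨ even j i ⟩
            side i                   ∎
            where open ≡-Reasoning

          odd : ∀ j i → side (i + (1 + 2 * j)) ≡ not (side i)
          odd j i = begin
            side (i + (1 + 2 * j)) ≡⟨ cong side (sym (+-assoc i 1 _)) ⟩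
            side (i + 1 + 2 * j)   ≡⟨ even j (i + 1) ⟩
            side (i + 1)           ≡⟨ alt i ⟩
            not (side i)           ∎
            where open ≡-Reasoning

          n-even : ∀ j → n ≢ 1 + 2 * j
          n-even j eq with side 0 | odd j 0 | side-periodic* 1 0
          ... | b | p | q with trans (sym q) (trans (cong side (trans (+-identityʳ n) eq)) p)
          n-even j eq | true  | p | q | ()
          n-even j eq | false | p | q | ()

          both : ∀ b → ∃[ a ] side a ≡ b
          both b with side 0 in e
          both true  | true  = 0 , e
          both false | false = 0 , e
          both false | true  = 1 , trans (alt 0) (cong not e)
          both true  | false = 1 , trans (alt 0) (cong not e)

          module _ (m r : ℕ) (n≡ : n ≡ 3 * m + r) (r≤2 : r ≤ 2) (d≡ : d ≡ 2 * m) where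

            e : ℕ
            e = 1 + d

            short′ : ∀ i → side i ≡ true → f i + 1 ≤ m + r
            short′ i p = linear (f i ∷ d ∷ n ∷ m ∷ r ∷ [])
              (λ f d n m r → n ≡′ 3 ⊗ m ⊕ r ⇒ d ≡′ 2 ⊗ m ⇒ # 1 ⊕ (f ⊕ d) ≤′ n ⇒ ⊢ f ⊕ # 1 ≤′ m ⊕ r)
              n≡ d≡ (side-true p)

            side-e : ∀ a → side (a + e) ≡ not (side a)
            side-e a = trans (cong (λ x → side (a + (1 + x))) d≡) (odd m a)

            far-end : ∀ a → side a ≡ true → n ≤ e + f (a + e)
            far-end a p = linear (f (a + e) ∷ d ∷ n ∷ m ∷ r ∷ [])
              (λ f d n m r → n ≡′ 3 ⊗ m ⊕ r ⇒ d ≡′ 2 ⊗ m ⇒ r ≤′ # 2 ⇒ # 1 ⊕ d ≤′ f ⇒ ⊢ n ≤′ # 1 ⊕ d ⊕ f)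
              n≡ d≡ r≤2 (long (trans (side-e a) (cong not p)))

            -- Since `e` is odd, an even `k` puts the hole in the same direction class as `a + e`,
            -- and no chord joins positions of one class.
            far-end≢ : ∀ a j → e + f (a + e) ≢ n + suc (2 * j)
            far-end≢ a j eq = same-side (a + e) (a + (1 + 2 * j)) 1 (side-e a) (odd j a)
              (linear (a ∷ f (a + e) ∷ d ∷ n ∷ j ∷ [])
                (λ a f d n j → # 1 ⊕ d ⊕ f ≡′ n ⊕ (# 1 ⊕ 2 ⊗ j) ⇒
                  ⊢ a ⊕ (# 1 ⊕ d) ⊕ f ≡′ a ⊕ (# 1 ⊕ 2 ⊗ j) ⊕ 1 ⊗ n) eq)

            -- For `k = 2` every condition of a punctured arc holds except possibly `f a ≢ 3`. The
            -- tight one is that the chord at `a + 4`, of length at most m + 1, ends by `a + e` with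
            -- e = 2 m + 1; this is where `4 ≤ m` comes from.
            all-three : 4 ≤ m → (∀ a → ¬ PuncturedArc n f e 2 a) → ∀ a → side a ≡ true → f a ≡ 3
            all-three 4≤m fails₂ a p with f a ≟ 3
            ... | yes q = q
            ... | no  q = ⊥-elim (fails₂ a
              ( m≤n⇒m≤1+n (short p) , q , far-end a p , far-end≢ a 1 , s≤s z≤n
              , linear (d ∷ m ∷ []) (λ d m → d ≡′ 2 ⊗ m ⇒ # 4 ≤′ m ⇒ ⊢ # 5 ≤′ # 1 ⊕ d) d≡ 4≤m
              , bound (f (a + 2)) d m r d≡ 4≤m r≤2 (short′ (a + 2) (trans (even 1 a) p))
              , inj₁ (bound′ (f (a + 4)) d m r d≡ 4≤m r≤2 (short′ (a + 4) (trans (even 2 a) p)))))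
              where
              bound = λ f d m r → linear (f ∷ d ∷ m ∷ r ∷ [])
                λ f d m r → d ≡′ 2 ⊗ m ⇒ # 4 ≤′ m ⇒ r ≤′ # 2 ⇒ f ⊕ # 1 ≤′ m ⊕ r ⇒ ⊢ # 2 ⊕ f ≤′ # 1 ⊕ d
              bound′ = λ f d m r → linear (f ∷ d ∷ m ∷ r ∷ [])
                λ f d m r → d ≡′ 2 ⊗ m ⇒ # 4 ≤′ m ⇒ r ≤′ # 2 ⇒ f ⊕ # 1 ≤′ m ⊕ r ⇒ ⊢ # 4 ⊕ f ≤′ # 1 ⊕ d

            -- With length 3 throughout, the chord at `a` misses the hole at `a + 5`, and the chords
            -- at `a + 4` and `a + 6` end by `a + 9`, which is inside because `e` is at least 9.
            large : 4 ≤ m → (∀ a → ¬ PuncturedArc n f e 2 a) → (∀ a → ¬ PuncturedArc n f e 4 a) → ⊥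
            large 4≤m fails₂ fails₄ = fails₄ a
              ( m≤n⇒m≤1+n (short p)
              , (λ q → case trans (sym q) (three a p) of λ ())
              , far-end a p , far-end≢ a 2 , s≤s z≤n
              , linear (d ∷ m ∷ []) (λ d m → d ≡′ 2 ⊗ m ⇒ # 4 ≤′ m ⇒ ⊢ # 7 ≤′ # 1 ⊕ d) d≡ 4≤m
              , linear (f (a + 4) ∷ d ∷ m ∷ []) (λ f d m → d ≡′ 2 ⊗ m ⇒ # 4 ≤′ m ⇒ f ≡′ # 3 ⇒ ⊢ # 4 ⊕ f ≤′ # 1 ⊕ d)
                  d≡ 4≤m (three (a + 4) (trans (even 2 a) p))
              , inj₁ (linear (f (a + 6) ∷ d ∷ m ∷ []) (λ f d m → d ≡′ 2 ⊗ m ⇒ # 4 ≤′ m ⇒ f ≡′ # 3 ⇒ ⊢ # 6 ⊕ f ≤′ # 1 ⊕ d)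
                  d≡ 4≤m (three (a + 6) (trans (even 3 a) p))))
              where
              a = proj₁ (both true)
              p = proj₂ (both true)
              three = all-three 4≤m fails₂

            -- Here `short′` leaves only the lengths 2 and 3, and an even length would join
            -- positions of the same direction.
            all-three′ : m + r ≤ 4 → ∀ a → side a ≡ true → f a ≡ 3
            all-three′ m+r≤4 a p = [ (λ q → ⊥-elim (same-side a (a + 2) 0 p (trans (even 1 a) p)
                                      (trans (cong (a +_) q) (sym (+-identityʳ (a + 2)))))) , id ]′
              (two-or-three (f a) (2≤f a) (linear (f a ∷ m ∷ r ∷ [])
                (λ x m r → x ⊕ # 1 ≤′ m ⊕ r ⇒ m ⊕ r ≤′ # 4 ⇒ ⊢ x ≤′ # 3) (short′ a p) m+r≤4))

            back-three : m + r ≤ 4 → ∀ a → side a ≡ false → f a + 3 ≡ n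
            back-three m+r≤4 a p = trans
              (cong (f a +_) (sym (all-three′ m+r≤4 (a + f a) (trans (opposite a) (cong not p))))) (back a)

            -- Unlike in `large`, the arc starts at a backward position. Its chord has length 7 =
            -- `e` and joins the two ends of the arc, while both cycle neighbours of the hole have
            -- forward chords of length 3.
            ten : m ≡ 3 → r ≡ 1 → ¬ (∀ a → ¬ PuncturedArc n f e 1 a)
            ten refl refl fails₁ = fails₁ a
              ( linear (f a ∷ d ∷ n ∷ []) (λ x d n → n ≡′ # 10 ⇒ d ≡′ # 6 ⇒ x ⊕ # 3 ≡′ n ⇒ ⊢ x ≤′ # 1 ⊕ d) n≡ d≡ fa
              , (λ eq → case linear (f a ∷ n ∷ []) (λ x n → n ≡′ # 10 ⇒ x ⊕ # 3 ≡′ n ⇒ x ≡′ # 2 ⇒ ⊢ # 1 ≤′ # 0)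
                  n≡ fa eq of λ ())
              , linear (f (a + e) ∷ d ∷ n ∷ [])
                  (λ x d n → n ≡′ # 10 ⇒ d ≡′ # 6 ⇒ x ≡′ # 3 ⇒ ⊢ n ≤′ # 1 ⊕ d ⊕ x) n≡ d≡ fe
              , (λ eq → case linear (f (a + e) ∷ d ∷ n ∷ [])
                  (λ x d n → n ≡′ # 10 ⇒ d ≡′ # 6 ⇒ x ≡′ # 3 ⇒ # 1 ⊕ d ⊕ x ≡′ n ⊕ # 2 ⇒ ⊢ # 1 ≤′ # 0)
                  n≡ d≡ fe eq of λ ())
              , ≤-refl
              , linear (d ∷ []) (λ d → d ≡′ # 6 ⇒ ⊢ # 4 ≤′ # 1 ⊕ d) d≡
              , linear (f (a + 1) ∷ d ∷ []) (λ x d → d ≡′ # 6 ⇒ x ≡′ # 3 ⇒ ⊢ # 1 ⊕ x ≤′ # 1 ⊕ d)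
                  d≡ (three (a + 1) (trans (alt a) (cong not p)))
              , inj₁ (linear (f (a + 3) ∷ d ∷ []) (λ x d → d ≡′ # 6 ⇒ x ≡′ # 3 ⇒ ⊢ # 3 ⊕ x ≤′ # 1 ⊕ d)
                  d≡ (three (a + 3) (trans (odd 1 a) (cong not p)))))
              where
              a = proj₁ (both false)
              p = proj₂ (both false)
              three = all-three′ ≤-refl
              fa = back-three ≤-refl a p
              fe = three (a + e) (trans (side-e a) (cong not p))

            eight : m ≡ 2 → r ≡ 2 → Exceptional n f
            eight refl refl = n≡ , proj₁ (both true) , inj₁ (table _ (proj₂ (both true)))
              where
              table : ∀ a → side a ≡ true → ∀ i → f (a + i) ≡ cube i
              table a p 0 = trans (cong f (+-identityʳ a)) (all-three′ ≤-refl a p)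
              table a p 1 = +-cancelʳ-≡ 3 _ 5 (trans (back-three ≤-refl (a + 1) (trans (alt a) (cong not p))) n≡)
              table a p (suc (suc i)) = trans (cong f (sym (+-assoc a 2 i))) (table (a + 2) (trans (even 1 a) p) i)

        -- Directions alternating in pairs

        Pattern : ℕ → Set
        Pattern j = side j ≡ true × side (j + 1) ≡ true × side (j + 2) ≡ false × side (j + 3) ≡ false

        module Paired (side-4 : ∀ k i → side (i + 4 * k) ≡ side i) where

          class : ∀ {j b} c k i → side (j + c) ≡ b → i ≡ c + 4 * k → side (j + i) ≡ b
          class {j} c k i p refl = trans (trans (cong side (sym (+-assoc j c _))) (side-4 k (j + c))) p

          class₀ : ∀ {j b} k i → side j ≡ b → i ≡ 4 * k → side (j + i) ≡ b
          class₀ {j} k i p refl = trans (side-4 k j) p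

          pattern-shift : ∀ k {j} → Pattern j → Pattern (j + 4 * k)
          pattern-shift k {j} (p₀ , p₁ , p₂ , p₃) = class₀ k _ p₀ refl , next 1 p₁ , next 2 p₂ , next 3 p₃
            where
            next : ∀ c {b} → side (j + c) ≡ b → side (j + 4 * k + c) ≡ b
            next c p = trans (cong side (+-assoc j (4 * k) c)) (class c k _ p (+-comm (4 * k) c))

          module _ (n≡8 : n ≡ 8) (d≡4 : d ≡ 4) where

            private
              ≤3 : ∀ {i} → side i ≡ true → f i ≤ 3
              ≤3 {i} p = linear (f i ∷ d ∷ n ∷ [])
                (λ f d n → n ≡′ # 8 ⇒ d ≡′ # 4 ⇒ # 1 ⊕ (f ⊕ d) ≤′ n ⇒ ⊢ f ≤′ # 3) n≡8 d≡4 (side-true p)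

              back′ : ∀ i {x} → f i ≡ x → x + f (i + x) ≡ 8
              back′ i refl = trans (back i) n≡8

            two₁ : ∀ {j} → Pattern j → f (j + 1) ≡ 2
            two₁ {j} P@(p₀ , p₁ , _) = [ id , (λ q → ⊥-elim (same-side (j + 1) (j + 4) 0 p₁ (trans (side-4 1 j) p₀)
                    (trans (cong (j + 1 +_) q) (trans (+-assoc j 1 3) (sym (+-identityʳ (j + 4))))))) ]′
              (two-or-three _ (2≤f (j + 1)) (≤3 p₁))

            six₃ : ∀ {j} → Pattern j → f (j + 3) ≡ 6
            six₃ {j} P = +-cancelˡ-≡ 2 _ 6 (trans (cong (λ x → 2 + f x) (sym (+-assoc j 1 2))) (back′ (j + 1) (two₁ P)))

            -- Directions alone do not exclude length 3 here, since `j + 3` is a backward position.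
            -- But the chord at `j + 3` is already known to be the one from `j + 1`.
            two₀ : ∀ {j} → Pattern j → f j ≡ 2
            two₀ {j} P@(p₀ , _) =
              [ id , (λ q → ⊥-elim (case trans (sym (cong (3 +_) (six₃ P))) (back′ j q) of λ ())) ]′
              (two-or-three _ (2≤f j) (≤3 p₀))

            six₂ : ∀ {j} → Pattern j → f (j + 2) ≡ 6
            six₂ {j} P = +-cancelˡ-≡ 2 _ 6 (back′ j (two₀ P))

            paired-eight : ∀ {j} → Pattern j → ∀ i → f (j + i) ≡ diamonds i
            paired-eight {j} P 0 = trans (cong f (+-identityʳ j)) (two₀ P)
            paired-eight P 1 = two₁ P
            paired-eight P 2 = six₂ P
            paired-eight P 3 = six₃ P
            paired-eight {j} P (suc (suc (suc (suc i)))) =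
              trans (cong f (sym (+-assoc j 4 i))) (paired-eight (pattern-shift 1 P) i)

          -- The case n = 8 has been split off, so `q` counts from the next size 20. With m = 4 q +
          -- 6 the two holes are those at m - 3 and m + 1.
          module _ (q : ℕ) (n≡ : n ≡ 12 * q + 20) (d≡ : d ≡ 8 * q + 12)
                   (fails₁ : ∀ a → ¬ PuncturedArc n f (1 + d) (4 * q + 3) a)
                   (fails₂ : ∀ a → ¬ PuncturedArc n f (1 + d) (4 * q + 7) a) where

            short″ : ∀ i → side i ≡ true → f i ≤ 4 * q + 7
            short″ i p = linear (f i ∷ d ∷ n ∷ q ∷ [])
              (λ f d n q → n ≡′ 12 ⊗ q ⊕ # 20 ⇒ d ≡′ 8 ⊗ q ⊕ # 12 ⇒ # 1 ⊕ (f ⊕ d) ≤′ n ⇒ ⊢ f ≤′ 4 ⊗ q ⊕ # 7)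
              n≡ d≡ (side-true p)

            f≡ : ∀ i j {x} → f j ≡ x → i ≡ j → f i ≡ x
            f≡ i j p refl = p

            -- The claim is that the chord at `w` ends at `j + n`, hence at `j`. One less would be a
            -- backward position, and still shorter contradicts `long`. Were it longer, it would
            -- lead back into the arc that starts at `j + 1`, and the hole just before `w` would
            -- work.
            far : ∀ {j} → Pattern j → f (j + (4 * q + 6)) ≡ 8 * q + 14
            far {j} P@(p₀ , p₁ , p₂ , p₃) =
              ≤-antisym (≮⇒≥ too-far) (linear (f w ∷ q ∷ [])
                (λ f q → # 1 ⊕ (8 ⊗ q ⊕ # 13) ≤′ f ⇒ ⊢ 8 ⊗ q ⊕ # 14 ≤′ f) (≤∧≢⇒< longer (f≢ ∘ sym)))
              where
              w = j + (4 * q + 6)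

              side-w : side w ≡ false
              side-w = class 2 (q + 1) _ p₂ (linear (q ∷ []) λ q → ⊢ 4 ⊗ q ⊕ # 6 ≡′ # 2 ⊕ 4 ⊗ (q ⊕ # 1))

              longer : 8 * q + 13 ≤ f w
              longer = linear (f w ∷ d ∷ q ∷ [])
                (λ f d q → d ≡′ 8 ⊗ q ⊕ # 12 ⇒ # 1 ⊕ d ≤′ f ⇒ ⊢ 8 ⊗ q ⊕ # 13 ≤′ f) d≡ (long side-w)

              f≢ : f w ≢ 8 * q + 13
              f≢ eq = same-side w (j + (12 * q + 19)) 0 side-w
                (class 3 (3 * q + 4) _ p₃ (linear (q ∷ []) λ q → ⊢ 12 ⊗ q ⊕ # 19 ≡′ # 3 ⊕ 4 ⊗ (3 ⊗ q ⊕ # 4)))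
                (linear (j ∷ f w ∷ q ∷ []) (λ j f q → f ≡′ 8 ⊗ q ⊕ # 13 ⇒
                  ⊢ j ⊕ (4 ⊗ q ⊕ # 6) ⊕ f ≡′ j ⊕ (12 ⊗ q ⊕ # 19) ⊕ # 0) eq)

              too-far : ¬ (8 * q + 14 < f w)
              too-far f> = fails₁ a
                ( m≤n⇒m≤1+n (short p₁)
                , (λ eq → same-side a (a + (4 * q + 4)) 0 p₁
                    (class₀ (q + 1) _ p₁ (linear (q ∷ []) λ q → ⊢ 4 ⊗ q ⊕ # 4 ≡′ 4 ⊗ (q ⊕ # 1)))
                    (linear (a ∷ f a ∷ q ∷ []) (λ a f q → f ≡′ # 1 ⊕ (4 ⊗ q ⊕ # 3) ⇒
                      ⊢ a ⊕ f ≡′ a ⊕ (4 ⊗ q ⊕ # 4) ⊕ # 0) eq))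
                , linear (f (a + (1 + d)) ∷ d ∷ n ∷ q ∷ [])
                    (λ f d n q → d ≡′ 8 ⊗ q ⊕ # 12 ⇒ n ≡′ 12 ⊗ q ⊕ # 20 ⇒ # 1 ⊕ d ≤′ f ⇒ ⊢ n ≤′ # 1 ⊕ d ⊕ f)
                    d≡ n≡ end-long
                , (λ eq → case linear (f (a + (1 + d)) ∷ d ∷ n ∷ q ∷ [])
                    (λ f d n q → d ≡′ 8 ⊗ q ⊕ # 12 ⇒ n ≡′ 12 ⊗ q ⊕ # 20 ⇒ # 1 ⊕ d ≤′ f ⇒
                      # 1 ⊕ d ⊕ f ≡′ n ⊕ (# 1 ⊕ (4 ⊗ q ⊕ # 3)) ⇒ ⊢ # 1 ≤′ # 0)
                    d≡ n≡ end-long eq of λ ())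
                , linear (q ∷ []) (λ q → ⊢ # 1 ≤′ 4 ⊗ q ⊕ # 3)
                , linear (d ∷ q ∷ []) (λ d q → d ≡′ 8 ⊗ q ⊕ # 12 ⇒ ⊢ 4 ⊗ q ⊕ # 3 ⊕ # 3 ≤′ # 1 ⊕ d) d≡
                , linear (f (a + (4 * q + 3)) ∷ d ∷ q ∷ [])
                    (λ f d q → d ≡′ 8 ⊗ q ⊕ # 12 ⇒ f ≤′ 4 ⊗ q ⊕ # 7 ⇒ ⊢ 4 ⊗ q ⊕ # 3 ⊕ f ≤′ # 1 ⊕ d) d≡
                    (short″ _ (trans (cong side (linear (j ∷ q ∷ []) λ j q → ⊢ j ⊕ # 1 ⊕ (4 ⊗ q ⊕ # 3) ≡′ j ⊕ 4 ⊗ (q ⊕ # 1)))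
                                     (trans (side-4 (q + 1) j) p₀)))
                , inj₂ (linear (f (a + (2 + (4 * q + 3))) ∷ f w ∷ n ∷ q ∷ [])
                    (λ g f n q → n ≡′ 12 ⊗ q ⊕ # 20 ⇒ # 1 ⊕ (8 ⊗ q ⊕ # 14) ≤′ f ⇒ g ≡′ f ⇒ ⊢ n ≤′ # 2 ⊕ (4 ⊗ q ⊕ # 3) ⊕ g)
                    n≡ f> (cong f (linear (j ∷ q ∷ []) λ j q →
                      ⊢ j ⊕ # 1 ⊕ (# 2 ⊕ (4 ⊗ q ⊕ # 3)) ≡′ j ⊕ (4 ⊗ q ⊕ # 6)))))
                where
                a = j + 1
                end-long : d < f (a + (1 + d))
                end-long = long (trans (cong side (linear (j ∷ d ∷ q ∷ []) (λ j d q → d ≡′ 8 ⊗ q ⊕ # 12 ⇒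
                    ⊢ j ⊕ # 1 ⊕ (# 1 ⊕ d) ≡′ j ⊕ (# 2 ⊕ 4 ⊗ (2 ⊗ q ⊕ # 3))) d≡))
                  (class 2 (2 * q + 3) _ p₂ refl))

            -- Every position of this class is the `w` of some shifted pattern: `j + 2 + n` is
            -- reached from `j` by 4 (2 q + 4) + (4 q + 6).
            far₂ : ∀ {j} → Pattern j → f (j + 2) ≡ 8 * q + 14
            far₂ {j} P = trans (sym (periodic (j + 2))) (f≡ (j + 2 + n) _ (far (pattern-shift (2 * q + 4) P))
              (linear (j ∷ n ∷ q ∷ []) (λ j n q → n ≡′ 12 ⊗ q ⊕ # 20 ⇒
                ⊢ j ⊕ # 2 ⊕ n ≡′ j ⊕ 4 ⊗ (2 ⊗ q ⊕ # 4) ⊕ (4 ⊗ q ⊕ # 6)) n≡))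

            near : ∀ {j} → Pattern j → f j ≡ 4 * q + 6
            near {j} P = linear (f j ∷ f w ∷ f (w + f w) ∷ n ∷ q ∷ [])
              (λ f g h n q → n ≡′ 12 ⊗ q ⊕ # 20 ⇒ g ≡′ 8 ⊗ q ⊕ # 14 ⇒ g ⊕ h ≡′ n ⇒ h ≡′ f ⇒ ⊢ f ≡′ 4 ⊗ q ⊕ # 6)
              n≡ (far P) (back w) (trans (cong f (linear (j ∷ f w ∷ n ∷ q ∷ [])
                (λ j g n q → n ≡′ 12 ⊗ q ⊕ # 20 ⇒ g ≡′ 8 ⊗ q ⊕ # 14 ⇒ ⊢ j ⊕ (4 ⊗ q ⊕ # 6) ⊕ g ≡′ j ⊕ n)
                n≡ (far P))) (periodic j))
              where w = j + (4 * q + 6)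

            -- By `near` the chord at `a + k`, with k = 4 q + 7, ends exactly at the last vertex of
            -- the arc, so one chord both serves that end and bridges the hole. The vertex behind
            -- the hole has class 2, and its chord leads back into the arc.
            no-pattern : ∀ {j} → ¬ Pattern j
            no-pattern {j} P@(p₀ , p₁ , p₂ , p₃) = fails₂ a
              ( m≤n⇒m≤1+n (short p₁)
              , (λ eq → case linear (f a ∷ q ∷ []) (λ f q → f ≤′ 4 ⊗ q ⊕ # 7 ⇒ f ≡′ # 1 ⊕ (4 ⊗ q ⊕ # 7) ⇒ ⊢ # 1 ≤′ # 0)
                  (short″ a p₁) eq of λ ())
              , linear (f (a + (1 + d)) ∷ d ∷ n ∷ q ∷ [])
                  (λ f d n q → d ≡′ 8 ⊗ q ⊕ # 12 ⇒ n ≡′ 12 ⊗ q ⊕ # 20 ⇒ f ≡′ 8 ⊗ q ⊕ # 14 ⇒ ⊢ n ≤′ # 1 ⊕ d ⊕ f)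
                  d≡ n≡ end
              , (λ eq → case linear (f (a + (1 + d)) ∷ d ∷ n ∷ q ∷ [])
                  (λ f d n q → d ≡′ 8 ⊗ q ⊕ # 12 ⇒ n ≡′ 12 ⊗ q ⊕ # 20 ⇒ f ≡′ 8 ⊗ q ⊕ # 14 ⇒
                    # 1 ⊕ d ⊕ f ≡′ n ⊕ (# 1 ⊕ (4 ⊗ q ⊕ # 7)) ⇒ ⊢ # 1 ≤′ # 0)
                  d≡ n≡ end eq of λ ())
              , linear (q ∷ []) (λ q → ⊢ # 1 ≤′ 4 ⊗ q ⊕ # 7)
              , linear (d ∷ q ∷ []) (λ d q → d ≡′ 8 ⊗ q ⊕ # 12 ⇒ ⊢ 4 ⊗ q ⊕ # 7 ⊕ # 3 ≤′ # 1 ⊕ d) d≡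
              , linear (f (a + (4 * q + 7)) ∷ d ∷ q ∷ [])
                  (λ f d q → d ≡′ 8 ⊗ q ⊕ # 12 ⇒ f ≡′ 4 ⊗ q ⊕ # 6 ⇒ ⊢ 4 ⊗ q ⊕ # 7 ⊕ f ≤′ # 1 ⊕ d) d≡
                  (f≡ _ _ (near (pattern-shift (q + 2) P))
                    (linear (j ∷ q ∷ []) λ j q → ⊢ j ⊕ # 1 ⊕ (4 ⊗ q ⊕ # 7) ≡′ j ⊕ 4 ⊗ (q ⊕ # 2)))
              , inj₂ (linear (f (a + (2 + (4 * q + 7))) ∷ n ∷ q ∷ [])
                  (λ g n q → n ≡′ 12 ⊗ q ⊕ # 20 ⇒ g ≡′ 8 ⊗ q ⊕ # 14 ⇒ ⊢ n ≤′ # 2 ⊕ (4 ⊗ q ⊕ # 7) ⊕ g)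
                  n≡ (f≡ _ _ (far₂ (pattern-shift (q + 2) P))
                    (linear (j ∷ q ∷ []) λ j q → ⊢ j ⊕ # 1 ⊕ (# 2 ⊕ (4 ⊗ q ⊕ # 7)) ≡′ j ⊕ 4 ⊗ (q ⊕ # 2) ⊕ # 2))))
              where
              a = j + 1
              end : f (a + (1 + d)) ≡ 8 * q + 14
              end = f≡ _ _ (far₂ (pattern-shift (2 * q + 3) P)) (linear (j ∷ d ∷ q ∷ []) (λ j d q → d ≡′ 8 ⊗ q ⊕ # 12 ⇒
                ⊢ j ⊕ # 1 ⊕ (# 1 ⊕ d) ≡′ j ⊕ 4 ⊗ (2 ⊗ q ⊕ # 3) ⊕ # 2) d≡)

-- Case distinction by n modulo 3 and modulo 4

module _ {n f} (C : Chords n f) where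
  open Shape n f C

  private
    below : ∀ {P : ℕ → Set} k → (∀ j → j < k → P j) → P k → ∀ j → j < suc k → P j
    below k p q j (s≤s j≤k) with m≤n⇒m<n∨m≡n j≤k
    ... | inj₁ j<k  = p j j<k
    ... | inj₂ refl = q

    four : (P : ℕ → Set) → P 0 → P 1 → P 2 → P 3 → ∀ j → j < 4 → P j
    four P p₀ p₁ p₂ p₃ = below 3 (below 2 (below 1 (below 0 (λ _ ()) p₀) p₁) p₂) p₃

    three : (P : ℕ → Set) → P 0 → P 1 → P 2 → ∀ j → j < 3 → P j
    three P p₀ p₁ p₂ = below 2 (below 1 (below 0 (λ _ ()) p₀) p₁) p₂

    even-or-odd : ∀ m → ∃[ j ] (m ≡ 2 * j ⊎ m ≡ 1 + 2 * j)
    even-or-odd zero = 0 , inj₁ refl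
    even-or-odd (suc m) with even-or-odd m
    ... | j , inj₁ eq = j , inj₂ (cong suc eq)
    ... | j , inj₂ eq = suc j , inj₁ (linear (m ∷ j ∷ []) (λ m j → m ≡′ # 1 ⊕ 2 ⊗ j ⇒ ⊢ # 1 ⊕ m ≡′ 2 ⊗ (# 1 ⊕ j)) eq)

    positive : ∀ m r → n ≡ 3 * m + r → r ≤ 3 → 1 ≤ m
    positive zero    r n≡ r≤3 = ⊥-elim (<-irrefl refl (≤-trans 4≤n (≤-trans (≤-reflexive n≡) r≤3)))
    positive (suc m) r n≡ r≤3 = s≤s z≤n

    _∙_ : ∀ {x y b : Bool} → x ≡ b → y ≡ b → y ≡ x
    p ∙ q = trans q (sym p)

  -- Three classes cannot be split evenly: in each of the eight cases two of them agree, and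
  -- `unbalanced` applies with the remaining class as `ρ`.
  no-multiple-of-3 : ∀ m d → n ≡ 3 * m → suc d ≡ 2 * m → ¬ (∀ a → ¬ ClosedArc n f d a)
  no-multiple-of-3 m d n≡ d≡ no-arc = absurd
    where
    n≤1+2d : n ≤ 1 + 2 * d
    n≤1+2d = linear (n ∷ m ∷ d ∷ []) (λ n m d → n ≡′ 3 ⊗ m ⇒ # 1 ⊕ d ≡′ 2 ⊗ m ⇒ # 1 ≤′ m ⇒
      ⊢ n ≤′ # 1 ⊕ 2 ⊗ d) n≡ d≡ (positive m 0 (trans n≡ (sym (+-identityʳ (3 * m)))) z≤n)
    3d : 3 * d + 3 ≡ 2 * n
    3d = linear (n ∷ m ∷ d ∷ []) (λ n m d → n ≡′ 3 ⊗ m ⇒ # 1 ⊕ d ≡′ 2 ⊗ m ⇒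
      ⊢ 3 ⊗ d ⊕ # 3 ≡′ 2 ⊗ n) n≡ d≡
    open NoClosedArc d n≤1+2d no-arc
    open Periodic 3 3d
    n≡m3 : n ≡ m * 3
    n≡m3 = trans n≡ (*-comm 3 m)
    absurd : ⊥
    absurd with side d 0 in e₀ | side d 1 in e₁ | side d 2 in e₂
    ... | true  | true  | true  =
      unbalanced m n≡m3 true {0} {1} 2 (<ᵇ⇒< 0 3 _) (<ᵇ⇒< 1 3 _) (λ ()) e₀ e₁ (three (λ j → j ≡ 2 ⊎ side d j ≡ true) (inj₂ e₀) (inj₂ e₁) (inj₁ refl))
    ... | true  | true  | false =
      unbalanced m n≡m3 true {0} {1} 2 (<ᵇ⇒< 0 3 _) (<ᵇ⇒< 1 3 _) (λ ()) e₀ e₁ (three (λ j → j ≡ 2 ⊎ side d j ≡ true) (inj₂ e₀) (inj₂ e₁) (inj₁ refl))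
    ... | true  | false | true  =
      unbalanced m n≡m3 true {0} {2} 1 (<ᵇ⇒< 0 3 _) (<ᵇ⇒< 2 3 _) (λ ()) e₀ e₂ (three (λ j → j ≡ 1 ⊎ side d j ≡ true) (inj₂ e₀) (inj₁ refl) (inj₂ e₂))
    ... | true  | false | false =
      unbalanced m n≡m3 false {1} {2} 0 (<ᵇ⇒< 1 3 _) (<ᵇ⇒< 2 3 _) (λ ()) e₁ e₂ (three (λ j → j ≡ 0 ⊎ side d j ≡ false) (inj₁ refl) (inj₂ e₁) (inj₂ e₂))
    ... | false | true  | true  =
      unbalanced m n≡m3 true {1} {2} 0 (<ᵇ⇒< 1 3 _) (<ᵇ⇒< 2 3 _) (λ ()) e₁ e₂ (three (λ j → j ≡ 0 ⊎ side d j ≡ true) (inj₁ refl) (inj₂ e₁) (inj₂ e₂))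
    ... | false | true  | false =
      unbalanced m n≡m3 false {0} {2} 1 (<ᵇ⇒< 0 3 _) (<ᵇ⇒< 2 3 _) (λ ()) e₀ e₂ (three (λ j → j ≡ 1 ⊎ side d j ≡ false) (inj₂ e₀) (inj₁ refl) (inj₂ e₂))
    ... | false | false | true  =
      unbalanced m n≡m3 false {0} {1} 2 (<ᵇ⇒< 0 3 _) (<ᵇ⇒< 1 3 _) (λ ()) e₀ e₁ (three (λ j → j ≡ 2 ⊎ side d j ≡ false) (inj₂ e₀) (inj₂ e₁) (inj₁ refl))
    ... | false | false | false =
      unbalanced m n≡m3 false {0} {1} 2 (<ᵇ⇒< 0 3 _) (<ᵇ⇒< 1 3 _) (λ ()) e₀ e₁ (three (λ j → j ≡ 2 ⊎ side d j ≡ false) (inj₂ e₀) (inj₂ e₁) (inj₁ refl))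

  module _ (m d : ℕ) (d≡ : d ≡ 2 * m)
           (no-arc : ∀ a → ¬ ClosedArc n f d a)
           (fails₁ : ∀ a → ¬ PuncturedArc n f (1 + d) 1 a)
           (fails₂ : ∀ a → ¬ PuncturedArc n f (1 + d) 2 a)
           (fails₄ : ∀ a → ¬ PuncturedArc n f (1 + d) 4 a) where

    -- Period 2 forces single alternation. Of the small sizes, 1 is below 4, for 4 a forward chord
    -- would have length at most 1, 7 is odd and cannot alternate, and 10 is treated by `ten`.
    exceptional₁ : n ≡ 3 * m + 1 → ⊥
    exceptional₁ n≡ = go m refl
      where
      n≤1+2d : n ≤ 1 + 2 * d
      n≤1+2d = linear (n ∷ m ∷ d ∷ []) (λ n m d → n ≡′ 3 ⊗ m ⊕ # 1 ⇒ d ≡′ 2 ⊗ m ⇒ # 1 ≤′ m ⇒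
        ⊢ n ≤′ # 1 ⊕ 2 ⊗ d) n≡ d≡ (positive m 1 n≡ (s≤s z≤n))
      3d : 3 * d + 2 ≡ 2 * n
      3d = linear (n ∷ m ∷ d ∷ []) (λ n m d → n ≡′ 3 ⊗ m ⊕ # 1 ⇒ d ≡′ 2 ⊗ m ⇒
        ⊢ 3 ⊗ d ⊕ # 2 ≡′ 2 ⊗ n) n≡ d≡
      open NoClosedArc d n≤1+2d no-arc
      open Periodic 2 3d
      open Alternating (2-periodic⇒alternating side-δ)
      go : ∀ m′ → m ≡ m′ → ⊥
      go 0 refl = case subst (4 ≤_) n≡ 4≤n of λ { (s≤s ()) }
      go 1 refl = case ≤-trans (+-monoˡ-≤ 1 (Chords.2≤f C (proj₁ (both true))))
                               (short′ m 1 n≡ (s≤s z≤n) d≡ _ (proj₂ (both true))) of λ { (s≤s (s≤s ())) }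
      go 2 refl = n-even 3 n≡
      go 3 refl = ten m 1 n≡ (s≤s z≤n) d≡ refl refl fails₁
      go (suc (suc (suc (suc m′)))) refl = large m 1 n≡ (s≤s z≤n) d≡ (s≤s (s≤s (s≤s (s≤s z≤n)))) fails₂ fails₄

    -- Odd `n` would make the directions constant, `n` ≡ 2 modulo 4 makes them alternate singly, and
    -- only multiples of 4 leave room for the paired pattern. The residue of `n` modulo 4 is read
    -- off from that of `m`.
    exceptional₂ : n ≡ 3 * m + 2 →
      (∀ a → ¬ PuncturedArc n f (1 + d) (m ∸ 3) a) →
      (∀ a → ¬ PuncturedArc n f (1 + d) (m + 1) a) →
      Exceptional n f
    exceptional₂ n≡ fails₅ fails₆ = by-residue (even-or-odd m) (even-or-odd _)
      where
      n≤1+2d : n ≤ 1 + 2 * d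
      n≤1+2d = linear (n ∷ m ∷ d ∷ []) (λ n m d → n ≡′ 3 ⊗ m ⊕ # 2 ⇒ d ≡′ 2 ⊗ m ⇒ # 1 ≤′ m ⇒
        ⊢ n ≤′ # 1 ⊕ 2 ⊗ d) n≡ d≡ (positive m 2 n≡ (s≤s (s≤s z≤n)))
      3d : 3 * d + 4 ≡ 2 * n
      3d = linear (n ∷ m ∷ d ∷ []) (λ n m d → n ≡′ 3 ⊗ m ⊕ # 2 ⇒ d ≡′ 2 ⊗ m ⇒
        ⊢ 3 ⊗ d ⊕ # 4 ≡′ 2 ⊗ n) n≡ d≡
      open NoClosedArc d n≤1+2d no-arc
      open Periodic 4 3d

      side-4 : ∀ k i → side d (i + 4 * k) ≡ side d i
      side-4 k i = trans (cong (λ x → side d (i + x)) (*-comm 4 k)) (side-δ* k i)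

      -- side has the periods n and 4, hence n mod 4.
      side-residue : ∀ ρ k → n ≡ ρ + 4 * k → ∀ i → side d (i + ρ) ≡ side d i
      side-residue ρ k n≡ i = trans (sym (side-4 k (i + ρ)))
        (trans (cong (side d) (trans (+-assoc i ρ _) (cong (i +_) (trans (sym n≡) (sym (+-identityʳ n))))))
               (side-periodic* d 1 i))

      alternating : (∀ i → side d (i + 2) ≡ side d i) → Exceptional n f
      alternating p = go m refl
        where
        open Alternating (2-periodic⇒alternating p)
        go : ∀ m′ → m ≡ m′ → Exceptional n f
        go 0 refl = ⊥-elim (case subst (4 ≤_) n≡ 4≤n of λ { (s≤s (s≤s ())) })
        go 1 refl = ⊥-elim (n-even 2 n≡)
        go 2 refl = eight m 2 n≡ ≤-refl d≡ refl refl
        go 3 refl = ⊥-elim (n-even 5 n≡)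
        go (suc (suc (suc (suc m′)))) refl =
          ⊥-elim (large m 2 n≡ ≤-refl d≡ (s≤s (s≤s (s≤s (s≤s z≤n)))) fails₂ fails₄)

      2-periodic : side d 2 ≡ side d 0 → side d 3 ≡ side d 1 → Exceptional n f
      2-periodic p₀ p₁ = alternating go
        where
        go : ∀ i → side d (i + 2) ≡ side d i
        go 0 = p₀
        go 1 = p₁
        go 2 = trans (side-4 1 0) (sym p₀)
        go 3 = trans (side-4 1 1) (sym p₁)
        go (suc (suc (suc (suc i)))) = trans (cong (side d) (+-comm 4 (i + 2)))
          (trans (side-4 1 (i + 2)) (trans (go i) (trans (sym (side-4 1 i)) (cong (side d) (+-comm i 4)))))

      -- Of the 16 ways to give directions to four classes, the ten uneven ones contradict
      -- `unbalanced`, two alternate singly, and the other four are rotations of `Pattern`.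
      multiple-of-4 : ∀ q → m ≡ 4 * q + 2 → Exceptional n f
      multiple-of-4 q m≡ = by-sides
        where
        open Paired side-4
        n≡4· : n ≡ (3 * q + 2) * 4
        n≡4· = trans (linear (n ∷ m ∷ q ∷ []) (λ n m q → n ≡′ 3 ⊗ m ⊕ # 2 ⇒ m ≡′ 4 ⊗ q ⊕ # 2 ⇒
          ⊢ n ≡′ 4 ⊗ (3 ⊗ q ⊕ # 2)) n≡ m≡) (*-comm 4 (3 * q + 2))

        paired : ∀ {j} → Pattern j → Exceptional n f
        paired {j} P = go q refl
          where
          go : ∀ q′ → q ≡ q′ → Exceptional n f
          go zero refl = n≡8 , j , inj₂ (paired-eight n≡8 (trans d≡ (cong (2 *_) m≡)) P)
            where
            n≡8 : n ≡ 8
            n≡8 = n≡4·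
          go (suc q′) refl = ⊥-elim (no-pattern q′
            (linear (n ∷ m ∷ q′ ∷ []) (λ n m q → n ≡′ 3 ⊗ m ⊕ # 2 ⇒ m ≡′ 4 ⊗ (# 1 ⊕ q) ⊕ # 2 ⇒
              ⊢ n ≡′ 12 ⊗ q ⊕ # 20) n≡ m≡)
            (linear (d ∷ m ∷ q′ ∷ []) (λ d m q → d ≡′ 2 ⊗ m ⇒ m ≡′ 4 ⊗ (# 1 ⊕ q) ⊕ # 2 ⇒
              ⊢ d ≡′ 8 ⊗ q ⊕ # 12) d≡ m≡)
            (subst (λ k → ∀ a → ¬ PuncturedArc n f (1 + d) k a) k≡₅ fails₅)
            (subst (λ k → ∀ a → ¬ PuncturedArc n f (1 + d) k a)
              (linear (m ∷ q′ ∷ []) (λ m q → m ≡′ 4 ⊗ (# 1 ⊕ q) ⊕ # 2 ⇒ ⊢ m ⊕ # 1 ≡′ 4 ⊗ q ⊕ # 7) m≡) fails₆)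
            P)
            where
            -- The truncated subtraction is exact, as `m` is at least 6. For `m ≤ 3` the value would
            -- be 0, which the condition `1 ≤ k` of a punctured arc rejects.
            k≡₅ : m ∸ 3 ≡ 4 * q′ + 3
            k≡₅ = trans (cong (_∸ 3) (linear (m ∷ q′ ∷ []) (λ m q → m ≡′ 4 ⊗ (# 1 ⊕ q) ⊕ # 2 ⇒
                    ⊢ m ≡′ 4 ⊗ q ⊕ # 3 ⊕ # 3) m≡)) (m+n∸n≡m (4 * q′ + 3) 3)

        by-sides : Exceptional n f
        by-sides with side d 0 in e₀ | side d 1 in e₁ | side d 2 in e₂ | side d 3 in e₃
        ... | true  | true  | true  | true  = ⊥-elim (
          unbalanced (3 * q + 2) n≡4· true {0} {1} 3 (<ᵇ⇒< 0 4 _) (<ᵇ⇒< 1 4 _) (λ ()) e₀ e₁ (four (λ j → j ≡ 3 ⊎ side d j ≡ true) (inj₂ e₀) (inj₂ e₁) (inj₂ e₂) (inj₁ refl)))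
        ... | true  | true  | true  | false = ⊥-elim (
          unbalanced (3 * q + 2) n≡4· true {0} {1} 3 (<ᵇ⇒< 0 4 _) (<ᵇ⇒< 1 4 _) (λ ()) e₀ e₁ (four (λ j → j ≡ 3 ⊎ side d j ≡ true) (inj₂ e₀) (inj₂ e₁) (inj₂ e₂) (inj₁ refl)))
        ... | true  | true  | false | true  = ⊥-elim (
          unbalanced (3 * q + 2) n≡4· true {0} {1} 2 (<ᵇ⇒< 0 4 _) (<ᵇ⇒< 1 4 _) (λ ()) e₀ e₁ (four (λ j → j ≡ 2 ⊎ side d j ≡ true) (inj₂ e₀) (inj₂ e₁) (inj₁ refl) (inj₂ e₃)))
        ... | true  | true  | false | false = paired {0} (e₀ , e₁ , e₂ , e₃)
        ... | true  | false | true  | true  = ⊥-elim (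
          unbalanced (3 * q + 2) n≡4· true {0} {2} 1 (<ᵇ⇒< 0 4 _) (<ᵇ⇒< 2 4 _) (λ ()) e₀ e₂ (four (λ j → j ≡ 1 ⊎ side d j ≡ true) (inj₂ e₀) (inj₁ refl) (inj₂ e₂) (inj₂ e₃)))
        ... | true  | false | true  | false = 2-periodic (e₀ ∙ e₂) (e₁ ∙ e₃)
        ... | true  | false | false | true  = paired {3} (e₃ , (trans (side-4 1 0) e₀) , (trans (side-4 1 1) e₁) , (trans (side-4 1 2) e₂))
        ... | true  | false | false | false = ⊥-elim (
          unbalanced (3 * q + 2) n≡4· false {1} {2} 0 (<ᵇ⇒< 1 4 _) (<ᵇ⇒< 2 4 _) (λ ()) e₁ e₂ (four (λ j → j ≡ 0 ⊎ side d j ≡ false) (inj₁ refl) (inj₂ e₁) (inj₂ e₂) (inj₂ e₃)))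
        ... | false | true  | true  | true  = ⊥-elim (
          unbalanced (3 * q + 2) n≡4· true {1} {2} 0 (<ᵇ⇒< 1 4 _) (<ᵇ⇒< 2 4 _) (λ ()) e₁ e₂ (four (λ j → j ≡ 0 ⊎ side d j ≡ true) (inj₁ refl) (inj₂ e₁) (inj₂ e₂) (inj₂ e₃)))
        ... | false | true  | true  | false = paired {1} (e₁ , e₂ , e₃ , (trans (side-4 1 0) e₀))
        ... | false | true  | false | true  = 2-periodic (e₀ ∙ e₂) (e₁ ∙ e₃)
        ... | false | true  | false | false = ⊥-elim (
          unbalanced (3 * q + 2) n≡4· false {0} {2} 1 (<ᵇ⇒< 0 4 _) (<ᵇ⇒< 2 4 _) (λ ()) e₀ e₂ (four (λ j → j ≡ 1 ⊎ side d j ≡ false) (inj₂ e₀) (inj₁ refl) (inj₂ e₂) (inj₂ e₃)))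
        ... | false | false | true  | true  = paired {2} (e₂ , e₃ , (trans (side-4 1 0) e₀) , (trans (side-4 1 1) e₁))
        ... | false | false | true  | false = ⊥-elim (
          unbalanced (3 * q + 2) n≡4· false {0} {1} 2 (<ᵇ⇒< 0 4 _) (<ᵇ⇒< 1 4 _) (λ ()) e₀ e₁ (four (λ j → j ≡ 2 ⊎ side d j ≡ false) (inj₂ e₀) (inj₂ e₁) (inj₁ refl) (inj₂ e₃)))
        ... | false | false | false | true  = ⊥-elim (
          unbalanced (3 * q + 2) n≡4· false {0} {1} 3 (<ᵇ⇒< 0 4 _) (<ᵇ⇒< 1 4 _) (λ ()) e₀ e₁ (four (λ j → j ≡ 3 ⊎ side d j ≡ false) (inj₂ e₀) (inj₂ e₁) (inj₂ e₂) (inj₁ refl)))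
        ... | false | false | false | false = ⊥-elim (
          unbalanced (3 * q + 2) n≡4· false {0} {1} 3 (<ᵇ⇒< 0 4 _) (<ᵇ⇒< 1 4 _) (λ ()) e₀ e₁ (four (λ j → j ≡ 3 ⊎ side d j ≡ false) (inj₂ e₀) (inj₂ e₁) (inj₂ e₂) (inj₁ refl)))

      by-residue : (p : ∃[ j ] (m ≡ 2 * j ⊎ m ≡ 1 + 2 * j)) →
                   ∃[ q ] (proj₁ p ≡ 2 * q ⊎ proj₁ p ≡ 1 + 2 * q) → Exceptional n f
      by-residue (j , inj₁ m≡) (q , inj₁ j≡) = alternating (side-residue 2 (3 * q)
        (linear (n ∷ m ∷ j ∷ q ∷ []) (λ n m j q → n ≡′ 3 ⊗ m ⊕ # 2 ⇒ m ≡′ 2 ⊗ j ⇒ j ≡′ 2 ⊗ q ⇒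
          ⊢ n ≡′ # 2 ⊕ 4 ⊗ (3 ⊗ q)) n≡ m≡ j≡))
      by-residue (j , inj₁ m≡) (q , inj₂ j≡) = multiple-of-4 q
        (linear (m ∷ j ∷ q ∷ []) (λ m j q → m ≡′ 2 ⊗ j ⇒ j ≡′ # 1 ⊕ 2 ⊗ q ⇒ ⊢ m ≡′ 4 ⊗ q ⊕ # 2) m≡ j≡)
      by-residue (j , inj₂ m≡) (q , inj₁ j≡) = ⊥-elim (not-1-periodic (side-residue 1 (3 * q + 1)
        (linear (n ∷ m ∷ j ∷ q ∷ []) (λ n m j q → n ≡′ 3 ⊗ m ⊕ # 2 ⇒ m ≡′ # 1 ⊕ 2 ⊗ j ⇒ j ≡′ 2 ⊗ q ⇒
          ⊢ n ≡′ # 1 ⊕ 4 ⊗ (3 ⊗ q ⊕ # 1)) n≡ m≡ j≡)))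
      by-residue (j , inj₂ m≡) (q , inj₂ j≡) = ⊥-elim (not-1-periodic λ i →
        trans (sym (3-periodic (i + 1))) (trans (cong (side d) (+-assoc i 1 3)) (side-4 1 i)))
        where
        3-periodic = side-residue 3 (3 * q + 2)
          (linear (n ∷ m ∷ j ∷ q ∷ []) (λ n m j q → n ≡′ 3 ⊗ m ⊕ # 2 ⇒ m ≡′ # 1 ⊕ 2 ⊗ j ⇒ j ≡′ # 1 ⊕ 2 ⊗ q ⇒
            ⊢ n ≡′ # 3 ⊕ 4 ⊗ (3 ⊗ q ⊕ # 2)) n≡ m≡ j≡)

-- Cubic graphs with a Hamiltonian cycle

∣p∣≤1+∣p-x∣ : ∀ {n} (p : Subset n) x → ∣ p ∣ ≤ suc ∣ p - x ∣
∣p∣≤1+∣p-x∣ (true  ∷ p) zero    = s≤s (≤-reflexive (cong ∣_∣ (sym (p─⊥≡p p))))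
∣p∣≤1+∣p-x∣ (false ∷ p) zero    = m≤n⇒m≤1+n (≤-reflexive (cong ∣_∣ (sym (p─⊥≡p p))))
∣p∣≤1+∣p-x∣ (true  ∷ p) (suc x) = s≤s (∣p∣≤1+∣p-x∣ p x)
∣p∣≤1+∣p-x∣ (false ∷ p) (suc x) = ∣p∣≤1+∣p-x∣ p x

x∉p-x : ∀ {n} (p : Subset n) x → x ∉ p - x
x∉p-x (true  ∷ p) zero    ()
x∉p-x (false ∷ p) zero    ()
x∉p-x (_ ∷ p)     (suc x) (there x∈) = x∉p-x p x x∈

covered⇒∣p∣≤ : ∀ {n} xs (p : Subset n) → (∀ {x} → x ∈ p → x ∈ˡ xs) → ∣ p ∣ ≤ length xs
covered⇒∣p∣≤ {n} [] p cover = ≤-reflexive (trans (cong ∣_∣ (Empty-unique λ { (x , x∈p) → case cover x∈p of λ () })) (∣⊥∣≡0 n))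
covered⇒∣p∣≤ (x ∷ xs) p cover = ≤-trans (∣p∣≤1+∣p-x∣ p x) (s≤s (covered⇒∣p∣≤ xs (p - x) cover′))
  where
  cover′ : ∀ {y} → y ∈ p - x → y ∈ˡ xs
  cover′ {y} y∈ with cover (p─q⊆p p ⁅ x ⁆ y∈)
  ... | here refl = ⊥-elim (x∉p-x p x y∈)
  ... | there y∈xs = y∈xs

unique⇒≤∣p∣ : ∀ {n xs} (p : Subset n) → Unique xs → All (_∈ p) xs → length xs ≤ ∣ p ∣
unique⇒≤∣p∣ p []         []          = z≤n
unique⇒≤∣p∣ p (x# ∷ uniq) (x∈p ∷ xs∈p) = ≤-trans
  (s≤s (unique⇒≤∣p∣ _ uniq (All.zipWith (λ { (y∈p , x≢y) → x∈p∧x≢y⇒x∈p-y y∈p (x≢y ∘ sym) }) (xs∈p , x#))))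
  (x∈p⇒∣p-x∣<∣p∣ x∈p)

insert-size : ∀ {n} (p : Subset n) x → x ∉ p → ∣ p [ x ]≔ inside ∣ ≡ suc ∣ p ∣
insert-size (true  ∷ p) zero    x∉p = ⊥-elim (x∉p here)
insert-size (false ∷ p) zero    x∉p = refl
insert-size (true  ∷ p) (suc x) x∉p = cong suc (insert-size p x (x∉p ∘ there))
insert-size (false ∷ p) (suc x) x∉p = insert-size p x (x∉p ∘ there)

≥-cross : ∀ {a b m n} (1<m : 1 < m) (1<n : 1 < n) →
  a /pred m ⟨ 1<m ⟩ ℚᵘ.≥ b /pred n ⟨ 1<n ⟩ → b * (m ∸ 1) ≤ a * (n ∸ 1)
≥-cross {a} {b} {suc (suc m)} {suc (suc n)} (s≤s (s≤s _)) (s≤s (s≤s _)) (ℚᵘ.*≤* p) =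
  ℤ.drop‿+≤+ (subst₂ ℤ._≤_ (sym (ℤ.pos-* b (suc m))) (sym (ℤ.pos-* a (suc n))) p)

cross-≥ : ∀ {a b m n} (1<m : 1 < m) (1<n : 1 < n) →
  b * (m ∸ 1) ≤ a * (n ∸ 1) → a /pred m ⟨ 1<m ⟩ ℚᵘ.≥ b /pred n ⟨ 1<n ⟩
cross-≥ {a} {b} {suc (suc m)} {suc (suc n)} (s≤s (s≤s _)) (s≤s (s≤s _)) p =
  ℚᵘ.*≤* (subst₂ ℤ._≤_ (ℤ.pos-* b (suc m)) (ℤ.pos-* a (suc n)) (ℤ.+≤+ p))

module _ {n : ℕ} (G : Graph n) where
  open Graph G

  ∈-neighbours⁺ : ∀ {u v} → Adj v u → u ∈ neighbours G v
  ∈-neighbours⁺ {u} {v} a = lookup⇒[]= u _ (trans (lookup∘tabulate _ u) (dec-true (adj? v u) a))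

  ∈-neighbours⁻ : ∀ {u v} → u ∈ neighbours G v → Adj v u
  ∈-neighbours⁻ {u} {v} u∈ with adj? v u | trans (sym (lookup∘tabulate (λ u → does (adj? v u)) u)) ([]=⇒lookup u∈)
  ... | yes a | _ = a
  ... | no _  | ()

-- Chord lengths of a cubic graph along its Hamiltonian cycle

module Positions {n : ℕ} {G : Graph n} (cubic : Cubic G) (H : HamiltonianCycle G) where
  open Graph G
  open HamiltonianCycle H

  0<n′ : 0 < n
  0<n′ = ≤-trans (s≤s z≤n) 3≤n

  instance
    n≢0′ : NonZero n
    n≢0′ = >-nonZero 0<n′

  vertex : ℕ → Fin n
  vertex i = vertexAt (fromℕ< (m%n<n i n))

  position : Fin n → ℕ
  position v = toℕ (order ⟨$⟩ˡ v)

  position<n : ∀ v → position v < n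
  position<n v = toℕ<n (order ⟨$⟩ˡ v)

  position-vertex : ∀ i → position (vertex i) ≡ i % n
  position-vertex i = trans (cong toℕ (inverseˡ order)) (toℕ-fromℕ< (m%n<n i n))

  vertex-cong : ∀ {i j} → i % n ≡ j % n → vertex i ≡ vertex j
  vertex-cong eq = cong vertexAt (fromℕ<-cong _ _ eq _ _)

  vertex-position : ∀ v → vertex (position v) ≡ v
  vertex-position v = trans (cong vertexAt (toℕ-injective
    (trans (toℕ-fromℕ< _) (m<n⇒m%n≡m (position<n v))))) (inverseʳ order)

  vertex-injective : ∀ {i j} → vertex i ≡ vertex j → i % n ≡ j % n
  vertex-injective {i} {j} eq = trans (sym (position-vertex i)) (trans (cong position eq) (position-vertex j))

  vertex-+n : ∀ i → vertex (i + n) ≡ vertex i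
  vertex-+n i = vertex-cong ([m+n]%n≡m%n i n)

  vertex-toℕ : ∀ i → vertex (toℕ i) ≡ vertexAt i
  vertex-toℕ i = cong vertexAt (toℕ-injective (trans (toℕ-fromℕ< _) (m<n⇒m%n≡m (toℕ<n i))))

  suc-% : ∀ i → suc i % n ≡ suc (i % n) % n
  suc-% i = trans (%-distribˡ-+ 1 i n)
    (trans (cong (λ x → (1 % n + x) % n) (sym (m%n%n≡m%n i n))) (sym (%-distribˡ-+ 1 (i % n) n)))

  adj-suc : ∀ i → Adj (vertex i) (vertex (suc i))
  adj-suc i with suc (i % n) ≟ n
  ... | yes eq = closing _ _ (trans (cong suc (toℕ-fromℕ< _)) eq)
        (trans (toℕ-fromℕ< _) (trans (suc-% i) (trans (cong (_% n) eq) (n%n≡0 n))))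
  ... | no neq = consecutive _ _
        (trans (toℕ-fromℕ< _) (trans (trans (suc-% i) (m<n⇒m%n≡m (≤∧≢⇒< (m%n<n i n) neq))) (cong suc (sym (toℕ-fromℕ< _)))))

  %-cong-+ʳ : ∀ {i j} k → i % n ≡ j % n → (i + k) % n ≡ (j + k) % n
  %-cong-+ʳ {i} {j} k eq = trans (%-distribˡ-+ i k n) (trans (cong (λ x → (x + k % n) % n) eq) (sym (%-distribˡ-+ j k n)))

  -- Adding `n ∸ i % n` serves as subtraction of `i` modulo `n`.
  cancel-% : ∀ i x → (x + i + (n ∸ i % n)) % n ≡ x % n
  cancel-% i x = begin
    (x + i + (n ∸ i % n)) % n     ≡⟨ cong (_% n) (trans (+-assoc x i _) (+-comm x _)) ⟩
    (i + (n ∸ i % n) + x) % n     ≡⟨ %-cong-+ʳ x mid ⟩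
    (n + x) % n                   ≡⟨ cong (_% n) (+-comm n x) ⟩
    (x + n) % n                   ≡⟨ [m+n]%n≡m%n x n ⟩
    x % n                         ∎
    where
    open ≡-Reasoning
    mid : (i + (n ∸ i % n)) % n ≡ n % n
    mid = trans (%-cong-+ʳ (n ∸ i % n) (sym (m%n%n≡m%n i n)))
                (cong (_% n) (m+[n∸m]≡n (<⇒≤ (m%n<n i n))))

  offset-injective : ∀ i {x y} → x < n → y < n → vertex (i + x) ≡ vertex (i + y) → x ≡ y
  offset-injective i {x} {y} x<n y<n eq = begin
    x                         ≡⟨ sym (m<n⇒m%n≡m x<n) ⟩
    x % n                     ≡⟨ sym (cancel-% i x) ⟩
    (x + i + (n ∸ i % n)) % n ≡⟨ %-cong-+ʳ (n ∸ i % n) (trans (cong (_% n) (+-comm x i))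
                                   (trans (vertex-injective eq) (cong (_% n) (+-comm i y)))) ⟩
    (y + i + (n ∸ i % n)) % n ≡⟨ cancel-% i y ⟩
    y % n                     ≡⟨ m<n⇒m%n≡m y<n ⟩
    y                         ∎
    where open ≡-Reasoning

  offset : ∀ i v → ∃[ x ] x < n × v ≡ vertex (i + x)
  offset i v = (position v + (n ∸ i % n)) % n , m%n<n _ n ,
    trans (sym (vertex-position v)) (vertex-cong (sym (begin
      (i + (position v + (n ∸ i % n)) % n) % n ≡⟨ cong (_% n) (+-comm i _) ⟩
      ((position v + (n ∸ i % n)) % n + i) % n ≡⟨ %-cong-+ʳ i (m%n%n≡m%n _ n) ⟩
      (position v + (n ∸ i % n) + i) % n       ≡⟨ cong (_% n) (trans (+-assoc (position v) _ i) (trans (cong (position v +_) (+-comm _ i)) (sym (+-assoc (position v) i _)))) ⟩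
      (position v + i + (n ∸ i % n)) % n       ≡⟨ cancel-% i (position v) ⟩
      position v % n                           ∎)))
    where open ≡-Reasoning

  adj-pred : ∀ i → Adj (vertex i) (vertex (i + (n ∸ 1)))
  adj-pred i = symmetric (subst (Adj (vertex (i + (n ∸ 1)))) (trans (cong vertex eq) (vertex-+n i)) (adj-suc (i + (n ∸ 1))))
    where
    eq : suc (i + (n ∸ 1)) ≡ i + n
    eq = trans (sym (+-suc i (n ∸ 1))) (cong (i +_) (m+[n∸m]≡n 0<n′))

  1<n : 1 < n
  1<n = ≤-trans (s≤s (s≤s z≤n)) 3≤n

  n∸1<n : n ∸ 1 < n
  n∸1<n = ∸-monoʳ-< {n} {1} {0} (s≤s z≤n) 0<n′

  suc[n∸1]≡n : suc (n ∸ 1) ≡ n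
  suc[n∸1]≡n = m+[n∸m]≡n 0<n′

  IsChord : ℕ → ℕ → Set
  IsChord i x = 2 ≤ x × x + 2 ≤ n × Adj (vertex i) (vertex (i + x))

  classify : ∀ i {x} → x < n → Adj (vertex i) (vertex (i + x)) → x ≡ 1 ⊎ x ≡ n ∸ 1 ⊎ IsChord i x
  classify i {0} x<n a = ⊥-elim (irreflexive (sym (cong vertex (+-identityʳ i))) a)
  classify i {1} x<n a = inj₁ refl
  classify i {suc (suc x)} x<n a with suc (suc x) ≟ n ∸ 1
  ... | yes eq = inj₂ (inj₁ eq)
  ... | no neq = inj₂ (inj₂ (s≤s (s≤s z≤n) , bound , a))
    where
    bound : suc (suc x) + 2 ≤ n
    bound = subst₂ _≤_ (+-comm 2 (suc (suc x))) suc[n∸1]≡n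
      (s≤s (≤∧≢⇒< (≤-pred (subst (suc (suc (suc x)) ≤_) (sym suc[n∸1]≡n) x<n)) neq))

  -- Two different chords and the two cycle neighbours would be four distinct neighbours of a vertex
  -- of degree 3.
  chord-unique : ∀ i {x y} → IsChord i x → IsChord i y → x ≡ y
  chord-unique i {x} {y} (2≤x , x+2≤n , ax) (2≤y , y+2≤n , ay) with x ≟ y
  ... | yes eq = eq
  ... | no x≢y = ⊥-elim (<-irrefl refl (≤-trans
        (unique⇒≤∣p∣ {xs = vertex (i + 1) ∷ vertex (i + (n ∸ 1)) ∷ vertex (i + x) ∷ vertex (i + y) ∷ []}
          (neighbours G (vertex i))
          ( (distinct 1<n n∸1<n 1≢n∸1 ∷ distinct 1<n x<n (<⇒≢ 2≤x) ∷ distinct 1<n y<n (<⇒≢ 2≤y) ∷ [])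
          ∷ (distinct n∸1<n x<n (n∸1≢ x+2≤n) ∷ distinct n∸1<n y<n (n∸1≢ y+2≤n) ∷ [])
          ∷ (distinct x<n y<n x≢y ∷ []) ∷ [] ∷ [])
          ( ∈-neighbours⁺ G (subst (Adj (vertex i) ∘ vertex) (+-comm 1 i) (adj-suc i))
          ∷ ∈-neighbours⁺ G (adj-pred i) ∷ ∈-neighbours⁺ G ax ∷ ∈-neighbours⁺ G ay ∷ []))
        (≤-reflexive (cubic (vertex i)))))
    where
    distinct : ∀ {x y} → x < n → y < n → x ≢ y → vertex (i + x) ≢ vertex (i + y)
    distinct x<n y<n x≢y eq = x≢y (offset-injective i x<n y<n eq)
    +2≤⇒< : ∀ {x} → x + 2 ≤ n → x < n
    +2≤⇒< {x} p = ≤-trans (≤-trans (≤-reflexive (+-comm 1 x)) (+-monoʳ-≤ x (s≤s z≤n))) p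
    x<n = +2≤⇒< x+2≤n
    y<n = +2≤⇒< y+2≤n
    1≢n∸1 : 1 ≢ n ∸ 1
    1≢n∸1 eq = <⇒≢ 3≤n (trans (cong suc eq) suc[n∸1]≡n)
    n∸1≢ : ∀ {x} → x + 2 ≤ n → n ∸ 1 ≢ x
    n∸1≢ {x} p refl = <-irrefl refl (≤-trans (≤-reflexive (trans (cong suc (sym suc[n∸1]≡n)) (+-comm 2 (n ∸ 1)))) p)

  private
    third-neighbour : ∀ i → ∃[ v ] Adj (vertex i) v × v ≢ vertex (i + 1) × v ≢ vertex (i + (n ∸ 1))
    third-neighbour i with any? (λ v → adj? (vertex i) v ×-dec ¬? (v ≟ᶠ vertex (i + 1)) ×-dec ¬? (v ≟ᶠ vertex (i + (n ∸ 1))))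
    ... | yes p = p
    ... | no ¬p = ⊥-elim (<-irrefl refl (≤-trans (≤-reflexive (sym (cubic (vertex i))))
          (covered⇒∣p∣≤ (vertex (i + 1) ∷ vertex (i + (n ∸ 1)) ∷ []) (neighbours G (vertex i)) cover)))
      where
      cover : ∀ {v} → v ∈ neighbours G (vertex i) → v ∈ˡ vertex (i + 1) ∷ vertex (i + (n ∸ 1)) ∷ []
      cover {v} v∈ with v ≟ᶠ vertex (i + 1) | v ≟ᶠ vertex (i + (n ∸ 1))
      ... | yes eq | _      = here eq
      ... | no _   | yes eq = there (here eq)
      ... | no p   | no q   = ⊥-elim (¬p (v , ∈-neighbours⁻ G v∈ , p , q))

  chord : ∀ i → ∃[ x ] IsChord i x
  chord i = let v , a , v≢₁ , v≢₂ = third-neighbour i in go a v≢₁ v≢₂ (offset i v)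
    where
    go : ∀ {v} → Adj (vertex i) v → v ≢ vertex (i + 1) → v ≢ vertex (i + (n ∸ 1)) →
         ∃[ x ] x < n × v ≡ vertex (i + x) → ∃[ x ] IsChord i x
    go a v≢₁ v≢₂ (x , x<n , refl) =
      [ (λ { refl → ⊥-elim (v≢₁ refl) }) , [ (λ { refl → ⊥-elim (v≢₂ refl) }) , (x ,_) ]′ ]′ (classify i x<n a)

  opaque
    jump : ℕ → ℕ
    -- Choosing the chord at the reduced position makes the function periodic by construction,
    -- without appeal to uniqueness.
    jump i = proj₁ (chord (i % n))

    jump-chord : ∀ i → IsChord i (jump i)
    jump-chord i = let x , 2≤x , x+2≤n , a = chord (i % n) in 2≤x , x+2≤n ,
      subst₂ Adj (vertex-cong (m%n%n≡m%n i n)) (vertex-cong (%-cong-+ʳ x (m%n%n≡m%n i n))) a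

    jump-periodic : ∀ i → jump (i + n) ≡ jump i
    jump-periodic i = cong (λ j → proj₁ (chord j)) ([m+n]%n≡m%n i n)

  jump-unique : ∀ i {x} → IsChord i x → x ≡ jump i
  jump-unique i c = chord-unique i c (jump-chord i)

  neighbour-cases : ∀ i {v} → Adj (vertex i) v →
    v ≡ vertex (i + 1) ⊎ v ≡ vertex (i + (n ∸ 1)) ⊎ v ≡ vertex (i + jump i)
  neighbour-cases i {v} = go (offset i v)
    where
    go : ∀ {v} → ∃[ x ] x < n × v ≡ vertex (i + x) → Adj (vertex i) v →
      v ≡ vertex (i + 1) ⊎ v ≡ vertex (i + (n ∸ 1)) ⊎ v ≡ vertex (i + jump i)
    go (x , x<n , refl) a =
      [ (λ { refl → inj₁ refl })
      , [ (λ { refl → inj₂ (inj₁ refl) }) , (λ c → inj₂ (inj₂ (cong (λ y → vertex (i + y)) (jump-unique i c)))) ]′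
      ]′ (classify i x<n a)

  chords : Chords n jump
  chords = record
    { periodic = jump-periodic
    ; 2≤f      = λ i → proj₁ (jump-chord i)
    ; f+2≤n    = λ i → proj₁ (proj₂ (jump-chord i))
    ; back     = λ i → back i (jump-chord i)
    }
    where
    -- Seen from its other end the same edge is a chord of length `n ∸ x`, and the chord there is
    -- unique.
    back : ∀ i {x} → IsChord i x → x + jump (i + x) ≡ n
    back i {x} (2≤x , x+2≤n , a) = trans (cong (x +_) (sym (jump-unique (i + x) (2≤ , +2≤ , a′)))) (m+[n∸m]≡n x≤n)
      where
      x≤n : x ≤ n
      x≤n = ≤-trans (m≤m+n x 2) x+2≤n
      2≤ : 2 ≤ n ∸ x
      2≤ = subst (_≤ n ∸ x) (m+n∸m≡n x 2) (∸-monoˡ-≤ x x+2≤n)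
      +2≤ : n ∸ x + 2 ≤ n
      +2≤ = ≤-trans (+-monoʳ-≤ (n ∸ x) 2≤x) (≤-reflexive (m∸n+n≡m x≤n))
      a′ : Adj (vertex (i + x)) (vertex (i + x + (n ∸ x)))
      a′ = subst (Adj (vertex (i + x)))
        (trans (sym (vertex-+n i)) (cong vertex (sym (trans (+-assoc i x _) (cong (i +_) (m+[n∸m]≡n x≤n)))))) (symmetric a)

-- The arc a, …, a + e without a + s; there is nothing to remove if e < s.
record Piece (n : ℕ) (f : ℕ → ℕ) (a e s : ℕ) : Set where
  field
    e<n     : e < n
    1≤e     : 1 ≤ e
    first≤  : f a ≤ e
    first≢  : f a ≢ s
    last≥   : n ≤ e + f (a + e)
    last≢   : e + f (a + e) ≢ n + s
    gap     : e < s ⊎ (∃[ k ] s ≡ suc k × 1 ≤ k × k + 3 ≤ e × k + f (a + k) ≤ e ×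
                (2 + k + f (a + (2 + k)) ≤ e ⊎ n ≤ 2 + k + f (a + (2 + k))))

-- The removed offset `suc d` lies just beyond the arc, so nothing is lost and neither end chord can
-- hit it.
closed-piece : ∀ {n f d a} → Chords n f → d < n → ClosedArc n f d a → Piece n f a d (suc d)
closed-piece {n} {f} {d} {a} C d<n (first , last) = record
  { e<n    = d<n
  ; 1≤e    = ≤-trans (s≤s z≤n) (≤-trans (2≤f a) first)
  ; first≤ = first
  ; first≢ = <⇒≢ (s≤s first)
  ; last≥  = last
  ; last≢  = λ eq → case linear (f (a + d) ∷ d ∷ n ∷ []) (λ f d n →
      f ⊕ # 2 ≤′ n ⇒ d ⊕ f ≡′ n ⊕ (# 1 ⊕ d) ⇒ ⊢ # 1 ≤′ # 0) (f+2≤n (a + d)) eq of λ ()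
  ; gap    = inj₁ ≤-refl
  }
  where open Chords C

punctured-piece : ∀ {n f e k a} → e < n → PuncturedArc n f e k a → Piece n f a e (suc k)
punctured-piece e<n (p₁ , p₂ , p₃ , p₄ , p₅ , p₆ , p₇ , p₈) = record
  { e<n = e<n ; 1≤e = ≤-trans p₅ (≤-trans (m≤m+n _ 3) p₆) ; first≤ = p₁ ; first≢ = p₂ ; last≥ = p₃ ; last≢ = p₄
  ; gap = inj₂ (_ , refl , p₅ , p₆ , p₇ , p₈) }

-- Degrees and connectedness of a piece

module PieceGraph {n : ℕ} {G : Graph n} (cubic : Cubic G) (H : HamiltonianCycle G) where
  open Graph G
  open Positions cubic H
  open Chords chords using (2≤f; f+2≤n)

  -- Growing the set by one offset at a time makes each stage the invariant of the output loop,
  -- which writes the vertices in the same order.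
  build : (a s k : ℕ) → Subset n
  build a s zero    = ∅
  build a s (suc t) with t ≟ s
  ... | yes _ = build a s t
  ... | no  _ = build a s t [ vertex (a + t) ]≔ inside

  ∈-build⁻ : ∀ a s k {v} → v ∈ build a s k → ∃[ t ] t < k × t ≢ s × v ≡ vertex (a + t)
  ∈-build⁻ a s zero v∈ = ⊥-elim (∉⊥ v∈)
  ∈-build⁻ a s (suc t) {v} v∈ with t ≟ s
  ... | yes _ = let t′ , t′<t , p = ∈-build⁻ a s t v∈ in t′ , m<n⇒m<1+n t′<t , p
  ... | no t≢s with v ≟ᶠ vertex (a + t)
  ...   | yes eq = t , ≤-refl , t≢s , eq
  ...   | no neq = let t′ , t′<t , p = ∈-build⁻ a s t (lookup⇒[]= v _
                         (trans (sym (lookup∘update′ neq (build a s t) inside)) ([]=⇒lookup v∈)))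
                   in t′ , m<n⇒m<1+n t′<t , p

  ∈-build⁺ : ∀ a s k {t} → t < k → t ≢ s → vertex (a + t) ∈ build a s k
  ∈-build⁺ a s (suc k) {t} (s≤s t≤k) t≢s with k ≟ s | m≤n⇒m<n∨m≡n t≤k
  ... | yes _   | inj₁ t<k  = ∈-build⁺ a s k t<k t≢s
  ... | yes k≡s | inj₂ refl = ⊥-elim (t≢s k≡s)
  ... | no _    | inj₂ refl = []≔-updates (build a s k) (vertex (a + k))
  ... | no _    | inj₁ t<k with vertex (a + t) ≟ᶠ vertex (a + k)
  ...   | yes eq = subst (_∈ build a s k [ vertex (a + k) ]≔ inside) (sym eq) ([]≔-updates (build a s k) (vertex (a + k)))
  ...   | no neq = lookup⇒[]= _ _ (trans (lookup∘update′ neq (build a s k) inside)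
                                         ([]=⇒lookup (∈-build⁺ a s k t<k t≢s)))

  size-build : ∀ a s k → k ≤ n → (k ≤ s → ∣ build a s k ∣ ≡ k) × (s < k → suc ∣ build a s k ∣ ≡ k)
  size-build a s zero    _   = (λ _ → ∣⊥∣≡0 n) , λ ()
  size-build a s (suc k) k<n with k ≟ s
  ... | yes refl = (λ k<k → ⊥-elim (<-irrefl refl k<k))
                 , λ _ → cong suc (proj₁ (size-build a s k (<⇒≤ k<n)) ≤-refl)
  ... | no k≢s = (λ k<s → trans grow (cong suc (proj₁ ih (<⇒≤ k<s))))
               , λ { (s≤s s≤k) → cong suc (trans grow (proj₂ ih (≤∧≢⇒< s≤k (k≢s ∘ sym)))) }
    where
    ih = size-build a s k (<⇒≤ k<n)
    fresh : vertex (a + k) ∉ build a s k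
    fresh v∈ = let t , t<k , _ , eq = ∈-build⁻ a s k v∈ in
      <⇒≢ t<k (sym (offset-injective a k<n (<-trans t<k k<n) eq))
    grow : ∣ build a s k [ vertex (a + k) ]≔ inside ∣ ≡ suc ∣ build a s k ∣
    grow = insert-size (build a s k) (vertex (a + k)) fresh

  module _ {a e s : ℕ} (P : Piece n jump a e s) where
    open Piece P

    S : Subset n
    S = build a s (suc e)

    V : ℕ → Fin n
    V t = vertex (a + t)

    In : ℕ → Set
    In t = t ≤ e × t ≢ s

    In⇒∈ : ∀ {t} → In t → V t ∈ S
    In⇒∈ (t≤e , t≢s) = ∈-build⁺ a s (suc e) (s≤s t≤e) t≢s

    ∈⇒In : ∀ {v} → v ∈ S → ∃[ t ] In t × v ≡ V t
    ∈⇒In v∈ = case ∈-build⁻ a s (suc e) v∈ of λ { (t , s≤s t≤e , t≢s , eq) → t , (t≤e , t≢s) , eq }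

    up : ∀ t → Adj (V t) (V (suc t))
    up t = subst (Adj (V t) ∘ vertex) (sym (+-suc a t)) (adj-suc (a + t))

    along : ∀ t → Adj (V t) (V (t + jump (a + t)))
    along t = subst (Adj (V t) ∘ vertex) (+-assoc a t _) (proj₂ (proj₂ (jump-chord (a + t))))

    around : ∀ t z → t + jump (a + t) ≡ z + n → Adj (V t) (V z)
    around t z eq = subst (Adj (V t)) (trans (cong V eq) (trans (cong vertex (sym (+-assoc a z n))) (vertex-+n (a + z)))) (along t)

    TwoNeighbours : ℕ → Set
    TwoNeighbours t = ∃[ x ] ∃[ y ] x ≢ y × In x × In y × Adj (V t) (V x) × Adj (V t) (V y)

    private
      -- A chord that passes `n` returns to an earlier offset `z`; as its length is at most `n - 2`,
      -- it cannot coincide with the cycle edge at `t`.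
      z-bound : ∀ t {z} → t + jump (a + t) ≡ z + n → z + 2 ≤ t
      z-bound t {z} eq = linear (t ∷ jump (a + t) ∷ z ∷ n ∷ [])
        (λ t f z n → f ⊕ # 2 ≤′ n ⇒ t ⊕ f ≡′ z ⊕ n ⇒ ⊢ z ⊕ # 2 ≤′ t) (f+2≤n (a + t)) eq

      excess : ∀ {x} → n ≤ x → x ≡ (x ∸ n) + n
      excess n≤x = sym (m∸n+n≡m n≤x)

      1≢s : 1 ≢ s
      1≢s refl = case gap of λ { (inj₁ (s≤s e≤0)) → <⇒≱ 1≤e e≤0 ; (inj₂ (0 , refl , () , _)) ; (inj₂ (suc k , () , _)) }

      first-two : TwoNeighbours 0
      first-two = 1 , jump a , <⇒≢ (2≤f a) , (1≤e , 1≢s) , (first≤ , first≢) , up 0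
                , subst (λ x → Adj (V 0) (V x)) (cong jump (+-identityʳ a)) (along 0)

      last-two : ∀ t → suc t ≡ e → TwoNeighbours (suc t)
      last-two t refl = t , z , (λ t≡z → <⇒≢ z<t (sym t≡z))
                      , (n≤1+n t , t≢s) , (≤-trans (m≤m+n z 2) z+2≤ , z≢s)
                      , symmetric (up t) , around (suc t) z (excess last≥)
        where
        z : ℕ
        z = suc t + jump (a + suc t) ∸ n
        z+2≤ : z + 2 ≤ suc t
        z+2≤ = z-bound (suc t) (excess last≥)
        z<t : z < t
        z<t = linear (z ∷ t ∷ []) (λ z t → z ⊕ # 2 ≤′ # 1 ⊕ t ⇒ ⊢ # 1 ⊕ z ≤′ t) z+2≤
        z≢s : z ≢ s
        z≢s z≡s = last≢ (trans (excess last≥) (trans (cong (_+ n) z≡s) (+-comm s n)))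
        t≢s : t ≢ s
        t≢s refl = case gap of λ
          { (inj₁ t<t) → <-irrefl refl (<-trans ≤-refl t<t)
          ; (inj₂ (k , refl , _ , k+3≤ , _)) → <-irrefl refl (≤-trans (≤-reflexive (+-comm 3 k)) k+3≤) }

      middle : ∀ t → suc t < e → t ≢ s → suc (suc t) ≢ s → TwoNeighbours (suc t)
      middle t t<e t≢s t+2≢s = t , suc (suc t) , <⇒≢ (s≤s (n≤1+n t))
        , (≤-trans (n≤1+n t) (<⇒≤ t<e) , t≢s) , (t<e , t+2≢s) , symmetric (up t) , up (suc t)

      before-gap : ∀ k → suc k ≡ s → suc k < e → 1 ≤ k → k + jump (a + k) ≤ e → TwoNeighbours k
      before-gap (suc k) refl k<e _ p = k , suc k + jump (a + suc k) , <⇒≢ (m≤m+n (suc k) _)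
        , (≤-trans (n≤1+n k) (≤-trans (n≤1+n _) (<⇒≤ k<e)) , <⇒≢ (s≤s (n≤1+n k)))
        , (p , λ eq → case linear (k ∷ jump (a + suc k) ∷ []) (λ k f → # 2 ≤′ f ⇒ # 1 ⊕ k ⊕ f ≡′ # 2 ⊕ k ⇒ ⊢ # 1 ≤′ # 0) (2≤f (a + suc k)) eq of λ ())
        , symmetric (up k) , along (suc k)

      after-gap : ∀ k → suc k ≡ s → k + 3 ≤ e →
        2 + k + jump (a + (2 + k)) ≤ e ⊎ n ≤ 2 + k + jump (a + (2 + k)) → TwoNeighbours (2 + k)
      after-gap k refl k+3≤e p = [ inside-right , inside-left ]′ p
        where
        next : In (3 + k)
        next = ≤-trans (≤-reflexive (+-comm 3 k)) k+3≤e , λ eq → <⇒≢ (s≤s (s≤s (n≤1+n k))) (sym eq)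
        inside-right : 2 + k + jump (a + (2 + k)) ≤ e → TwoNeighbours (2 + k)
        inside-right q = 3 + k , 2 + k + jump (a + (2 + k))
          , (λ eq → case linear (k ∷ jump (a + (2 + k)) ∷ []) (λ k f → # 2 ≤′ f ⇒ # 3 ⊕ k ≡′ # 2 ⊕ k ⊕ f ⇒ ⊢ # 1 ≤′ # 0) (2≤f _) eq of λ ())
          , next
          , (q , λ eq → case linear (k ∷ jump (a + (2 + k)) ∷ []) (λ k f → # 2 ≤′ f ⇒ # 2 ⊕ k ⊕ f ≡′ # 1 ⊕ k ⇒ ⊢ # 1 ≤′ # 0) (2≤f _) eq of λ ())
          , up (2 + k) , along (2 + k)
        inside-left : n ≤ 2 + k + jump (a + (2 + k)) → TwoNeighbours (2 + k)
        inside-left q = 3 + k , z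
          , (λ eq → case linear (z ∷ k ∷ []) (λ z k → z ⊕ # 2 ≤′ # 2 ⊕ k ⇒ # 3 ⊕ k ≡′ z ⇒ ⊢ # 1 ≤′ # 0) z+2≤ eq of λ ())
          , next
          , ( linear (z ∷ k ∷ e ∷ []) (λ z k e → z ⊕ # 2 ≤′ # 2 ⊕ k ⇒ k ⊕ # 3 ≤′ e ⇒ ⊢ z ≤′ e) z+2≤ k+3≤e
            , λ eq → case linear (z ∷ k ∷ []) (λ z k → z ⊕ # 2 ≤′ # 2 ⊕ k ⇒ z ≡′ # 1 ⊕ k ⇒ ⊢ # 1 ≤′ # 0) z+2≤ eq of λ ())
          , up (2 + k) , around (2 + k) z (excess q)
          where
          z : ℕ
          z = 2 + k + jump (a + (2 + k)) ∸ n
          z+2≤ : z + 2 ≤ 2 + k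
          z+2≤ = z-bound (2 + k) (excess q)

    two-neighbours : ∀ t → In t → TwoNeighbours t
    two-neighbours zero    _ = first-two
    two-neighbours (suc t) (t<e , t+1≢s) with suc t ≟ e
    ... | yes eq = last-two t eq
    ... | no t+1≢e with t ≟ s | suc (suc t) ≟ s
    ...   | no t≢s | no t+2≢s = middle t (≤∧≢⇒< t<e t+1≢e) t≢s t+2≢s
    ...   | yes refl | _ = case gap of λ
              { (inj₁ e<s) → ⊥-elim (<-asym t<e e<s)
              ; (inj₂ (k , refl , _ , k+3≤e , _ , p)) → after-gap k refl k+3≤e p }
    ...   | no _ | yes refl = case gap of λ
              { (inj₁ e<s) → ⊥-elim (t+1≢e (≤-antisym t<e (≤-pred e<s)))
              ; (inj₂ (k , refl , 1≤k , k+3≤e , p , _)) → before-gap k refl (≤-trans (≤-reflexive (+-comm 2 k)) (≤-trans (+-monoʳ-≤ k (s≤s (s≤s z≤n))) k+3≤e)) 1≤k p }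

    2≤degreeIn : ∀ {u} → u ∈ S → 2 ≤ degreeIn G S u
    2≤degreeIn u∈ = case ∈⇒In u∈ of λ { (t , t∈ , refl) →
      let x , y , x≢y , x∈ , y∈ , ax , ay = two-neighbours t t∈ in
      unique⇒≤∣p∣ {xs = V x ∷ V y ∷ []} (neighbours G (V t) ∩ S)
        (((λ eq → x≢y (offset-injective a (≤-<-trans (proj₁ x∈) e<n) (≤-<-trans (proj₁ y∈) e<n) eq)) ∷ []) ∷ [] ∷ [])
        (x∈p∩q⁺ (∈-neighbours⁺ G ax , In⇒∈ x∈) ∷ x∈p∩q⁺ (∈-neighbours⁺ G ay , In⇒∈ y∈) ∷ []) }

    Path : Fin n → Fin n → Set
    Path = Star (InducedAdj G S)

    Path-sym : ∀ {u v} → Path u v → Path v u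
    Path-sym = reverse λ { (u∈ , v∈ , a) → v∈ , u∈ , symmetric a }

    walk : ∀ t d → (∀ i → i ≤ d → In (i + t)) → Path (V t) (V (d + t))
    walk t zero    _   = ε
    walk t (suc d) all = walk t d (λ i i≤d → all i (m≤n⇒m≤1+n i≤d)) ◅◅
      (In⇒∈ (all d (n≤1+n d)) , In⇒∈ (all (suc d) ≤-refl) , up (d + t)) ◅ ε

    walk′ : ∀ {t t′} → t ≤ t′ → (∀ i → t ≤ i → i ≤ t′ → In i) → Path (V t) (V t′)
    walk′ {t} {t′} t≤t′ all = subst (Path (V t) ∘ V) (m∸n+n≡m t≤t′)
      (walk t (t′ ∸ t) λ i i≤ → all (i + t) (m≤n+m t i) (≤-trans (+-monoˡ-≤ t i≤) (≤-reflexive (m∸n+n≡m t≤t′))))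

    from-start : ∀ t → In t → Path (V 0) (V t)
    from-start t (t≤e , t≢s) with <-cmp t s
    ... | tri≈ _ t≡s _ = ⊥-elim (t≢s t≡s)
    ... | tri< t<s _ _ = walk′ z≤n λ i _ i≤t → ≤-trans i≤t t≤e , <⇒≢ (≤-<-trans i≤t t<s)
    ... | tri> _ _ s<t with gap
    ...   | inj₁ e<s = ⊥-elim (<-asym e<s (<-≤-trans s<t t≤e))
    -- The chord at `k` is the bridge over the hole. It lands at some `z` beyond it, from where the
    -- path goes back to `2 + k` and then forward to the target.
    ...   | inj₂ (k , refl , 1≤k , k+3≤e , p , _) =
            walk′ z≤n (λ i _ i≤k → In-k i i≤k) ◅◅
            (In⇒∈ (In-k k ≤-refl) , In⇒∈ (right z k+2≤z p) , along k) ◅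
            Path-sym (walk′ k+2≤z λ i l u → right i l (≤-trans u p)) ◅◅
            walk′ s<t λ i l u → right i l (≤-trans u t≤e)
            where
            z = k + jump (a + k)
            k+2≤z : 2 + k ≤ z
            k+2≤z = ≤-trans (≤-reflexive (+-comm 2 k)) (+-monoʳ-≤ k (2≤f (a + k)))
            In-k : ∀ i → i ≤ k → In i
            In-k i i≤k = ≤-trans i≤k (≤-trans (m≤m+n k 3) k+3≤e) , <⇒≢ (s≤s i≤k)
            right : ∀ i → 2 + k ≤ i → i ≤ e → In i
            right i l u = u , λ eq → <⇒≢ l (sym eq)

    S-connected : ConnectedOn G S
    S-connected u∈ v∈ = case ∈⇒In u∈ , ∈⇒In v∈ of λ { ((t , t∈ , refl) , (t′ , t′∈ , refl)) →
      Path-sym (from-start t t∈) ◅◅ from-start t′ t′∈ }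

    S-isPDS : 2 ≤ ∣ S ∣ → ∣ S ∣ < n → 3 * (∣ S ∣ ∸ 1) ≤ 2 * (n ∸ 1) → IsPDS G S
    S-isPDS 2≤ <n ineq = record
      { 2≤∣S∣ = 2≤
      ; ∣S∣<n = <n
      ; proportional = λ {u} u∈ → cross-≥ 2≤ (<-trans 2≤ <n)
          (subst (λ d → d * (∣ S ∣ ∸ 1) ≤ degreeIn G S u * (n ∸ 1)) (sym (cubic u))
            (≤-trans ineq (*-monoˡ-≤ (n ∸ 1) (2≤degreeIn u∈))))
      }

-- Exhaustive check of the two graphs with eight vertices

indicator : Bool → ℕ
indicator b = if b then 1 else 0

length-filter : ∀ {a p} {A : Set a} {P : Pred A p} (P? : Decidable P) xs →
  length (filter P? xs) ≡ sum (List.map (indicator ∘ does ∘ P?) xs)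
length-filter P? []       = refl
length-filter P? (x ∷ xs) with does (P? x)
... | true  = cong suc (length-filter P? xs)
... | false = length-filter P? xs

every : ∀ k → (Vec Bool k → Bool) → Bool
every zero    p = p []
every (suc k) p = every k (p ∘ (true ∷_)) ∧ every k (p ∘ (false ∷_))

every-sound : ∀ k p → every k p ≡ true → ∀ bs → p bs ≡ true
every-sound zero    p eq [] = eq
every-sound (suc k) p eq (b ∷ bs) with every k (p ∘ (true ∷_)) in e | b
... | true  | true  = every-sound k _ e bs
... | true  | false = every-sound k _ eq bs
... | false | _     = case eq of λ ()

count : ∀ {k} → Vec Bool k → ℕ
count []       = 0
count (b ∷ bs) = indicator b + count bs

-- Offset 7 is the predecessor on a cycle of length 8. The final 0 gives the expression the form of
-- a sum over a list of three, as `length-filter` produces it.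
degreeAt : (ℕ → ℕ) → Vec Bool 8 → ℕ → ℕ
degreeAt f bs t = indicator (at (t + 1)) + (indicator (at (t + 7)) + (indicator (at (t + f t)) + 0))
  where
  at : ℕ → Bool
  at i = lookup bs (i mod 8)

violated : (ℕ → ℕ) → Vec Bool 8 → ℕ → Bool
violated f bs t = lookup bs (t mod 8) ∧ (degreeAt f bs t <ᵇ 2)

-- For five of eight vertices the density condition reads 3 * 4 ≤ degree * 7, so each member needs
-- at least two neighbours inside. That this always fails somewhere is left to evaluation over all
-- 256 subsets.
no-five : (ℕ → ℕ) → Vec Bool 8 → Bool
no-five f bs = not (count bs ≡ᵇ 5) ∨ any (violated f bs) (upTo 8)

no-five-cube : every 8 (no-five cube) ≡ true
no-five-cube = refl

no-five-diamonds : every 8 (no-five diamonds) ≡ true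
no-five-diamonds = refl

any-false : ∀ {a} {A : Set a} (p : A → Bool) → (∀ x → p x ≡ false) → ∀ xs → any p xs ≡ false
any-false p none []       = refl
any-false p none (x ∷ xs) rewrite none x = any-false p none xs

-- K = ⌊(2 n + 1) / 3⌋
Optimum : ℕ → ℕ → Set
Optimum n K = 3 * K ≤ 2 * n + 1 × 2 * n ≤ 3 * K + 1

optimum-0 : ∀ m → Optimum (3 * m) (2 * m)
optimum-0 m = linear (m ∷ []) (λ m → ⊢ 3 ⊗ (2 ⊗ m) ≤′ 2 ⊗ (3 ⊗ m) ⊕ # 1)
            , linear (m ∷ []) (λ m → ⊢ 2 ⊗ (3 ⊗ m) ≤′ 3 ⊗ (2 ⊗ m) ⊕ # 1)

optimum-+ : ∀ m r → 1 ≤ r → r ≤ 2 → Optimum (3 * m + r) (2 * m + 1)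
optimum-+ m r 1≤r r≤2 =
    linear (m ∷ r ∷ []) (λ m r → # 1 ≤′ r ⇒ ⊢ 3 ⊗ (2 ⊗ m ⊕ # 1) ≤′ 2 ⊗ (3 ⊗ m ⊕ r) ⊕ # 1) 1≤r
  , linear (m ∷ r ∷ []) (λ m r → r ≤′ # 2 ⇒ ⊢ 2 ⊗ (3 ⊗ m ⊕ r) ≤′ 3 ⊗ (2 ⊗ m ⊕ # 1) ⊕ # 1) r≤2

three-halves : ∀ {k n} → 1 ≤ k → 1 ≤ n → 3 * (k ∸ 1) ≤ 2 * (n ∸ 1) → 3 * k ≤ 2 * n + 1
three-halves {suc k} {suc n} _ _ = linear (k ∷ n ∷ []) λ k n →
  3 ⊗ k ≤′ 2 ⊗ n ⇒ ⊢ 3 ⊗ (# 1 ⊕ k) ≤′ 2 ⊗ (# 1 ⊕ n) ⊕ # 1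

12≤7d⇒2≤d : ∀ d → 12 ≤ d * 7 → 2 ≤ d
12≤7d⇒2≤d 1 p = ⊥-elim (<⇒≱ (m≤n+m 8 4) p)
12≤7d⇒2≤d (suc (suc d)) _ = s≤s (s≤s z≤n)

three-halves⁻ : ∀ {k n} → 1 ≤ k → 1 ≤ n → 3 * k ≤ 2 * n + 1 → 3 * (k ∸ 1) ≤ 2 * (n ∸ 1)
three-halves⁻ {suc k} {suc n} _ _ = linear (k ∷ n ∷ []) λ k n →
  3 ⊗ (# 1 ⊕ k) ≤′ 2 ⊗ (# 1 ⊕ n) ⊕ # 1 ⇒ ⊢ 3 ⊗ k ≤′ 2 ⊗ n

-- Upper bounds and optimality of pieces

module OptimumGraph {n : ℕ} {G : Graph n} (connected : Connected G) (cubic : Cubic G) (H : HamiltonianCycle G) where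
  open Graph G
  open Positions cubic H
  open PieceGraph cubic H
  open Shape n jump chords using (4≤n)

  private
    crossing : ∀ {T : Subset n} {u w} → Star (InducedAdj G ⊤) u w → u ∈ T → w ∉ T → ∃[ u′ ] ∃[ w′ ] u′ ∈ T × w′ ∉ T × Adj u′ w′
    crossing ε u∈ w∉ = ⊥-elim (w∉ u∈)
    crossing {T} (_◅_ {j = v} (_ , _ , a) path) u∈ w∉ with v ∈? T
    ... | yes v∈ = crossing path v∈ w∉
    ... | no v∉  = _ , v , u∈ , v∉ , a

    outsider : (T : Subset n) → ∣ T ∣ < n → ∃[ w ] w ∉ T
    outsider T ∣T∣<n with any? (λ w → ¬? (w ∈? T))
    ... | yes p = p
    ... | no ¬p = ⊥-elim (<⇒≱ ∣T∣<n (≤-trans (≤-reflexive (sym (∣⊤∣≡n n))) (p⊆q⇒∣p∣≤∣q∣ all)))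
      where
      all : ∀ {w} → w ∈ ⊤ → w ∈ T
      all {w} _ with w ∈? T
      ... | yes w∈ = w∈
      ... | no w∉  = ⊥-elim (¬p (w , w∉))

    member : (T : Subset n) → 2 ≤ ∣ T ∣ → ∃[ u ] u ∈ T
    member T 2≤ with nonempty? T
    ... | yes p = p
    ... | no ¬p = ⊥-elim (<⇒≱ 2≤ (≤-trans (≤-reflexive (trans (cong ∣_∣ (Empty-unique ¬p)) (∣⊥∣≡0 n))) z≤n))

  degree-bound : ∀ {T u} → IsPDS G T → u ∈ T → 3 * (∣ T ∣ ∸ 1) ≤ degreeIn G T u * (n ∸ 1)
  degree-bound {T} {u} P u∈ = subst (λ d → d * (∣ T ∣ ∸ 1) ≤ degreeIn G T u * (n ∸ 1)) (cubic u)
      (≥-cross 2≤∣S∣ (<-trans 2≤∣S∣ ∣S∣<n) (proportional u∈))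
    where open IsPDS P

  upper-bound : ∀ {T} → IsPDS G T → 3 * (∣ T ∣ ∸ 1) ≤ 2 * (n ∸ 1)
  upper-bound {T} P =
    let u , u∈ = member T 2≤∣S∣
        w , w∉ = outsider T ∣S∣<n
        u′ , w′ , u′∈ , w′∉ , a = crossing (connected ∈⊤ ∈⊤) u∈ w∉
    in ≤-trans (degree-bound P u′∈) (*-monoˡ-≤ (n ∸ 1) (≤-pred (≤-trans
         (p⊂q⇒∣p∣<∣q∣ (p∩q⊆p _ T , w′ , ∈-neighbours⁺ G a , λ w′∈ → w′∉ (proj₂ (x∈p∩q⁻ _ T w′∈))))
         (≤-reflexive (cubic u′)))))
    where open IsPDS P

  bound-optimum : ∀ {T K} → Optimum n K → IsPDS G T → ∣ T ∣ ≤ K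
  bound-optimum {T} {K} (_ , 2n≤) P = ≮⇒≥ λ K<T → case
      linear (∣ T ∣ ∷ n ∷ K ∷ []) (λ T n K → # 1 ⊕ K ≤′ T ⇒ 2 ⊗ n ≤′ 3 ⊗ K ⊕ # 1 ⇒ 3 ⊗ T ≤′ 2 ⊗ n ⊕ # 1 ⇒ ⊢ # 1 ≤′ # 0)
        K<T 2n≤ (three-halves (≤-trans (s≤s z≤n) 2≤∣S∣) 0<n′ (upper-bound P)) of λ ()
    where open IsPDS P

  module _ {a e s : ℕ} (P : Piece n jump a e s) where
    open Piece P

    piece-optimal : ∀ {K} → Optimum n K → (e < s × suc e ≡ K) ⊎ (s ≤ e × e ≡ K) →
      IsConnectedMaximumPDS G (S P)
    piece-optimal {K} opt size = record
      { isPDS = S-isPDS P (subst (2 ≤_) (sym ∣S∣≡K) 2≤K) (subst (_< n) (sym ∣S∣≡K) K<n)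
                          (subst (λ k → 3 * (k ∸ 1) ≤ 2 * (n ∸ 1)) (sym ∣S∣≡K)
                            (three-halves⁻ (≤-trans (s≤s z≤n) 2≤K) 0<n′ (proj₁ opt)))
      ; connected = S-connected P
      ; maximum = λ T Q → subst (∣ T ∣ ≤_) (sym ∣S∣≡K) (bound-optimum opt Q)
      }
      where
      sizes = size-build a s (suc e) e<n
      ∣S∣≡K : ∣ S P ∣ ≡ K
      ∣S∣≡K = [ (λ { (e<s , eq) → trans (proj₁ sizes e<s) eq })
              , (λ { (s≤e , eq) → trans (suc-injective (proj₂ sizes (s≤s s≤e))) eq }) ]′ size
      2≤K : 2 ≤ K
      2≤K = ≮⇒≥ λ K<2 → case linear (n ∷ K ∷ []) (λ n K →
        # 1 ⊕ K ≤′ # 2 ⇒ # 4 ≤′ n ⇒ 2 ⊗ n ≤′ 3 ⊗ K ⊕ # 1 ⇒ ⊢ # 1 ≤′ # 0) K<2 4≤n (proj₂ opt) of λ ()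
      K<n : K < n
      K<n = ≰⇒> λ n≤K → case linear (n ∷ K ∷ []) (λ n K →
        n ≤′ K ⇒ # 4 ≤′ n ⇒ 3 ⊗ K ≤′ 2 ⊗ n ⊕ # 1 ⇒ ⊢ # 1 ≤′ # 0) n≤K 4≤n (proj₁ opt) of λ ()

  module _ (n≡8 : n ≡ 8) (j : ℕ) (f : ℕ → ℕ) (table : ∀ i → jump (j + i) ≡ f i)
           (sound : every 8 (no-five f) ≡ true) (T : Subset n) where

    private
      W : ℕ → Fin n
      W t = vertex (j + t)

      bits : Vec Bool 8
      bits = tabulate λ i → does (W (toℕ i) ∈? T)

      bit : ∀ x → lookup bits (x mod 8) ≡ does (W x ∈? T)
      bit x = trans (lookup∘tabulate (λ i → does (W (toℕ i) ∈? T)) (x mod 8)) (cong (λ v → does (v ∈? T))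
        (trans (cong (vertex ∘ (j +_)) (toℕ-fromℕ< (m%n<n x 8)))
               (vertex-cong (%-cong-+ˡ j (subst (λ k → .{{_ : NonZero k}} → x % 8 % k ≡ x % k) (sym n≡8) (m%n%n≡m%n x 8))))))
        where
        %-cong-+ˡ : ∀ i {x y} → x % n ≡ y % n → (i + x) % n ≡ (i + y) % n
        %-cong-+ˡ i {x} {y} eq = trans (cong (_% n) (+-comm i x)) (trans (%-cong-+ʳ i eq) (cong (_% n) (+-comm y i)))

      size≤ : ∣ T ∣ ≤ count bits
      size≤ = ≤-trans (covered⇒∣p∣≤ (filter (_∈? T) (applyUpTo W 8)) T cover) (≤-reflexive (length-filter (_∈? T) (applyUpTo W 8)))
        where
        cover : ∀ {v} → v ∈ T → _
        cover {v} v∈ = case offset j v of λ { (x , x<n , refl) →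
          ∈-filter⁺ (_∈? T) (∈-applyUpTo⁺ W (subst (x <_) n≡8 x<n)) v∈ }

      size≥ : count bits ≤ ∣ T ∣
      size≥ = ≤-trans (≤-reflexive (sym (length-filter (_∈? T) (applyUpTo W 8))))
        (unique⇒≤∣p∣ T (filter⁺ (_∈? T) (applyUpTo⁺₁ W 8 distinct)) (All.all-filter (_∈? T) (applyUpTo W 8)))
        where
        distinct : ∀ {x y} → x < y → y < 8 → W x ≢ W y
        distinct x<y y<8 eq = <⇒≢ x<y (offset-injective j (<-trans x<y y<n) y<n eq)
          where y<n = subst (_ <_) (sym n≡8) y<8

      degree≤ : ∀ t → degreeIn G T (W t) ≤ degreeAt f bits t
      degree≤ t = ≤-trans (covered⇒∣p∣≤ (filter (_∈? T) nbrs) _ cover)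
        (≤-reflexive (trans (length-filter (_∈? T) nbrs)
          (cong₂ _+_ (cong indicator (sym (bit (t + 1))))
            (cong₂ _+_ (cong indicator (sym (bit (t + 7))))
              (cong (_+ 0) (cong indicator (sym (bit (t + f t)))))))))
        where
        nbrs = W (t + 1) ∷ W (t + 7) ∷ W (t + f t) ∷ []
        cover : ∀ {v} → v ∈ neighbours G (W t) ∩ T → _
        cover {v} v∈ = ∈-filter⁺ (_∈? T)
          ([ (λ eq → here (trans eq (cong vertex (+-assoc j t 1))))
           , [ (λ eq → there (here (trans eq (trans (cong (λ k → vertex (j + t + (k ∸ 1))) n≡8) (cong vertex (+-assoc j t 7))))))
             , (λ eq → there (there (here (trans eq (trans (cong (λ k → vertex (j + t + k)) (table t)) (cong vertex (+-assoc j t (f t))))))))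
             ]′ ]′ (neighbour-cases (j + t) (∈-neighbours⁻ G (proj₁ (x∈p∩q⁻ (neighbours G (W t)) T v∈)))))
          (proj₂ (x∈p∩q⁻ (neighbours G (W t)) T v∈))

    no-PDS-of-size-5 : IsPDS G T → ∣ T ∣ ≢ 5
    no-PDS-of-size-5 P ∣T∣≡5 = case passes of λ ()
      where
      count≡5 : (count bits ≡ᵇ 5) ≡ true
      count≡5 = Equivalence.to T-≡ (≡⇒≡ᵇ _ _ (trans (≤-antisym size≥ size≤) ∣T∣≡5))

      fine : ∀ t → violated f bits t ≡ false
      fine t with lookup bits (t mod 8) in e | degreeAt f bits t <ᵇ 2 in e′
      ... | false | _     = refl
      ... | true  | false = refl
      ... | true  | true  = ⊥-elim (<⇒≱ (<ᵇ⇒< _ _ (Equivalence.from T-≡ e′))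
              (≤-trans (2≤ (degree-bound P W∈)) (degree≤ t)))
        where
        W∈ : W t ∈ T
        W∈ with W t ∈? T | trans (sym (bit t)) e
        ... | yes p | _ = p
        ... | no _  | ()
        2≤ : ∀ {d} → 3 * (∣ T ∣ ∸ 1) ≤ d * (n ∸ 1) → 2 ≤ d
        2≤ p rewrite ∣T∣≡5 | n≡8 = 12≤7d⇒2≤d _ p

      passes : false ≡ true
      passes = trans (sym (cong₂ (λ c v → not c ∨ v) count≡5 (any-false (violated f bits) fine (upTo 8))))
                     (every-sound 8 (no-five f) sound bits)

  exceptional-bound : Exceptional n jump → ∀ {T} → IsPDS G T → ∣ T ∣ ≤ 4
  exceptional-bound (n≡8 , j , table) {T} P = ≤-pred (≤∧≢⇒< ∣T∣≤5 ∣T∣≢5)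
    where
    ∣T∣≤5 : ∣ T ∣ ≤ 5
    ∣T∣≤5 = bound-optimum (subst (λ n → Optimum n 5) (sym n≡8) (optimum-+ 2 2 (s≤s z≤n) ≤-refl)) P
    ∣T∣≢5 : ∣ T ∣ ≢ 5
    ∣T∣≢5 = [ (λ t → no-PDS-of-size-5 n≡8 j cube t no-five-cube T P)
            , (λ t → no-PDS-of-size-5 n≡8 j diamonds t no-five-diamonds T P) ]′ table

  -- Both tables have an entry of at most 3 at index 0 and of at least 5 at index 3, so the same arc
  -- of four vertices serves both graphs.
  exceptional-arc : Exceptional n jump → ∃[ a ] ClosedArc n jump 3 a
  exceptional-arc (n≡8 , j , table) = j , [ (λ t → arc cube t ≤-refl refl) , (λ t → arc diamonds t (n≤1+n 2) refl) ]′ table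
    where
    arc : ∀ f → (∀ i → jump (j + i) ≡ f i) → f 0 ≤ 3 → (8 ≤ᵇ 3 + f 3) ≡ true → ClosedArc n jump 3 j
    arc f t f0 f3 = subst (_≤ 3) (trans (sym (t 0)) (cong jump (+-identityʳ j))) f0
                  , subst₂ _≤_ (sym n≡8) (cong (3 +_) (sym (t 3))) (≤ᵇ⇒≤ 8 (3 + f 3) (Equivalence.from T-≡ f3))

  exceptional-optimal : Exceptional n jump → ∀ {a} (P : Piece n jump a 3 4) → IsConnectedMaximumPDS G (S P)
  exceptional-optimal E@(n≡8 , _) {a} P = record
    { isPDS     = S-isPDS P (subst (2 ≤_) (sym ∣S∣≡4) (s≤s (s≤s z≤n)))
                            (subst₂ _<_ (sym ∣S∣≡4) (sym n≡8) (m≤m+n 5 3))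
                            (subst₂ (λ k n → 3 * (k ∸ 1) ≤ 2 * (n ∸ 1)) (sym ∣S∣≡4) (sym n≡8) (m≤m+n 9 5))
    ; connected = S-connected P
    ; maximum   = λ T Q → subst (∣ T ∣ ≤_) (sym ∣S∣≡4) (exceptional-bound E Q)
    }
    where
    ∣S∣≡4 : ∣ S P ∣ ≡ 4
    ∣S∣≡4 = proj₁ (size-build a 4 4 (≤-trans (m≤m+n 4 4) (≤-reflexive (sym n≡8)))) ≤-refl

-- Program logic

update-same : ∀ (f : ℕ → ℕ) i x → (f [ i ↦ x ]) i ≡ x
update-same f i x with i ≡ᵇ i | ≡⇒≡ᵇ i i refl
... | true | _ = refl

update-other : ∀ (f : ℕ → ℕ) {i j} x → j ≢ i → (f [ i ↦ x ]) j ≡ f j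
update-other f {i} {j} x j≢i with j ≡ᵇ i in eq
... | false = refl
... | true  = ⊥-elim (j≢i (≡ᵇ⇒≡ j i (subst T (sym eq) tt)))

TestHolds : Test → State → Set
TestHolds (a ≐ b) σ = ⟦ a ⟧ᵒ σ ≡ ⟦ b ⟧ᵒ σ
TestHolds (a ≺ b) σ = ⟦ a ⟧ᵒ σ < ⟦ b ⟧ᵒ σ
TestHolds (a ≼ b) σ = ⟦ a ⟧ᵒ σ ≤ ⟦ b ⟧ᵒ σ

private
  reflects : ∀ {P : Set} {b} → (T b → P) → (P → T b) → Reflects P b
  reflects {b = true}  to from = ofʸ (to tt)
  reflects {b = false} to from = ofⁿ from

test-reflects : ∀ b σ → Reflects (TestHolds b σ) (⟦ b ⟧ᵗ σ)
test-reflects (a ≐ b) σ = reflects (≡ᵇ⇒≡ _ _) (≡⇒≡ᵇ _ _)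
test-reflects (a ≺ b) σ = reflects (<ᵇ⇒< _ _) <⇒<ᵇ
test-reflects (a ≼ b) σ = reflects (≤ᵇ⇒≤ _ _) ≤⇒≤ᵇ

loopFree : Program → Bool
loopFree skip                       = true
loopFree (r ≔ e)                    = true
loopFree (mem[ a ]≔ b)              = true
loopFree (p ⨾ q)                    = loopFree p ∧ loopFree q
loopFree (If b Then p Else q End)   = loopFree p ∧ loopFree q
loopFree (While b Do p End)         = false

-- A bound on the running time, where a loop counts for the part that is
-- repeated at most n times and is then multiplied by n.
cost : Program → ℕ
cost skip                     = 0
cost (r ≔ e)                  = 1
cost (mem[ a ]≔ b)            = 1
cost (p ⨾ q)                  = cost p + cost q
cost (If b Then p Else q End) = suc (cost p ⊔ cost q)
cost (While b Do p End)       = suc (suc (cost p))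

module Logic (inp : ℕ → ℕ) (w n : ℕ) (0<n : 0 < n) where
  open Machine inp w using (⟦_⟧ᵉ; NoOverflow; run-skip; run-assign; run-store; run-seq; run-then; run-else; run-stop; run-loop)

  cost-bounds : ∀ p {σ σ′ t} → T (loopFree p) → Run inp w p σ σ′ t → t ≤ cost p
  cost-bounds skip          _  run-skip       = z≤n
  cost-bounds (r ≔ e)       _  (run-assign _) = ≤-refl
  cost-bounds (mem[ a ]≔ b) _  run-store      = ≤-refl
  cost-bounds (p ⨾ q)       lf (run-seq x y) with loopFree p in e
  ... | true = +-mono-≤ (cost-bounds p (subst T (sym e) tt) x) (cost-bounds q lf y)
  cost-bounds (If b Then p Else q End) lf (run-then _ x) with loopFree p in e
  ... | true = s≤s (m≤n⇒m≤n⊔o (cost q) (cost-bounds p (subst T (sym e) tt) x))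
  cost-bounds (If b Then p Else q End) lf (run-else _ x) with loopFree p in e
  ... | true = s≤s (m≤n⇒m≤o⊔n (cost p) (cost-bounds q lf x))

  -- Steps are not counted here: `cost-bounds` limits every run of loop-free code, so time enters
  -- only on passing to `Timed`.
  Exec : Program → State → (State → Set) → Set
  Exec p σ Q = ∃[ σ′ ] ∃[ t ] Run inp w p σ σ′ t × Q σ′

  -- The factor `n` is wasteful for straight-line code, but with it the bounds simply add up under
  -- sequencing.
  Timed : Program → State → (State → Set) → Set
  Timed p σ Q = ∃[ σ′ ] ∃[ t ] Run inp w p σ σ′ t × t ≤ cost p * n × Q σ′

  weaken : ∀ {p σ} {Q Q′ : State → Set} → (∀ {σ′} → Q σ′ → Q′ σ′) → Exec p σ Q → Exec p σ Q′
  weaken f (σ′ , t , r , q) = σ′ , t , r , f q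

  exec-skip : ∀ {σ} {Q : State → Set} → Q σ → Exec skip σ Q
  exec-skip q = _ , _ , run-skip , q

  -- The new state records the intended value `v` instead of the evaluated expression, so that later
  -- reads of the register compute to `v`.
  exec-assign : ∀ {r e σ} {Q : State → Set} v → ⟦ e ⟧ᵉ σ ≡ v → NoOverflow e σ →
    Q ⟨ regs σ [ r ↦ v ] , mem σ ⟩ → Exec (r ≔ e) σ Q
  exec-assign _ refl ok q = _ , _ , run-assign ok , q

  exec-store : ∀ {a b σ} {Q : State → Set} i x → ⟦ a ⟧ᵒ σ ≡ i → ⟦ b ⟧ᵒ σ ≡ x →
    Q ⟨ regs σ , mem σ [ i ↦ x ] ⟩ → Exec (mem[ a ]≔ b) σ Q
  exec-store _ _ refl refl q = _ , _ , run-store , q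

  exec-seq : ∀ {p q σ} {Q : State → Set} → Exec p σ (λ σ′ → Exec q σ′ Q) → Exec (p ⨾ q) σ Q
  exec-seq (_ , _ , r , _ , _ , r′ , q) = _ , _ , run-seq r r′ , q

  set : ∀ {r e q σ} {Q : State → Set} v → ⟦ e ⟧ᵉ σ ≡ v → NoOverflow e σ →
    Exec q ⟨ regs σ [ r ↦ v ] , mem σ ⟩ Q → Exec (r ≔ e ⨾ q) σ Q
  set v eq ok q = exec-seq (exec-assign v eq ok q)

  add : ∀ {r a b q σ} {Q : State → Set} v → ⟦ a ⟧ᵒ σ + ⟦ b ⟧ᵒ σ ≡ v → v ≤ w →
    Exec q ⟨ regs σ [ r ↦ v ] , mem σ ⟩ Q → Exec (r ≔ a ⊞ b ⨾ q) σ Q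
  add v eq v≤w = set v eq (subst (_≤ w) (sym eq) v≤w)

  put : ∀ {a b q σ} {Q : State → Set} i x → ⟦ a ⟧ᵒ σ ≡ i → ⟦ b ⟧ᵒ σ ≡ x →
    Exec q ⟨ regs σ , mem σ [ i ↦ x ] ⟩ Q → Exec (mem[ a ]≔ b ⨾ q) σ Q
  put i x p q r = exec-seq (exec-store i x p q r)

  exec-if : ∀ {b p q σ} {Q : State → Set} → (TestHolds b σ → Exec p σ Q) → (¬ TestHolds b σ → Exec q σ Q) →
    Exec (If b Then p Else q End) σ Q
  exec-if {b} {σ = σ} yes′ no′ with ⟦ b ⟧ᵗ σ in eq | test-reflects b σ
  ... | true  | ofʸ h  = let _ , _ , r , q = yes′ h in _ , _ , run-then eq r , q
  ... | false | ofⁿ ¬h = let _ , _ , r , q = no′ ¬h in _ , _ , run-else eq r , q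

  timed : ∀ {p σ} {Q : State → Set} → {_ : T (loopFree p)} → Exec p σ Q → Timed p σ Q
  timed {p} {_} {_} {lf} (σ′ , t , r , q) =
    σ′ , t , r , ≤-trans (cost-bounds p lf r) (m≤m*n (cost p) n {{>-nonZero 0<n}}) , q

  _⟫_ : ∀ {p σ} {Q Q′ : State → Set} → Timed p σ Q → (∀ {σ′} → Q σ′ → Q′ σ′) → Timed p σ Q′
  (σ′ , t , r , t≤ , q) ⟫ f = σ′ , t , r , t≤ , f q

  timed-seq : ∀ {p q σ} {Q : State → Set} → Timed p σ (λ σ′ → Timed q σ′ Q) → Timed (p ⨾ q) σ Q
  timed-seq {p} {q} (_ , _ , r , s , _ , _ , r′ , t , post) =
    _ , _ , run-seq r r′ , ≤-trans (+-mono-≤ s t) (≤-reflexive (sym (*-distribʳ-+ n (cost p) (cost q)))) , post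

  timed-if : ∀ {b p q σ} {Q : State → Set} → (TestHolds b σ → Timed p σ Q) → (¬ TestHolds b σ → Timed q σ Q) →
    Timed (If b Then p Else q End) σ Q
  timed-if {b} {p} {q} {σ} yes′ no′ with ⟦ b ⟧ᵗ σ in eq | test-reflects b σ
  ... | true  | ofʸ h  = let _ , _ , r , t , post = yes′ h in
        _ , _ , run-then eq r , +-mono-≤ 0<n (≤-trans t (*-monoˡ-≤ n (m≤m⊔n (cost p) (cost q)))) , post
  ... | false | ofⁿ ¬h = let _ , _ , r , t , post = no′ ¬h in
        _ , _ , run-else eq r , +-mono-≤ 0<n (≤-trans t (*-monoˡ-≤ n (m≤n⊔m (cost p) (cost q)))) , post

  -- The index of `J` counts the rounds and need not be held in a register. Each round costs the
  -- body and one test; the closing test is paid for by the second successor in `cost`, because `n`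
  -- is positive.
  timed-for : ∀ {b p} (J : ℕ → State → Set) k → {_ : T (loopFree p)} → k ≤ n →
    (∀ i σ → i < k → J i σ → TestHolds b σ) → (∀ σ → J k σ → ¬ TestHolds b σ) →
    (∀ i σ → i < k → J i σ → Exec p σ (J (suc i))) →
    ∀ {σ} → J 0 σ → Timed (While b Do p End) σ (J k)
  timed-for {b} {p} J k {lf} k≤n holds stops body {σ} j₀ =
    let σ′ , t , r , t≤ , q = go k 0 σ refl j₀
    in σ′ , t , r , ≤-trans t≤ (+-mono-≤ 0<n
         (≤-trans (*-monoˡ-≤ (suc (cost p)) k≤n) (≤-reflexive (*-comm n (suc (cost p)))))) , q
    where
    go : ∀ d i σ → i + d ≡ k → J i σ → ∃[ σ′ ] ∃[ t ] Run inp w (While b Do p End) σ σ′ t × t ≤ suc (d * suc (cost p)) × J k σ′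
    go zero i σ eq j with trans (sym (+-identityʳ i)) eq
    ... | refl with ⟦ b ⟧ᵗ σ in e | test-reflects b σ
    ...   | true  | ofʸ h = ⊥-elim (stops σ j h)
    ...   | false | _     = σ , 1 , run-stop e , ≤-refl , j
    go (suc d) i σ eq j with ⟦ b ⟧ᵗ σ in e | test-reflects b σ
    ... | false | ofⁿ ¬h = ⊥-elim (¬h (holds i σ (m+1+n≤m⇒ eq) j))
      where
      m+1+n≤m⇒ : i + suc d ≡ k → i < k
      m+1+n≤m⇒ refl = m<m+n i (s≤s z≤n)
    ... | true  | _ =
      let σ₁ , s , r₁ , j₁ = body i σ i<k j
          σ₂ , t , r₂ , t≤ , q = go d (suc i) σ₁ (trans (sym (+-suc i d)) eq) j₁
      in σ₂ , suc (s + t) , run-loop e r₁ r₂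
       , s≤s (≤-trans (+-mono-≤ (cost-bounds p lf r₁) t≤) (≤-reflexive (+-suc (cost p) (d * suc (cost p))))) , q
      where
      i<k : i < k
      i<k = subst (i <_) eq (m<m+n i (s≤s z≤n))

-- The algorithm

-- mem[n + v] will hold the position of v on the cycle, and mem[2 n + i] for i < 2 n
-- the distance jump i; the second period saves reductions modulo n.  The solution
-- is recorded in A, e₀, s₀ as the a, e, s of a Piece, with e₀ = 0 if there is none.
N M D R C N₂ I X Y A e₀ s₀ E Z W U k₀ S₀ : Reg
N = 0
M = 1
D = 2
R = 3
C = 4
N₂ = 5
I = 6
X = 7
Y = 8
A = 9
e₀ = 10
s₀ = 11
E = 12
Z = 13
W = 14
U = 15
k₀ = 16
S₀ = 17

-- The machine cannot divide, so ⌊n / 3⌋ and its double are accumulated in `M` and `E` by repeated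
-- subtraction, leaving n mod 3 in `R`.
divide : Program
divide = R ≔ reg R ⊟ lit 3 ⨾ M ≔ reg M ⊞ lit 1 ⨾ E ≔ reg E ⊞ lit 2

-- Afterwards `E` is K, the last offset of a punctured arc, `D` is K - 1, the last offset of a
-- closed arc, and `C` is the address of the first cycle cell.
bases : Program
bases =
  If lit 1 ≼ reg R Then E ≔ reg E ⊞ lit 1 Else skip End ⨾
  D ≔ reg E ⊟ lit 1 ⨾
  N₂ ≔ reg N ⊞ reg N ⨾
  C ≔ reg N₂ ⊞ reg N ⨾
  C ≔ reg C ⊞ lit 1

setup : Program
setup =
  (N ≔ input[ lit 0 ] ⨾ R ≔ val (reg N)) ⨾
  While lit 3 ≼ reg R Do divide End ⨾
  bases

locate : Program
locate =
  X ≔ reg C ⊞ reg I ⨾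
  X ≔ input[ reg X ] ⨾
  X ≔ reg N ⊞ reg X ⨾
  mem[ reg X ]≔ reg I ⨾
  I ≔ reg I ⊞ lit 1

scan-end : Program
scan-end =
  Y ≔ reg Y ⊟ reg I ⨾
  U ≔ reg Y ⊞ lit 1 ⨾
  If lit 1 ≺ reg Y Then
    If reg U ≺ reg N Then
      mem[ reg Z ]≔ reg Y ⨾
      mem[ reg W ]≔ reg Y
    Else skip End
  Else skip End

-- Handles one entry of the adjacency list of the vertex at position I; X + 1 is
-- the address of its cell.  The chord is the entry at distance ≢ ±1.
scan : Program
scan =
  X ≔ reg X ⊞ lit 1 ⨾
  Y ≔ input[ reg X ] ⨾
  Y ≔ reg N ⊞ reg Y ⨾
  Y ≔ mem[ reg Y ] ⨾
  If reg Y ≺ reg I Then Y ≔ reg Y ⊞ reg N Else skip End ⨾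
  scan-end

measure : Program
measure =
  X ≔ reg C ⊞ reg I ⨾
  X ≔ input[ reg X ] ⨾
  Y ≔ reg X ⊞ reg X ⨾
  X ≔ reg Y ⊞ reg X ⨾
  Z ≔ reg N₂ ⊞ reg I ⨾
  W ≔ reg Z ⊞ reg N ⨾
  scan ⨾
  scan ⨾
  scan ⨾
  I ≔ reg I ⊞ lit 1

tryArc : Program
tryArc =
  X ≔ reg N₂ ⊞ reg I ⨾
  Y ≔ mem[ reg X ] ⨾
  If reg Y ≼ reg D Then
    X ≔ reg X ⊞ reg D ⨾
    Y ≔ mem[ reg X ] ⨾
    Y ≔ reg D ⊞ reg Y ⨾
    If reg N ≼ reg Y Then
      A ≔ val (reg I) ⨾ e₀ ≔ val (reg D) ⨾ s₀ ≔ reg D ⊞ lit 1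
    Else skip End
  Else skip End

keepHole : Program
keepHole = A ≔ val (reg I) ⨾ e₀ ≔ val (reg E) ⨾ s₀ ≔ val (reg S₀)

tryRight : Program
tryRight =
  W ≔ reg k₀ ⊞ lit 2 ⨾
  Z ≔ reg X ⊞ reg W ⨾
  Z ≔ mem[ reg Z ] ⨾
  Z ≔ reg W ⊞ reg Z ⨾
  If reg Z ≼ reg E Then keepHole Else
    If reg N ≼ reg Z Then keepHole Else skip End
  End

tryLeft : Program
tryLeft =
  If lit 1 ≼ reg k₀ Then
    W ≔ reg k₀ ⊞ lit 3 ⨾
    If reg W ≼ reg E Then
      Z ≔ reg X ⊞ reg k₀ ⨾
      Z ≔ mem[ reg Z ] ⨾
      Z ≔ reg k₀ ⊞ reg Z ⨾
      If reg Z ≼ reg E Then tryRight Else skip End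
    Else skip End
  Else skip End

tryHole : Program
tryHole =
  S₀ ≔ reg k₀ ⊞ lit 1 ⨾
  X ≔ reg N₂ ⊞ reg I ⨾
  Y ≔ mem[ reg X ] ⨾
  If reg Y ≼ reg E Then
    If reg Y ≐ reg S₀ Then skip Else
      Z ≔ reg X ⊞ reg E ⨾
      Z ≔ mem[ reg Z ] ⨾
      Z ≔ reg E ⊞ reg Z ⨾
      If reg N ≼ reg Z Then
        W ≔ reg N ⊞ reg S₀ ⨾
        If reg Z ≐ reg W Then skip Else tryLeft End
      Else skip End
    End
  Else skip End

-- That holes at a + (1 + k) for these five k suffice is exceptional₁ and exceptional₂.
searchBody : Program
searchBody =
  tryArc ⨾
  k₀ ≔ val (lit 1) ⨾ tryHole ⨾
  k₀ ≔ val (lit 2) ⨾ tryHole ⨾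
  k₀ ≔ val (lit 4) ⨾ tryHole ⨾
  k₀ ≔ reg M ⊟ lit 3 ⨾ tryHole ⨾
  k₀ ≔ reg M ⊞ lit 1 ⨾ tryHole ⨾
  I ≔ reg I ⊞ lit 1

fallbackBody : Program
fallbackBody = tryArc ⨾ I ≔ reg I ⊞ lit 1

emit : Program
emit =
  If reg I ≐ reg s₀ Then skip Else
    X ≔ reg A ⊞ reg I ⨾
    -- Start and offset are both below `n`, so a single subtraction reduces their sum.
    If reg N ≼ reg X Then X ≔ reg X ⊟ reg N Else skip End ⨾
    X ≔ reg C ⊞ reg X ⨾
    X ≔ input[ reg X ] ⨾
    mem[ reg X ]≔ lit 1
  End ⨾
  I ≔ reg I ⊞ lit 1

-- The loop is only reached for n = 8, where D becomes 3.
fallback : Program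
fallback =
  If reg e₀ ≐ lit 0 Then
    (D ≔ reg D ⊟ lit 1 ⨾ I ≔ val (lit 0)) ⨾
    While reg I ≺ reg N Do fallbackBody End
  Else skip End

algorithm : Program
algorithm =
  setup ⨾
  While reg I ≺ reg N Do locate End ⨾
  I ≔ val (lit 0) ⨾
  While reg I ≺ reg N Do measure End ⨾
  I ≔ val (lit 0) ⨾
  While reg I ≺ reg N Do searchBody End ⨾
  fallback ⨾
  I ≔ val (lit 0) ⨾
  While reg I ≼ reg e₀ Do emit End

-- Correctness and running time of the program

record Constants (n m d vN vM vE vC vN₂ : ℕ) : Set where
  constructor constants
  field
    N≡  : vN ≡ n
    M≡  : vM ≡ m
    E≡  : vE ≡ suc d
    C≡  : vC ≡ 1 + 3 * n
    N₂≡ : vN₂ ≡ 2 * n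

module Verification {n : ℕ} {G : Graph n} (connected : Connected G) (cubic : Cubic G) (H : HamiltonianCycle G)
  (inp : ℕ → ℕ) (enc : EncodesInput G H inp) (w : ℕ) (10n≤w : 10 * n ≤ w) where

  open Graph G
  open Positions cubic H
  open PieceGraph cubic H
  open OptimumGraph connected cubic H
  open Shape n jump chords using (4≤n)
  open Logic inp w n 0<n′
  open EncodesInput enc

  fits : ∀ {v} → v ≤ 10 * n → v ≤ w
  fits v≤ = ≤-trans v≤ 10n≤w

  increment : ∀ {σ i} {Q : State → Set} → i < n → regs σ I ≡ i →
    Q ⟨ regs σ [ I ↦ suc i ] , mem σ ⟩ → Exec (I ≔ reg I ⊞ lit 1) σ Q
  increment {σ} {i} i<n I≡ = exec-assign (suc i) i+1 (subst (_≤ w) (sym i+1)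
      (fits (linear (i ∷ n ∷ []) (λ i n → # 1 ⊕ i ≤′ n ⇒ ⊢ # 1 ⊕ i ≤′ 10 ⊗ n) i<n)))
    where
    i+1 : regs σ I + 1 ≡ suc i
    i+1 = trans (cong (_+ 1) I≡) (+-comm i 1)

  -- In both cases `suc d` is K, with `m` = ⌊n / 3⌋.
  SizeShape : ℕ → ℕ → Set
  SizeShape m d = (n ≡ 3 * m × suc d ≡ 2 * m) ⊎ (∃[ r ] 1 ≤ r × r ≤ 2 × n ≡ 3 * m + r × d ≡ 2 * m)

  -- `Constants` depends on the register values and not on the state, so one proof of it remains
  -- valid, by computation, across assignments to other registers.
  Consts : ℕ → ℕ → State → Set
  Consts m d σ = Constants n m d (regs σ N) (regs σ M) (regs σ E) (regs σ C) (regs σ N₂)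

  Fresh : State → Set
  Fresh σ = regs σ I ≡ 0 × regs σ e₀ ≡ 0 × (∀ x → mem σ x ≡ 0)

  Divided : ℕ → State → Set
  Divided i σ = regs σ N ≡ n × regs σ R + 3 * i ≡ n × regs σ M ≡ i × regs σ E ≡ 2 * i × Fresh σ

  private
    [n/3] : ℕ
    [n/3] = n / 3

    n≡3m+r : n ≡ 3 * [n/3] + n % 3
    n≡3m+r = trans (m≡m%n+[m/n]*n n 3) (trans (+-comm (n % 3) _) (cong (_+ n % 3) (*-comm [n/3] 3)))

    3m≤n : 3 * [n/3] ≤ n
    3m≤n = ≤-trans (m≤m+n _ (n % 3)) (≤-reflexive (sym n≡3m+r))

  divide-step : ∀ i σ → i < [n/3] → Divided i σ → Exec divide σ (Divided (suc i))
  divide-step i σ i<m (N≡ , R≡ , M≡ , E≡ , fr) = go (regs σ R ∸ 3) refl R′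
    where
    small : suc i ≤ 10 * n
    small = linear (i ∷ [n/3] ∷ n ∷ []) (λ i m n → # 1 ⊕ i ≤′ m ⇒ 3 ⊗ m ≤′ n ⇒ ⊢ # 1 ⊕ i ≤′ 10 ⊗ n) i<m 3m≤n
    small₂ : 2 * suc i ≤ 10 * n
    small₂ = linear (i ∷ [n/3] ∷ n ∷ []) (λ i m n → # 1 ⊕ i ≤′ m ⇒ 3 ⊗ m ≤′ n ⇒ ⊢ 2 ⊗ (# 1 ⊕ i) ≤′ 10 ⊗ n) i<m 3m≤n
    E+2 : regs σ E + 2 ≡ 2 * suc i
    E+2 = linear (regs σ E ∷ i ∷ []) (λ E i → E ≡′ 2 ⊗ i ⇒ ⊢ E ⊕ # 2 ≡′ 2 ⊗ (# 1 ⊕ i)) E≡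
    3≤R : 3 ≤ regs σ R
    3≤R = linear (regs σ R ∷ i ∷ [n/3] ∷ n ∷ []) (λ R i m n → R ⊕ 3 ⊗ i ≡′ n ⇒ # 1 ⊕ i ≤′ m ⇒ 3 ⊗ m ≤′ n ⇒ ⊢ # 3 ≤′ R) R≡ i<m 3m≤n
    R′ : regs σ R ∸ 3 + 3 * suc i ≡ n
    R′ = linear ((regs σ R ∸ 3) ∷ regs σ R ∷ i ∷ n ∷ []) (λ R′ R i n → R′ ⊕ # 3 ≡′ R ⇒ R ⊕ 3 ⊗ i ≡′ n ⇒
      ⊢ R′ ⊕ 3 ⊗ (# 1 ⊕ i) ≡′ n) (m∸n+n≡m 3≤R) R≡
    go : ∀ v → regs σ R ∸ 3 ≡ v → v + 3 * suc i ≡ n → Exec divide σ (Divided (suc i))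
    go v eq R′ = set v eq _
      (add (suc i) (trans (cong (_+ 1) M≡) (+-comm i 1)) (fits small)
      (exec-assign (2 * suc i) E+2 (subst (_≤ w) (sym E+2) (fits small₂))
      (N≡ , R′ , refl , refl , fr)))

  Ready : State → Set
  Ready σ = ∃[ m ] ∃[ d ] SizeShape m d × Consts m d σ × regs σ D ≡ d × Fresh σ

  private
    r<3 : n % 3 ≤ 2
    r<3 = ≤-pred (m%n<n n 3)

    remainder : ∀ {x} → x + 3 * [n/3] ≡ n → x ≡ n % 3
    remainder {x} eq = +-cancelʳ-≡ (3 * [n/3]) x (n % 3) (trans eq (trans n≡3m+r (+-comm (3 * [n/3]) (n % 3))))

    1≤m : 1 ≤ [n/3]
    1≤m = ≰⇒> λ m≤0 → case linear (n ∷ [n/3] ∷ (n % 3) ∷ []) (λ n m r →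
      n ≡′ 3 ⊗ m ⊕ r ⇒ r ≤′ # 2 ⇒ m ≤′ # 0 ⇒ # 4 ≤′ n ⇒ ⊢ # 1 ≤′ # 0) n≡3m+r r<3 m≤0 4≤n of λ ()

  bases-tail : ∀ σ e d → suc d ≡ e → SizeShape [n/3] d → regs σ N ≡ n → regs σ M ≡ [n/3] → regs σ E ≡ e → Fresh σ →
    Exec (D ≔ reg E ⊟ lit 1 ⨾ N₂ ≔ reg N ⊞ reg N ⨾ C ≔ reg N₂ ⊞ reg N ⨾ C ≔ reg C ⊞ lit 1) σ Ready
  bases-tail σ e d refl shape N≡ M≡ E≡ fr =
    set d (cong (_∸ 1) E≡) _
    (add (2 * n) (linear (regs σ N ∷ n ∷ []) (λ a n → a ≡′ n ⇒ ⊢ a ⊕ a ≡′ 2 ⊗ n) N≡)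
         (fits (linear (n ∷ []) λ n → ⊢ 2 ⊗ n ≤′ 10 ⊗ n))
    (add (3 * n) (linear (regs σ N ∷ n ∷ []) (λ a n → a ≡′ n ⇒ ⊢ 2 ⊗ n ⊕ a ≡′ 3 ⊗ n) N≡)
         (fits (linear (n ∷ []) λ n → ⊢ 3 ⊗ n ≤′ 10 ⊗ n))
    (exec-assign (1 + 3 * n) (+-comm (3 * n) 1)
      (subst (_≤ w) (+-comm 1 (3 * n)) (fits (linear (n ∷ []) (λ n → # 4 ≤′ n ⇒ ⊢ # 1 ⊕ 3 ⊗ n ≤′ 10 ⊗ n) 4≤n)))
    (_ , d , shape , constants N≡ M≡ E≡ refl refl , refl , fr))))

  bases-step : ∀ σ → Divided [n/3] σ → Exec bases σ Ready
  bases-step σ (N≡ , R≡ , M≡ , E≡ , fr) = exec-seq (exec-if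
    (λ 1≤R → exec-assign (2 * [n/3] + 1) (cong (_+ 1) E≡) (subst (_≤ w) (cong (_+ 1) (sym E≡)) (fits (linear (n ∷ [n/3] ∷ [])
        (λ n m → 3 ⊗ m ≤′ n ⇒ # 4 ≤′ n ⇒ ⊢ 2 ⊗ m ⊕ # 1 ≤′ 10 ⊗ n) 3m≤n 4≤n)))
      (bases-tail _ (2 * [n/3] + 1) (2 * [n/3]) (+-comm 1 _)
        (inj₂ (n % 3 , subst (1 ≤_) (remainder R≡) 1≤R , r<3 , n≡3m+r , refl)) N≡ M≡ refl fr))
    (λ ¬1≤R → exec-skip (bases-tail σ (2 * [n/3]) (2 * [n/3] ∸ 1) (m+[n∸m]≡n (≤-trans 1≤m (m≤m+n _ _)))
        (inj₁ ( trans n≡3m+r (trans (cong (3 * [n/3] +_) (trans (sym (remainder R≡)) (n≤0⇒n≡0 (≤-pred (≰⇒> ¬1≤R))))) (+-identityʳ _))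
              , m+[n∸m]≡n (≤-trans 1≤m (m≤m+n _ _)))) N≡ M≡ E≡ fr)))

  setup-correct : Timed setup initial Ready
  setup-correct = timed-seq (timed {N ≔ input[ lit 0 ] ⨾ R ≔ val (reg N)} {initial} {Divided 0}
      (set n size-cell _ (exec-assign n refl _ (refl , +-identityʳ n , refl , refl , refl , refl , λ _ → refl)))
    ⟫ λ j₀ → timed-seq (timed-for Divided [n/3] (m/n≤m n 3)
        (λ i σ i<m (_ , R≡ , _) → linear (regs σ R ∷ i ∷ [n/3] ∷ n ∷ []) (λ R i m n → R ⊕ 3 ⊗ i ≡′ n ⇒ # 1 ⊕ i ≤′ m ⇒ 3 ⊗ m ≤′ n ⇒ ⊢ # 3 ≤′ R) R≡ i<m 3m≤n)
        (λ σ (_ , R≡ , _) 3≤R → <⇒≱ (m%n<n n 3) (subst (3 ≤_) (remainder R≡) 3≤R))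
        divide-step j₀
      ⟫ λ j → timed (bases-step _ j)))

  -- Tables of positions and chord lengths

  cycle-cell : ∀ i → i < n → inp (1 + 3 * n + i) ≡ toℕ (vertex i)
  cycle-cell i i<n = trans (cong (λ x → inp (1 + (3 * n + x))) (sym (toℕ-fromℕ< i<n)))
    (trans (cycle-cells (fromℕ< i<n)) (cong toℕ (trans (sym (vertex-toℕ (fromℕ< i<n))) (cong vertex (toℕ-fromℕ< i<n)))))

  -- The first `n` cells are reserved for the output. They must keep their initial zeros, since the
  -- last loop writes only ones.
  Low : (ℕ → ℕ) → Set
  Low f = ∀ x → x < n → f x ≡ 0

  PositionTable : ℕ → (ℕ → ℕ) → Set
  PositionTable i f = ∀ j → j < i → f (n + toℕ (vertex j)) ≡ j

  module _ (m d : ℕ) where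

    Base : State → Set
    Base σ = Consts m d σ × regs σ D ≡ d × regs σ e₀ ≡ 0 × Low (mem σ)

    Located : ℕ → State → Set
    Located i σ = regs σ I ≡ i × Base σ × PositionTable i (mem σ)

    locate-step : ∀ i σ → i < n → Located i σ → Exec locate σ (Located (suc i))
    locate-step i σ i<n (I≡ , (cs@(constants N≡ M≡ E≡ C≡ N₂≡) , D≡ , e≡ , low) , table) =
      add (1 + 3 * n + i) (cong₂ _+_ C≡ I≡) (fits (linear (i ∷ n ∷ [])
          (λ i n → # 1 ⊕ i ≤′ n ⇒ ⊢ # 1 ⊕ 3 ⊗ n ⊕ i ≤′ 10 ⊗ n) i<n))
      (set v (cycle-cell i i<n) _
      (add (n + v) (cong (_+ v) N≡) (fits (linear (v ∷ n ∷ []) (λ v n → # 1 ⊕ v ≤′ n ⇒ ⊢ n ⊕ v ≤′ 10 ⊗ n) (toℕ<n (vertex i))))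
      (put (n + v) i refl I≡
      (increment i<n I≡
      (refl , (cs , D≡ , e≡ , low′) , table′)))))
      where
      v = toℕ (vertex i)
      low′ : Low (mem σ [ n + v ↦ i ])
      low′ x x<n = trans (update-other (mem σ) i (<⇒≢ (<-≤-trans x<n (m≤m+n n v)))) (low x x<n)
      table′ : PositionTable (suc i) (mem σ [ n + v ↦ i ])
      table′ j (s≤s j≤i) with m≤n⇒m<n∨m≡n j≤i
      ... | inj₂ refl = update-same (mem σ) (n + v) i
      ... | inj₁ j<i  = trans (update-other (mem σ) i (λ eq → <⇒≢ j<i
              (offset-injective 0 (<-trans j<i i<n) i<n (toℕ-injective (+-cancelˡ-≡ n _ _ eq))))) (table j j<i)

    Measured : (ℕ → ℕ) → ℕ → Set
    Measured f j = f (2 * n + j) ≡ jump j × f (3 * n + j) ≡ jump j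

    MeasuredBelow : ℕ → State → Set
    MeasuredBelow i σ = regs σ I ≡ i × Base σ × PositionTable n (mem σ) × (∀ j → j < i → Measured (mem σ) j)

    -- Adjacency lists come in arbitrary order, so the promise is conditional: the cells are filled
    -- once an entry naming the end of the chord has been seen. After three entries `adjacencyList`
    -- supplies such an entry.
    Inspecting : ℕ → ℕ → State → Set
    Inspecting i t σ = MeasuredBelow i σ × regs σ Z ≡ 2 * n + i × regs σ W ≡ 3 * n + i ×
      (∀ (j : Fin 3) → toℕ j < t → neighbour (vertex i) j ≡ vertex (i + jump i) → Measured (mem σ) i)

    Scanning : ℕ → ℕ → State → Set
    Scanning i t σ = regs σ X ≡ 3 * toℕ (vertex i) + t × Inspecting i t σ

    distance : ∀ i u → i < n → ∃[ y ] y < n × u ≡ vertex (i + y) ×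
      ((position u < i × position u + n ∸ i ≡ y) ⊎ (¬ position u < i × position u ∸ i ≡ y))
    distance i u i<n with position u <? i
    ... | yes p<i = position u + n ∸ i
                  , linear ((position u + n ∸ i) ∷ position u ∷ i ∷ n ∷ [])
                      (λ y p i n → # 1 ⊕ p ≤′ i ⇒ y ⊕ i ≡′ p ⊕ n ⇒ ⊢ # 1 ⊕ y ≤′ n) p<i eq
                  , trans (sym (vertex-position u)) (trans (sym (vertex-+n (position u)))
                      (cong vertex (trans (sym eq) (+-comm _ i))))
                  , inj₁ (p<i , refl)
      where
      eq : position u + n ∸ i + i ≡ position u + n
      eq = m∸n+n≡m (≤-trans (<⇒≤ i<n) (m≤n+m n (position u)))
    ... | no p≮i = position u ∸ i , ≤-<-trans (m∸n≤m (position u) i) (position<n u)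
                 , trans (sym (vertex-position u)) (cong vertex (sym (m+[n∸m]≡n (≮⇒≥ p≮i))))
                 , inj₂ (p≮i , refl)

    module _ (i : ℕ) (i<n : i < n) where

      stored-twice : (ℕ → ℕ) → ℕ → (ℕ → ℕ)
      stored-twice f y = (f [ 2 * n + i ↦ y ]) [ 3 * n + i ↦ y ]

      private
        other : ∀ f y x → x ≢ 2 * n + i → x ≢ 3 * n + i → stored-twice f y x ≡ f x
        other f y x ≢₂ ≢₃ = trans (update-other (f [ 2 * n + i ↦ y ]) y ≢₃) (update-other f y ≢₂)

        below : ∀ f y x → x < 2 * n → stored-twice f y x ≡ f x
        below f y x x<2n = other f y x (<⇒≢ (≤-trans x<2n (m≤m+n _ i)))
          (<⇒≢ (≤-trans x<2n (≤-trans (m≤n+m (2 * n) n) (m≤m+n (3 * n) i))))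

        2n≢3n : 2 * n + i ≢ 3 * n + i
        2n≢3n eq = <⇒≢ (m<n+m (2 * n) 0<n′) (+-cancelʳ-≡ i _ _ eq)

        apart : ∀ j → j < n → 2 * n + i ≢ 3 * n + j
        apart j j<n eq = case linear (i ∷ j ∷ n ∷ []) (λ i j n → # 1 ⊕ i ≤′ n ⇒ 2 ⊗ n ⊕ i ≡′ 3 ⊗ n ⊕ j ⇒ ⊢ # 1 ≤′ # 0) i<n eq of λ ()

      store-keeps : ∀ {σ} → MeasuredBelow i σ → MeasuredBelow i ⟨ regs σ , stored-twice (mem σ) (jump i) ⟩
      store-keeps {σ} (I≡ , (cs , D≡ , e≡ , low) , table , below-i) =
        I≡ , (cs , D≡ , e≡ , λ x x<n → trans (below (mem σ) (jump i) x (<-≤-trans x<n (m≤m+n n _))) (low x x<n))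
        , (λ j j<n → trans (below (mem σ) (jump i) _ (<-≤-trans (+-monoʳ-< n (toℕ<n (vertex j))) (≤-reflexive (cong (n +_) (sym (+-identityʳ n)))))) (table j j<n))
        , λ j j<i → let q₂ , q₃ = below-i j j<i in
            trans (other (mem σ) (jump i) _ (λ eq → <⇒≢ j<i (+-cancelˡ-≡ (2 * n) _ _ eq)) (λ eq → apart′ j j<i eq)) q₂
          , trans (other (mem σ) (jump i) _ (λ eq → apart j (<-trans j<i i<n) (sym eq)) (λ eq → <⇒≢ j<i (+-cancelˡ-≡ (3 * n) _ _ eq))) q₃
        where
        apart′ : ∀ j → j < i → 2 * n + j ≢ 3 * n + i
        apart′ j j<i eq = case linear (i ∷ j ∷ n ∷ []) (λ i j n → # 1 ⊕ i ≤′ n ⇒ # 1 ⊕ j ≤′ i ⇒ 2 ⊗ n ⊕ j ≡′ 3 ⊗ n ⊕ i ⇒ ⊢ # 1 ≤′ # 0) i<n j<i eq of λ ()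

      store-measures : ∀ f → Measured (stored-twice f (jump i)) i
      store-measures f = trans (update-other (f [ 2 * n + i ↦ jump i ]) (jump i) 2n≢3n) (update-same f (2 * n + i) (jump i))
                       , update-same (f [ 2 * n + i ↦ jump i ]) (3 * n + i) (jump i)

      scan-end-correct : ∀ σ t (j : Fin 3) y → toℕ j ≡ t → y < n → neighbour (vertex i) j ≡ vertex (i + y) →
        regs σ Y ∸ i ≡ y → regs σ X ≡ 3 * toℕ (vertex i) + suc t → Inspecting i t σ →
        Exec scan-end σ (Scanning i (suc t))
      scan-end-correct σ t j y refl y<n nb≡ Y≡ X≡ ((I≡ , base@(constants N≡ _ _ _ _ , _) , rest) , Z≡ , W≡ , done) =
        set y (trans (cong (regs σ Y ∸_) I≡) Y≡) _
        (add (y + 1) refl (fits (linear (y ∷ n ∷ []) (λ y n → # 1 ⊕ y ≤′ n ⇒ ⊢ y ⊕ # 1 ≤′ 10 ⊗ n) y<n))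
        (exec-if
          (λ 1<y → exec-if
            (λ y+1<n → is-chord 1<y (≤-trans (≤-reflexive (+-suc y 1)) (subst (suc (y + 1) ≤_) N≡ y+1<n)))
            (λ y+1≮n → exec-skip (skipped λ (_ , y+2≤n , _) → y+1≮n (subst (y + 1 <_) (sym N≡) (≤-trans (≤-reflexive (sym (+-suc y 1))) y+2≤n)))))
          (λ y≯1 → exec-skip (skipped λ (2≤y , _) → y≯1 2≤y))))
        where
        σ′ : State
        σ′ = ⟨ (regs σ [ Y ↦ y ]) [ U ↦ y + 1 ] , mem σ ⟩

        v≡ : Adj (vertex i) (vertex (i + y))
        v≡ = Equivalence.from (adjacencyList (vertex i) (vertex (i + y))) (j , nb≡)

        is-chord : 2 ≤ y → y + 2 ≤ n → Exec (mem[ reg Z ]≔ reg Y ⨾ mem[ reg W ]≔ reg Y) σ′ (Scanning i (suc t))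
        -- A distance that passes both tests belongs to a chord, so uniqueness identifies it with
        -- `jump i` and repeated writes would be harmless.
        is-chord 2≤y y+2≤n with jump-unique i (2≤y , y+2≤n , v≡)
        ... | refl = put (2 * n + i) y Z≡ refl (exec-store (3 * n + i) y W≡ refl
            (X≡ , store-keeps {σ′} (I≡ , base , rest) , Z≡ , W≡ , λ _ _ _ → store-measures (mem σ)))

        skipped : ¬ IsChord i y → Scanning i (suc t) σ′
        skipped ¬chord = X≡ , (I≡ , base , rest) , Z≡ , W≡ , done′
          where
          done′ : ∀ j′ → toℕ j′ < suc t → neighbour (vertex i) j′ ≡ vertex (i + jump i) → Measured (mem σ) i
          done′ j′ (s≤s j′≤t) eq with m≤n⇒m<n∨m≡n j′≤t
          ... | inj₁ j′<t = done j′ j′<t eq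
          ... | inj₂ j′≡t with toℕ-injective j′≡t
          ...   | refl = ⊥-elim (¬chord (subst (IsChord i) (offset-injective i jump<n y<n (trans (sym eq) nb≡)) (jump-chord i)))
            where
            jump<n : jump i < n
            jump<n = linear (jump i ∷ n ∷ []) (λ f n → f ⊕ # 2 ≤′ n ⇒ ⊢ # 1 ⊕ f ≤′ n) (proj₁ (proj₂ (jump-chord i)))

      scan-correct : ∀ σ (j : Fin 3) t → toℕ j ≡ t → Scanning i t σ → Exec scan σ (Scanning i (suc t))
      scan-correct σ j t refl (X≡ , ins@((I≡ , (constants N≡ _ _ _ _ , _) , table , _) , _)) =
        add (3 * v + suc t) (trans (cong (_+ 1) X≡) (trans (+-assoc (3 * v) t 1) (cong (3 * v +_) (+-comm t 1))))
          (fits (linear (v ∷ t ∷ n ∷ []) (λ v t n → # 1 ⊕ v ≤′ n ⇒ # 1 ⊕ t ≤′ # 3 ⇒ # 4 ≤′ n ⇒ ⊢ 3 ⊗ v ⊕ (# 1 ⊕ t) ≤′ 10 ⊗ n)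
            (toℕ<n (vertex i)) (toℕ<n j) 4≤n))
        (set (toℕ u) (trans (cong inp (+-suc (3 * v) t)) (adjacency-cells (vertex i) j)) _
        (add (n + toℕ u) (cong (_+ toℕ u) N≡)
          (fits (linear (toℕ u ∷ n ∷ []) (λ u n → # 1 ⊕ u ≤′ n ⇒ ⊢ n ⊕ u ≤′ 10 ⊗ n) (toℕ<n u)))
        (set p (trans (cong (λ x → mem σ (n + toℕ x)) (sym (vertex-position u))) (table p (position<n u))) _
        (exec-seq (finish (distance i u i<n))))))
        where
        v = toℕ (vertex i)
        u = neighbour (vertex i) j
        p = position u
        σ′ : State
        σ′ = ⟨ (((regs σ [ X ↦ 3 * v + suc t ]) [ Y ↦ toℕ u ]) [ Y ↦ n + toℕ u ]) [ Y ↦ p ] , mem σ ⟩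
        finish : ∃[ y ] y < n × u ≡ vertex (i + y) × ((p < i × p + n ∸ i ≡ y) ⊎ (¬ p < i × p ∸ i ≡ y)) →
          Exec (If reg Y ≺ reg I Then Y ≔ reg Y ⊞ reg N Else skip End) σ′ (λ σ″ → Exec scan-end σ″ (Scanning i (suc t)))
        finish (y , y<n , u≡ , cases) = exec-if
          (λ p<I → let eq = [ proj₂ , (λ (p≮i , _) → ⊥-elim (p≮i (subst (p <_) I≡ p<I))) ]′ cases in
            exec-assign (p + n) (cong (p +_) N≡)
              (subst (_≤ w) (cong (p +_) (sym N≡)) (fits (linear (p ∷ n ∷ []) (λ p n → # 1 ⊕ p ≤′ n ⇒ ⊢ p ⊕ n ≤′ 10 ⊗ n) (position<n u))))
              (scan-end-correct _ t j y refl y<n u≡ eq refl ins))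
          (λ p≮I → let eq = [ (λ (p<i , _) → ⊥-elim (p≮I (subst (p <_) (sym I≡) p<i))) , proj₂ ]′ cases in
            exec-skip (scan-end-correct σ′ t j y refl y<n u≡ eq refl ins))

      measure-step : ∀ σ → MeasuredBelow i σ → Exec measure σ (MeasuredBelow (suc i))
      measure-step σ inv@(I≡ , (cs@(constants N≡ M≡ E≡ C≡ N₂≡) , _) , _) =
        add (1 + 3 * n + i) (cong₂ _+_ C≡ I≡) (fits (linear (i ∷ n ∷ []) (λ i n → # 1 ⊕ i ≤′ n ⇒ ⊢ # 1 ⊕ 3 ⊗ n ⊕ i ≤′ 10 ⊗ n) i<n))
        (set v (cycle-cell i i<n) _
        (add (v + v) refl (fits (linear (v ∷ n ∷ []) (λ v n → # 1 ⊕ v ≤′ n ⇒ ⊢ v ⊕ v ≤′ 10 ⊗ n) (toℕ<n (vertex i))))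
        (add (3 * v + 0) (linear (v ∷ []) λ v → ⊢ v ⊕ v ⊕ v ≡′ 3 ⊗ v ⊕ # 0)
          (fits (linear (v ∷ n ∷ []) (λ v n → # 1 ⊕ v ≤′ n ⇒ ⊢ 3 ⊗ v ⊕ # 0 ≤′ 10 ⊗ n) (toℕ<n (vertex i))))
        (add (2 * n + i) (cong₂ _+_ N₂≡ I≡) (fits (linear (i ∷ n ∷ []) (λ i n → # 1 ⊕ i ≤′ n ⇒ ⊢ 2 ⊗ n ⊕ i ≤′ 10 ⊗ n) i<n))
        (add (3 * n + i) (trans (cong (2 * n + i +_) N≡) (linear (i ∷ n ∷ []) λ i n → ⊢ 2 ⊗ n ⊕ i ⊕ n ≡′ 3 ⊗ n ⊕ i))
          (fits (linear (i ∷ n ∷ []) (λ i n → # 1 ⊕ i ≤′ n ⇒ ⊢ 3 ⊗ n ⊕ i ≤′ 10 ⊗ n) i<n))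
        (exec-seq (weaken (λ s₁ → exec-seq (weaken (λ s₂ → exec-seq (weaken (λ s₃ → last s₃)
          (scan-correct _ (suc (suc zero)) 2 refl s₂)))
          (scan-correct _ (suc zero) 1 refl s₁)))
          (scan-correct _ zero 0 refl (refl , inv , refl , refl , λ _ ())))))))))
        where
        v = toℕ (vertex i)
        last : ∀ {σ′} → Scanning i 3 σ′ → Exec (I ≔ reg I ⊞ lit 1) σ′ (MeasuredBelow (suc i))
        last {σ′} (_ , (I≡ , base , table , below-i) , _ , _ , done) =
          increment i<n I≡ (refl , base , table , below-suc)
          where
          below-suc : ∀ j → j < suc i → Measured (mem σ′) j
          below-suc j (s≤s j≤i) with m≤n⇒m<n∨m≡n j≤i
          ... | inj₁ j<i  = below-i j j<i
          ... | inj₂ refl = let k , eq = Equivalence.to (adjacencyList (vertex i) (vertex (i + jump i))) (proj₂ (proj₂ (jump-chord i)))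
                            in done k (toℕ<n k) eq

  -- Search for an optimal piece

  Good : ℕ → ℕ → ℕ → Set
  Good a e s = a < n × (Σ[ P ∈ Piece n jump a e s ] IsConnectedMaximumPDS G (S P))

  -- A later success may overwrite an earlier one, as each recorded piece is optimal by itself. The
  -- failures therefore matter only as long as nothing has been found.
  data Outcome (Failed : Set) (a e s : ℕ) : Set where
    nothing-found : e ≡ 0 → Failed → Outcome Failed a e s
    found         : Good a e s → Outcome Failed a e s

  Status : Set → State → Set
  Status Failed σ = Outcome Failed (regs σ A) (regs σ e₀) (regs σ s₀)

  fail : ∀ {F P : Set} {a e s} → ¬ P → Outcome F a e s → Outcome (F × ¬ P) a e s
  fail ¬p (nothing-found e≡0 f) = nothing-found e≡0 (f , ¬p)
  fail ¬p (found good)          = found good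

  jump≤n : ∀ i → jump i ≤ n
  jump≤n i = ≤-trans (m≤m+n _ 2) (proj₁ (proj₂ (jump-chord i)))

  module _ (m d : ℕ) (m≤n : m ≤ n) (e<n : suc d < n) (μ : ℕ → ℕ) (table : ∀ j → j < 2 * n → μ (2 * n + j) ≡ jump j) where

    -- The search only reads memory, which is therefore a fixed function `μ`. The separate `d′` lets
    -- `tryArc` be reused by the fallback with a smaller `D`.
    Env : ℕ → ℕ → State → Set
    Env d′ a σ = regs σ I ≡ a × Consts m d σ × regs σ D ≡ d′ × mem σ ≡ μ

    fetch : ∀ {f} a x → f ≡ μ → a + x < 2 * n → f (2 * n + a + x) ≡ jump (a + x)
    fetch a x refl a+x<2n = trans (cong μ (+-assoc (2 * n) a x)) (table (a + x) a+x<2n)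

    tryArc-correct : ∀ d′ a (F : Set) σ → d′ < n → a < n → (ClosedArc n jump d′ a → Good a d′ (suc d′)) →
      Env d′ a σ → Status F σ → Exec tryArc σ (λ σ′ → Env d′ a σ′ × Status (F × ¬ ClosedArc n jump d′ a) σ′)
    tryArc-correct d′ a F σ d′<n a<n good env@(I≡ , cs@(constants N≡ M≡ E≡ C≡ N₂≡) , D≡ , μ≡) st =
      add (2 * n + a) (cong₂ _+_ N₂≡ I≡) (fits (linear (a ∷ n ∷ []) (λ a n → # 1 ⊕ a ≤′ n ⇒ ⊢ 2 ⊗ n ⊕ a ≤′ 10 ⊗ n) a<n))
      (set (jump a) (trans (cong (mem σ) (sym (+-identityʳ (2 * n + a)))) (trans (fetch a 0 μ≡ a+0<) (cong jump (+-identityʳ a)))) _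
      (exec-if
        (λ first → add (2 * n + a + d′) (cong (2 * n + a +_) D≡)
          (fits (linear (a ∷ d′ ∷ n ∷ []) (λ a d n → # 1 ⊕ a ≤′ n ⇒ # 1 ⊕ d ≤′ n ⇒ ⊢ 2 ⊗ n ⊕ a ⊕ d ≤′ 10 ⊗ n) a<n d′<n))
        (set (jump (a + d′)) (fetch a d′ μ≡ a+d<) _
        (add (d′ + jump (a + d′)) (cong (_+ jump (a + d′)) D≡)
          (fits (linear (d′ ∷ jump (a + d′) ∷ n ∷ []) (λ d f n → # 1 ⊕ d ≤′ n ⇒ f ≤′ n ⇒ ⊢ d ⊕ f ≤′ 10 ⊗ n) d′<n (jump≤n (a + d′))))
        (exec-if
          (λ last → set a I≡ _ (set d′ D≡ _ (exec-assign (suc d′) d+1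
              (subst (_≤ w) (sym d+1) (fits (linear (d′ ∷ n ∷ []) (λ d n → # 1 ⊕ d ≤′ n ⇒ ⊢ # 1 ⊕ d ≤′ 10 ⊗ n) d′<n)))
              (env , found (good (subst (jump a ≤_) D≡ first , subst (_≤ d′ + jump (a + d′)) N≡ last))))))
          (λ ¬last → exec-skip (env , fail (λ (_ , last) → ¬last (subst (_≤ d′ + jump (a + d′)) (sym N≡) last)) st))))))
        (λ ¬first → exec-skip (env , fail (λ (first , _) → ¬first (subst (jump a ≤_) (sym D≡) first)) st))))
      where
      d+1 : regs σ D + 1 ≡ suc d′
      d+1 = trans (cong (_+ 1) D≡) (+-comm d′ 1)
      a+0< : a + 0 < 2 * n
      a+0< = linear (a ∷ n ∷ []) (λ a n → # 1 ⊕ a ≤′ n ⇒ ⊢ # 1 ⊕ (a ⊕ # 0) ≤′ 2 ⊗ n) a<n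
      a+d< : a + d′ < 2 * n
      a+d< = linear (a ∷ d′ ∷ n ∷ []) (λ a d n → # 1 ⊕ a ≤′ n ⇒ # 1 ⊕ d ≤′ n ⇒ ⊢ # 1 ⊕ (a ⊕ d) ≤′ 2 ⊗ n) a<n d′<n

    module _ (d′ k a : ℕ) (F : Set) (k≤ : k ≤ n + 1) (a<n : a < n)
             (good : PuncturedArc n jump (suc d) k a → Good a (suc d) (suc k)) where

      Tried : State → Set
      Tried σ = Env d′ a σ × Status (F × ¬ PuncturedArc n jump (suc d) k a) σ

      Trying : State → Set
      Trying σ = Env d′ a σ × regs σ k₀ ≡ k × regs σ S₀ ≡ suc k × regs σ X ≡ 2 * n + a × Status F σ

      private
        e = suc d

        k+3≤10n : ∀ {x} → x ≤ 3 → k + x ≤ 10 * n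
        k+3≤10n {x} x≤3 = linear (k ∷ x ∷ n ∷ []) (λ k x n → k ≤′ n ⊕ # 1 ⇒ x ≤′ # 3 ⇒ # 4 ≤′ n ⇒ ⊢ k ⊕ x ≤′ 10 ⊗ n) k≤ x≤3 4≤n

        k+c : ∀ {y} c → y ≡ k → y + c ≡ c + k
        k+c c refl = +-comm k c

        offset< : ∀ {x} → x ≤ e → a + x < 2 * n
        offset< {x} x≤e = linear (a ∷ x ∷ e ∷ n ∷ []) (λ a x e n → # 1 ⊕ a ≤′ n ⇒ x ≤′ e ⇒ # 1 ⊕ e ≤′ n ⇒ ⊢ # 1 ⊕ (a ⊕ x) ≤′ 2 ⊗ n) a<n x≤e e<n

        address-fits : ∀ {x} → x ≤ e → 2 * n + a + x ≤ w
        address-fits {x} x≤e = fits (linear (a ∷ x ∷ e ∷ n ∷ [])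
          (λ a x e n → # 1 ⊕ a ≤′ n ⇒ x ≤′ e ⇒ # 1 ⊕ e ≤′ n ⇒ ⊢ 2 ⊗ n ⊕ a ⊕ x ≤′ 10 ⊗ n) a<n x≤e e<n)

        sum-fits : ∀ {x} y → x ≤ e → x + jump y ≤ w
        sum-fits {x} y x≤e = fits (linear (x ∷ jump y ∷ e ∷ n ∷ [])
          (λ x f e n → x ≤′ e ⇒ # 1 ⊕ e ≤′ n ⇒ f ≤′ n ⇒ ⊢ x ⊕ f ≤′ 10 ⊗ n) x≤e e<n (jump≤n y))

      give-up : ∀ {σ} → ¬ PuncturedArc n jump e k a → Env d′ a σ → Status F σ → Exec skip σ Tried
      give-up ¬p env st = exec-skip (env , fail ¬p st)

      keepHole-correct : ∀ σ → PuncturedArc n jump e k a → Env d′ a σ → regs σ S₀ ≡ suc k → Exec keepHole σ Tried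
      keepHole-correct σ p env@(I≡ , (constants _ _ E≡ _ _) , _) S≡ =
        set a I≡ _ (set e E≡ _ (exec-assign (suc k) S≡ _ (env , found (good p))))

      tryRight-correct : ∀ σ → k + 3 ≤ e →
        (2 + k + jump (a + (2 + k)) ≤ e ⊎ n ≤ 2 + k + jump (a + (2 + k)) → PuncturedArc n jump e k a) →
        Trying σ → Exec tryRight σ Tried
      tryRight-correct σ k+3≤e punctured (env@(I≡ , (constants N≡ M≡ E≡ C≡ N₂≡) , _ , μ≡) , k≡ , S≡ , X≡ , st) =
        add (2 + k) (k+c 2 k≡) (fits (subst (_≤ 10 * n) (+-comm k 2) (k+3≤10n (n≤1+n 2))))
        (add (2 * n + a + (2 + k)) (cong (_+ (2 + k)) X≡) (address-fits 2+k≤e)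
        (set x (fetch a (2 + k) μ≡ (offset< 2+k≤e)) _
        (add (2 + k + x) refl (sum-fits (a + (2 + k)) 2+k≤e)
        (exec-if
          (λ p → keepHole-correct _ (punctured (inj₁ (subst (2 + k + x ≤_) E≡ p))) env S≡)
          (λ ¬p → exec-if
            (λ q → keepHole-correct _ (punctured (inj₂ (subst (_≤ 2 + k + x) N≡ q))) env S≡)
            (λ ¬q → give-up (λ (_ , _ , _ , _ , _ , _ , _ , r) →
              [ (λ p → ¬p (subst (2 + k + x ≤_) (sym E≡) p)) , (λ q → ¬q (subst (_≤ 2 + k + x) (sym N≡) q)) ]′ r) env st))))))
        where
        x = jump (a + (2 + k))
        2+k≤e : 2 + k ≤ e
        2+k≤e = linear (k ∷ e ∷ []) (λ k e → k ⊕ # 3 ≤′ e ⇒ ⊢ # 2 ⊕ k ≤′ e) k+3≤e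

      tryLeft-correct : ∀ σ →
        (1 ≤ k → k + 3 ≤ e → k + jump (a + k) ≤ e → 2 + k + jump (a + (2 + k)) ≤ e ⊎ n ≤ 2 + k + jump (a + (2 + k)) →
          PuncturedArc n jump e k a) →
        Trying σ → Exec tryLeft σ Tried
      tryLeft-correct σ punctured tr@(env@(I≡ , (constants N≡ M≡ E≡ C≡ N₂≡) , _ , μ≡) , k≡ , S≡ , X≡ , st) = exec-if
        (λ 1≤k → add (k + 3) (cong (_+ 3) k≡) (fits (k+3≤10n ≤-refl))
          (exec-if
            (λ q → let k+3≤e = subst (k + 3 ≤_) E≡ q ; k≤e = ≤-trans (m≤m+n k 3) k+3≤e in
              add (2 * n + a + k) (cong₂ _+_ X≡ k≡) (address-fits k≤e)
              (set (jump (a + k)) (fetch a k μ≡ (offset< k≤e)) _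
              (add (k + jump (a + k)) (cong (_+ jump (a + k)) k≡) (sum-fits (a + k) k≤e)
              (exec-if
                (λ r → tryRight-correct _ k+3≤e (punctured (subst (1 ≤_) k≡ 1≤k) k+3≤e (subst (k + jump (a + k) ≤_) E≡ r)) tr)
                (λ ¬r → give-up (λ (_ , _ , _ , _ , _ , _ , r , _) → ¬r (subst (k + jump (a + k) ≤_) (sym E≡) r)) env st)))))
            (λ ¬q → give-up (λ (_ , _ , _ , _ , _ , q , _) → ¬q (subst (k + 3 ≤_) (sym E≡) q)) env st)))
        (λ ¬1≤k → give-up (λ (_ , _ , _ , _ , 1≤k , _) → ¬1≤k (subst (1 ≤_) (sym k≡) 1≤k)) env st)

      tryHole-correct : ∀ σ → regs σ k₀ ≡ k → Env d′ a σ → Status F σ → Exec tryHole σ Tried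
      tryHole-correct σ k≡ env@(I≡ , (constants N≡ M≡ E≡ C≡ N₂≡) , _ , μ≡) st =
        add (suc k) (k+c 1 k≡) (fits (subst (_≤ 10 * n) (+-comm k 1) (k+3≤10n (s≤s z≤n))))
        (add (2 * n + a) (cong₂ _+_ N₂≡ I≡) (subst (_≤ w) (+-identityʳ (2 * n + a)) (address-fits z≤n))
        (set (jump a) (trans (cong (mem σ) (sym (+-identityʳ (2 * n + a)))) (trans (fetch a 0 μ≡ (offset< z≤n)) (cong jump (+-identityʳ a)))) _
        (exec-if
          (λ p → exec-if
            (λ eq → give-up (λ (_ , neq , _) → neq eq) env st)
            (λ neq → add (2 * n + a + e) (cong (2 * n + a +_) E≡) (address-fits ≤-refl)
              (set y (fetch a e μ≡ (offset< ≤-refl)) _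
              (add (e + y) (cong (_+ y) E≡) (sum-fits (a + e) ≤-refl)
              (exec-if
                (λ q → add (n + suc k) (cong (_+ suc k) N≡)
                    (fits (linear (n ∷ k ∷ []) (λ n k → k ≤′ n ⊕ # 1 ⇒ # 4 ≤′ n ⇒ ⊢ n ⊕ (# 1 ⊕ k) ≤′ 10 ⊗ n) k≤ 4≤n))
                  (exec-if
                    (λ eq → give-up (λ (_ , _ , _ , neq′ , _) → neq′ eq) env st)
                    (λ neq′ → tryLeft-correct _
                      (λ 1≤k k+3≤e r s → subst (jump a ≤_) E≡ p , neq , subst (_≤ e + y) N≡ q , neq′ , 1≤k , k+3≤e , r , s)
                      (env , k≡ , refl , refl , st))))
                (λ ¬q → give-up (λ (_ , _ , q , _) → ¬q (subst (_≤ e + y) (sym N≡) q)) env st))))))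
          (λ ¬p → give-up (λ (p , _) → ¬p (subst (jump a ≤_) (sym E≡) p)) env st))))
        where
        y = jump (a + e)

  module _ (m d : ℕ) (shape : SizeShape m d) where

    optimum : Optimum n (suc d)
    optimum = case shape of λ
      { (inj₁ (n≡ , d≡)) → subst₂ Optimum (sym n≡) (sym d≡) (optimum-0 m)
      ; (inj₂ (r , 1≤r , r≤2 , n≡ , d≡)) →
          subst₂ Optimum (sym n≡) (trans (+-comm _ 1) (cong suc (sym d≡))) (optimum-+ m r 1≤r r≤2) }

    1+d<n : suc d < n
    1+d<n = ≰⇒> λ n≤K → case linear (n ∷ d ∷ []) (λ n d →
      n ≤′ # 1 ⊕ d ⇒ # 4 ≤′ n ⇒ 3 ⊗ (# 1 ⊕ d) ≤′ 2 ⊗ n ⊕ # 1 ⇒ ⊢ # 1 ≤′ # 0) n≤K 4≤n (proj₁ optimum) of λ ()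

    d<n : d < n
    d<n = <-trans (n<1+n d) 1+d<n

    m≤n : m ≤ n
    m≤n = case shape of λ
      { (inj₁ (n≡ , _)) → linear (n ∷ m ∷ []) (λ n m → n ≡′ 3 ⊗ m ⇒ ⊢ m ≤′ n) n≡
      ; (inj₂ (r , _ , _ , n≡ , _)) → linear (n ∷ m ∷ r ∷ []) (λ n m r → n ≡′ 3 ⊗ m ⊕ r ⇒ ⊢ m ≤′ n) n≡ }

    good-arc : ∀ {a} → a < n → ClosedArc n jump d a → Good a d (suc d)
    good-arc a<n p = a<n , P , piece-optimal P optimum (inj₁ (≤-refl , refl))
      where P = closed-piece chords d<n p

    good-hole : ∀ {k a} → a < n → PuncturedArc n jump (suc d) k a → Good a (suc d) (suc k)
    good-hole {k} a<n p@(_ , _ , _ , _ , _ , k+3≤e , _) = a<n , P , piece-optimal P optimum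
        (inj₂ (linear (k ∷ d ∷ []) (λ k d → k ⊕ # 3 ≤′ # 1 ⊕ d ⇒ ⊢ # 1 ⊕ k ≤′ # 1 ⊕ d) k+3≤e , refl))
      where P = punctured-piece 1+d<n p

    AllFail : ℕ → Set
    AllFail a = ¬ ClosedArc n jump d a × ¬ Hole 1 × ¬ Hole 2 × ¬ Hole 4 × ¬ Hole (m ∸ 3) × ¬ Hole (m + 1)
      where
      Hole : ℕ → Set
      Hole k = PuncturedArc n jump (suc d) k a

    -- The loops test only starts below `n`, whereas the combinatorial part assumes failure at every
    -- natural number; periodicity closes this gap.
    jump-% : ∀ a x → jump (a + x) ≡ jump (a % n + x)
    jump-% a x = trans (sym (Shape.f-% n jump chords (a + x)))
      (trans (cong jump (%-cong-+ʳ x (sym (m%n%n≡m%n a n)))) (Shape.f-% n jump chords (a % n + x)))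

    jump-%₀ : ∀ a → jump a ≡ jump (a % n)
    jump-%₀ a = sym (Shape.f-% n jump chords a)

    closed-% : ∀ d′ a → ClosedArc n jump d′ a → ClosedArc n jump d′ (a % n)
    closed-% d′ a (p , q) = subst (_≤ d′) (jump-%₀ a) p , subst (λ x → n ≤ d′ + x) (jump-% a d′) q

    punctured-% : ∀ k a → PuncturedArc n jump (suc d) k a → PuncturedArc n jump (suc d) k (a % n)
    punctured-% k a (p₁ , p₂ , p₃ , p₄ , p₅ , p₆ , p₇ , p₈) =
        subst (_≤ suc d) (jump-%₀ a) p₁ , subst (_≢ suc k) (jump-%₀ a) p₂
      , subst (λ x → n ≤ suc d + x) (jump-% a (suc d)) p₃ , subst (λ x → suc d + x ≢ n + suc k) (jump-% a (suc d)) p₄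
      , p₅ , p₆ , subst (λ x → k + x ≤ suc d) (jump-% a k) p₇
      , subst (λ x → 2 + k + x ≤ suc d ⊎ n ≤ 2 + k + x) (jump-% a (2 + k)) p₈

    fail⇒exceptional : (∀ a → a < n → AllFail a) → Exceptional n jump
    fail⇒exceptional fails = case shape of λ
      { (inj₁ (n≡ , d≡)) → ⊥-elim (no-multiple-of-3 chords m d n≡ d≡ no-arc)
      ; (inj₂ (1 , _ , _ , n≡ , d≡)) → ⊥-elim (exceptional₁ chords m d d≡ no-arc fails₁ fails₂ fails₄ n≡)
      ; (inj₂ (2 , _ , _ , n≡ , d≡)) → exceptional₂ chords m d d≡ no-arc fails₁ fails₂ fails₄ n≡ fails₅ fails₆
      ; (inj₂ (suc (suc (suc _)) , _ , s≤s (s≤s ()) , _))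
      ; (inj₂ (0 , () , _)) }
      where
      at : ∀ a → AllFail (a % n)
      at a = fails (a % n) (m%n<n a n)
      no-arc : ∀ a → ¬ ClosedArc n jump d a
      no-arc a p = proj₁ (at a) (closed-% d a p)
      fails₁ : ∀ a → ¬ PuncturedArc n jump (suc d) 1 a
      fails₁ a p = proj₁ (proj₂ (at a)) (punctured-% 1 a p)
      fails₂ : ∀ a → ¬ PuncturedArc n jump (suc d) 2 a
      fails₂ a p = proj₁ (proj₂ (proj₂ (at a))) (punctured-% 2 a p)
      fails₄ : ∀ a → ¬ PuncturedArc n jump (suc d) 4 a
      fails₄ a p = proj₁ (proj₂ (proj₂ (proj₂ (at a)))) (punctured-% 4 a p)
      fails₅ : ∀ a → ¬ PuncturedArc n jump (suc d) (m ∸ 3) a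
      fails₅ a p = proj₁ (proj₂ (proj₂ (proj₂ (proj₂ (at a))))) (punctured-% (m ∸ 3) a p)
      fails₆ : ∀ a → ¬ PuncturedArc n jump (suc d) (m + 1) a
      fails₆ a p = proj₂ (proj₂ (proj₂ (proj₂ (proj₂ (at a))))) (punctured-% (m + 1) a p)

    module Search (μ : ℕ → ℕ) (table : ∀ j → j < 2 * n → μ (2 * n + j) ≡ jump j) where

      Environment : ℕ → ℕ → State → Set
      Environment = Env m d m≤n 1+d<n μ table

      Searched : ℕ → State → Set
      Searched i σ = Environment d i σ × Status (∀ a → a < i → AllFail a) σ

      -- The nesting follows the order of the six tests, each of which adds one factor on the right.
      Failures : ℕ → Set
      Failures i = ((((((∀ a → a < i → AllFail a) × ¬ ClosedArc n jump d i)
        × ¬ PuncturedArc n jump (suc d) 1 i) × ¬ PuncturedArc n jump (suc d) 2 i) × ¬ PuncturedArc n jump (suc d) 4 i)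
        × ¬ PuncturedArc n jump (suc d) (m ∸ 3) i) × ¬ PuncturedArc n jump (suc d) (m + 1) i

      gather : ∀ i {a e s} → Outcome (Failures i) a e s → Outcome (∀ a → a < suc i → AllFail a) a e s
      gather i (found g) = found g
      gather i (nothing-found e≡0 ((((((before , ¬arc) , ¬1) , ¬2) , ¬4) , ¬5) , ¬6)) = nothing-found e≡0 all
        where
        all : ∀ a → a < suc i → AllFail a
        all a (s≤s a≤i) with m≤n⇒m<n∨m≡n a≤i
        ... | inj₁ a<i  = before a a<i
        ... | inj₂ refl = ¬arc , ¬1 , ¬2 , ¬4 , ¬5 , ¬6

      hole : ∀ {i σ} k F → k ≤ n + 1 → i < n → regs σ k₀ ≡ k → Environment d i σ → Status F σ →
        Exec tryHole σ (λ σ′ → Environment d i σ′ × Status (F × ¬ PuncturedArc n jump (suc d) k i) σ′)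
      hole {i} {σ} k F k≤ i<n = tryHole-correct m d m≤n 1+d<n μ table d k i F k≤ i<n (good-hole i<n) σ

      search-step : ∀ i σ → i < n → Searched i σ → Exec searchBody σ (Searched (suc i))
      search-step i σ i<n (env , st) =
        exec-seq (weaken (λ (env , st) → set 1 refl _ (
        exec-seq (weaken (λ (env , st) → set 2 refl _ (
        exec-seq (weaken (λ (env , st) → set 4 refl _ (
        exec-seq (weaken (λ (env@(_ , constants _ M≡ _ _ _ , _) , st) → set (m ∸ 3) (cong (_∸ 3) M≡) _ (
        exec-seq (weaken (λ (env@(_ , constants _ M≡ _ _ _ , _) , st) → add (m + 1) (cong (_+ 1) M≡)
            (fits (linear (m ∷ n ∷ []) (λ m n → m ≤′ n ⇒ # 4 ≤′ n ⇒ ⊢ m ⊕ # 1 ≤′ 10 ⊗ n) m≤n 4≤n)) (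
        exec-seq (weaken (λ ((I≡ , cs , D≡ , μ≡) , st) → increment i<n I≡ ((refl , cs , D≡ , μ≡) , gather i st))
          (hole (m + 1) _ (+-monoˡ-≤ 1 m≤n) i<n refl env st))))
          (hole (m ∸ 3) _ (≤-trans (m∸n≤m m 3) (≤-trans m≤n (m≤m+n n 1))) i<n refl env st))))
          (hole 4 _ (≤-trans 4≤n (m≤m+n n 1)) i<n refl env st))))
          (hole 2 _ (≤-trans (≤-trans (m≤m+n 2 2) 4≤n) (m≤m+n n 1)) i<n refl env st))))
          (hole 1 _ (≤-trans (≤-trans (m≤m+n 1 3) 4≤n) (m≤m+n n 1)) i<n refl env st))))
          (tryArc-correct m d m≤n 1+d<n μ table d i _ σ d<n i<n (good-arc i<n) env st))

      Fallen : ℕ → State → Set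
      Fallen i σ = Environment (d ∸ 1) i σ × Status (∀ a → a < i → ¬ ClosedArc n jump (d ∸ 1) a) σ

      module _ (exc : Exceptional n jump) where

        d∸1≡3 : d ∸ 1 ≡ 3
        d∸1≡3 = cong (_∸ 1) d≡4
          where
          d≡4 : d ≡ 4
          d≡4 = ≤-antisym
            (≮⇒≥ λ 4<d → case linear (d ∷ n ∷ []) (λ d n → n ≡′ # 8 ⇒ # 5 ≤′ d ⇒ 3 ⊗ (# 1 ⊕ d) ≤′ 2 ⊗ n ⊕ # 1 ⇒ ⊢ # 1 ≤′ # 0) (proj₁ exc) 4<d (proj₁ optimum) of λ ())
            (≮⇒≥ λ d<4 → case linear (d ∷ n ∷ []) (λ d n → n ≡′ # 8 ⇒ # 1 ⊕ d ≤′ # 4 ⇒ 2 ⊗ n ≤′ 3 ⊗ (# 1 ⊕ d) ⊕ # 1 ⇒ ⊢ # 1 ≤′ # 0) (proj₁ exc) d<4 (proj₂ optimum) of λ ())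

        good-fallback : ∀ {a} → a < n → ClosedArc n jump (d ∸ 1) a → Good a (d ∸ 1) (suc (d ∸ 1))
        good-fallback {a} a<n p = subst (λ x → Good a x (suc x)) (sym d∸1≡3) (a<n , P , exceptional-optimal exc P)
          where
          P = closed-piece chords (≤-trans (m≤m+n 4 4) (≤-reflexive (sym (proj₁ exc)))) (subst (λ x → ClosedArc n jump x a) d∸1≡3 p)

        fallback-step : ∀ i σ → i < n → Fallen i σ → Exec fallbackBody σ (Fallen (suc i))
        fallback-step i σ i<n (env , st) = exec-seq (weaken
          (λ ((I≡ , cs , D≡ , μ≡) , st) → increment i<n I≡ ((refl , cs , D≡ , μ≡) , extend st))
          (tryArc-correct m d m≤n 1+d<n μ table (d ∸ 1) i _ σ (≤-<-trans (m∸n≤m d 1) d<n) i<n (good-fallback i<n) env st))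
          where
          Fails : ℕ → Set
          Fails i = ∀ a → a < i → ¬ ClosedArc n jump (d ∸ 1) a
          extend : ∀ {a e s} → Outcome (Fails i × ¬ ClosedArc n jump (d ∸ 1) i) a e s → Outcome (Fails (suc i)) a e s
          extend (found g) = found g
          extend (nothing-found e≡0 (before , now)) = nothing-found e≡0 all
            where
            all : Fails (suc i)
            all a (s≤s a≤i) with m≤n⇒m<n∨m≡n a≤i
            ... | inj₁ a<i  = before a a<i
            ... | inj₂ refl = now

        fallback-succeeds : ∀ {a e s} → Outcome (∀ a → a < n → ¬ ClosedArc n jump (d ∸ 1) a) a e s → Good a e s
        fallback-succeeds (found g) = g
        fallback-succeeds (nothing-found _ none) = let a , p = exceptional-arc exc in
          ⊥-elim (none (a % n) (m%n<n a n) (closed-% (d ∸ 1) a (subst (λ x → ClosedArc n jump x a) (sym d∸1≡3) p)))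

      Solved : State → Set
      Solved σ = Consts m d σ × mem σ ≡ μ × Good (regs σ A) (regs σ e₀) (regs σ s₀)

      search-correct : ∀ {σ} → Searched 0 σ → Timed (While reg I ≺ reg N Do searchBody End) σ (Searched n)
      search-correct = timed-for Searched n ≤-refl
        (λ i σ i<n ((I≡ , constants N≡ _ _ _ _ , _) , _) → subst₂ _<_ (sym I≡) (sym N≡) i<n)
        (λ σ ((I≡ , constants N≡ _ _ _ _ , _) , _) I<N → <-irrefl refl (subst₂ _<_ I≡ N≡ I<N))
        search-step

      positive-e : ∀ {a e s} → Good a e s → e ≢ 0
      positive-e (_ , P , _) refl = case Piece.1≤e P of λ ()

      fallback-correct : ∀ σ → Searched n σ → Timed fallback σ Solved
      fallback-correct σ ((I≡ , cs , D≡ , μ≡) , st) = timed-if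
        (λ e≡0 → let exc = exception e≡0 st in timed-seq (timed {D ≔ reg D ⊟ lit 1 ⨾ I ≔ val (lit 0)} {σ} {Fallen 0}
            (set (d ∸ 1) (cong (_∸ 1) D≡) _ (exec-assign 0 refl _ ((refl , cs , refl , μ≡) , restart e≡0 st)))
          ⟫ λ j₀ → timed-for Fallen n ≤-refl
            (λ i σ i<n ((I≡ , constants N≡ _ _ _ _ , _) , _) → subst₂ _<_ (sym I≡) (sym N≡) i<n)
            (λ σ ((I≡ , constants N≡ _ _ _ _ , _) , _) I<N → <-irrefl refl (subst₂ _<_ I≡ N≡ I<N))
            (fallback-step exc) j₀
          ⟫ λ ((_ , cs , _ , μ≡) , st) → cs , μ≡ , fallback-succeeds exc st))
        (λ e≢0 → timed {skip} (exec-skip (cs , μ≡ , success e≢0 st)))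
        where
        exception : ∀ {a e s} → e ≡ 0 → Outcome (∀ a → a < n → AllFail a) a e s → Exceptional n jump
        exception e≡0 (found g) = ⊥-elim (positive-e g e≡0)
        exception e≡0 (nothing-found _ fails) = fail⇒exceptional fails
        restart : ∀ {F a e s} → e ≡ 0 → Outcome F a e s → Outcome (∀ a → a < 0 → ¬ ClosedArc n jump (d ∸ 1) a) a e s
        restart e≡0 _ = nothing-found e≡0 λ _ ()
        success : ∀ {F a e s} → e ≢ 0 → Outcome F a e s → Good a e s
        success e≢0 (found g) = g
        success e≢0 (nothing-found e≡0 _) = ⊥-elim (e≢0 e≡0)

    -- Writing the characteristic vector

    module Output (a e s : ℕ) (a<n : a < n) (e<n : e < n) where

      Emitted : ℕ → State → Set
      Emitted i σ = regs σ I ≡ i × Consts m d σ × regs σ A ≡ a × regs σ e₀ ≡ e × regs σ s₀ ≡ s × EncodesOutput (build a s i) (mem σ)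

      emit-insert : Program
      emit-insert =
        X ≔ reg C ⊞ reg X ⨾
        X ≔ input[ reg X ] ⨾
        mem[ reg X ]≔ lit 1

      build-skip : ∀ i → i ≡ s → build a s (suc i) ≡ build a s i
      build-skip i i≡s with i ≟ s
      ... | yes _  = refl
      ... | no i≢s = ⊥-elim (i≢s i≡s)

      build-insert : ∀ i → i ≢ s → build a s (suc i) ≡ build a s i [ vertex (a + i) ]≔ true
      build-insert i i≢s with i ≟ s
      ... | yes i≡s = ⊥-elim (i≢s i≡s)
      ... | no _    = refl

      insert-encodes : ∀ (p : Subset n) f x → EncodesOutput p f → EncodesOutput (p [ x ]≔ true) (f [ toℕ x ↦ 1 ])
      insert-encodes p f x enc v with toℕ v ≟ toℕ x
      ... | yes eq with toℕ-injective eq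
      ...   | refl = trans (update-same f (toℕ v) 1) (cong indicator (sym (lookup∘update v p true)))
      insert-encodes p f x enc v | no neq = trans (update-other f 1 neq)
        (trans (enc v) (cong indicator (sym (lookup∘update′ (neq ∘ cong toℕ) p true))))

      Inserted : ℕ → State → Set
      Inserted i σ = regs σ I ≡ i × Consts m d σ × regs σ A ≡ a × regs σ e₀ ≡ e × regs σ s₀ ≡ s × EncodesOutput (build a s (suc i)) (mem σ)

      emit-insert-correct : ∀ i σ x → x < n → vertex x ≡ vertex (a + i) → regs σ X ≡ x → i ≢ s → Emitted i σ →
        Exec emit-insert σ (Inserted i)
      emit-insert-correct i σ x x<n v≡ X≡ i≢s (I≡ , cs@(constants _ _ _ C≡ _) , A≡ , e≡ , s≡ , enc) =
        add (1 + 3 * n + x) (cong₂ _+_ C≡ X≡) (fits (linear (x ∷ n ∷ []) (λ x n → # 1 ⊕ x ≤′ n ⇒ ⊢ # 1 ⊕ 3 ⊗ n ⊕ x ≤′ 10 ⊗ n) x<n))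
        (set (toℕ (vertex (a + i))) (trans (cycle-cell x x<n) (cong toℕ v≡)) _
        (exec-store (toℕ (vertex (a + i))) 1 refl refl
        (I≡ , cs , A≡ , e≡ , s≡ , subst (λ p → EncodesOutput p (mem σ [ toℕ (vertex (a + i)) ↦ 1 ])) (sym (build-insert i i≢s))
          (insert-encodes (build a s i) (mem σ) (vertex (a + i)) enc))))

      emit-step : ∀ i σ → i < suc e → Emitted i σ → Exec emit σ (Emitted (suc i))
      emit-step i σ (s≤s i≤e) inv@(I≡ , cs@(constants N≡ _ _ _ _) , A≡ , e≡ , s≡ , enc) = exec-seq (weaken next (exec-if
        (λ I≡s → exec-skip (I≡ , cs , A≡ , e≡ , s≡ , subst (λ p → EncodesOutput p (mem σ)) (sym (build-skip i (trans (sym I≡) (trans I≡s s≡)))) enc))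
        (λ I≢s → add (a + i) (cong₂ _+_ A≡ I≡)
            (fits (linear (a ∷ i ∷ n ∷ []) (λ a i n → # 1 ⊕ a ≤′ n ⇒ # 1 ⊕ i ≤′ n ⇒ ⊢ a ⊕ i ≤′ 10 ⊗ n) a<n i<n))
          (exec-seq (exec-if
            (λ N≤X → exec-assign (a + i ∸ n) (cong (a + i ∸_) N≡) _
              (emit-insert-correct i _ (a + i ∸ n) (wrapped (n≤ N≤X)) (trans (sym (vertex-+n _)) (cong vertex (m∸n+n≡m (n≤ N≤X))))
                refl (i≢s I≢s) inv))
            (λ N≰X → exec-skip (emit-insert-correct i _ (a + i) (≰⇒> (N≰X ∘ subst (_≤ a + i) (sym N≡))) refl refl (i≢s I≢s) inv)))))))
        where
        i<n : i < n
        i<n = ≤-<-trans i≤e e<n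
        i≢s : regs σ I ≢ regs σ s₀ → i ≢ s
        i≢s I≢s i≡s = I≢s (trans I≡ (trans i≡s (sym s≡)))
        n≤ : regs σ N ≤ a + i → n ≤ a + i
        n≤ = subst (_≤ a + i) N≡
        wrapped : n ≤ a + i → a + i ∸ n < n
        wrapped n≤a+i = linear ((a + i ∸ n) ∷ a ∷ i ∷ n ∷ [])
          (λ x a i n → x ⊕ n ≡′ a ⊕ i ⇒ # 1 ⊕ a ≤′ n ⇒ # 1 ⊕ i ≤′ n ⇒ ⊢ # 1 ⊕ x ≤′ n) (m∸n+n≡m n≤a+i) a<n i<n
        next : ∀ {σ′} → Inserted i σ′ → Exec (I ≔ reg I ⊞ lit 1) σ′ (Emitted (suc i))
        next (I≡ , rest) = increment i<n I≡ (refl , rest)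

      output-correct : ∀ {σ} → Emitted 0 σ → Timed (While reg I ≼ reg e₀ Do emit End) σ (Emitted (suc e))
      output-correct = timed-for Emitted (suc e) e<n
        (λ i σ i<1+e (I≡ , _ , _ , e≡ , _) → subst₂ _≤_ (sym I≡) (sym e≡) (≤-pred i<1+e))
        (λ σ (I≡ , _ , _ , e≡ , _) I≤e → <-irrefl refl (subst₂ _≤_ I≡ e≡ I≤e))
        emit-step

  algorithm-correct : Timed algorithm initial λ σ → Σ[ S ∈ Subset n ] EncodesOutput S (mem σ) × IsConnectedMaximumPDS G S
  algorithm-correct = timed-seq (setup-correct ⟫ λ (m , d , shape , cs , D≡ , I≡ , e≡ , zeros) →
    timed-seq (timed-for (Located m d) n ≤-refl
      (λ i σ i<n (I≡ , (constants N≡ _ _ _ _ , _) , _) → subst₂ _<_ (sym I≡) (sym N≡) i<n)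
      (λ σ (I≡ , (constants N≡ _ _ _ _ , _) , _) I<N → <-irrefl refl (subst₂ _<_ I≡ N≡ I<N))
      (locate-step m d) (I≡ , (cs , D≡ , e≡ , λ x _ → zeros x) , λ _ ()) ⟫ λ (_ , base , table) →
    timed-seq (timed {I ≔ val (lit 0)} (exec-assign 0 refl _ (
    timed-seq (timed-for (MeasuredBelow m d) n ≤-refl
      (λ i σ i<n (I≡ , (constants N≡ _ _ _ _ , _) , _) → subst₂ _<_ (sym I≡) (sym N≡) i<n)
      (λ σ (I≡ , (constants N≡ _ _ _ _ , _) , _) I<N → <-irrefl refl (subst₂ _<_ I≡ N≡ I<N))
      (λ i σ i<n → measure-step m d i i<n σ) (refl , base , table , λ _ ()) ⟫ λ {σ} (_ , (cs , D≡ , e≡ , low) , _ , measured) →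
    let module S = Search m d shape (mem σ) (double (mem σ) measured) in
    timed-seq (timed {I ≔ val (lit 0)} (exec-assign 0 refl _ (
    timed-seq (S.search-correct ((refl , cs , D≡ , refl) , nothing-found e≡ (λ _ ())) ⟫ λ searched →
    timed-seq (S.fallback-correct _ searched ⟫ λ { {σ′} (cs , mem≡ , a<n , P , optimal) →
    let module O = Output m d shape (regs σ′ A) (regs σ′ e₀) (regs σ′ s₀) a<n (Piece.e<n P) in
    timed-seq (timed {I ≔ val (lit 0)} (exec-assign 0 refl _ (
    O.output-correct (refl , cs , refl , refl , refl , empty mem≡ low) ⟫ λ (_ , _ , _ , _ , _ , encodes) →
      S P , encodes , optimal))) })))))))))))
    where
    double : ∀ f → (∀ j → j < n → f (2 * n + j) ≡ jump j × f (3 * n + j) ≡ jump j) → ∀ j → j < 2 * n → f (2 * n + j) ≡ jump j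
    double f measured j j<2n with j <? n
    ... | yes j<n = proj₁ (measured j j<n)
    ... | no j≮n  = trans (cong f 2n+j≡) (trans (proj₂ (measured (j ∸ n) j∸n<n))
                      (trans (sym (jump-periodic (j ∸ n))) (cong jump (m∸n+n≡m n≤j))))
      where
      n≤j = ≮⇒≥ j≮n
      2n+j≡ : 2 * n + j ≡ 3 * n + (j ∸ n)
      2n+j≡ = linear (j ∷ (j ∸ n) ∷ n ∷ []) (λ j x n → x ⊕ n ≡′ j ⇒ ⊢ 2 ⊗ n ⊕ j ≡′ 3 ⊗ n ⊕ x) (m∸n+n≡m n≤j)
      j∸n<n : j ∸ n < n
      j∸n<n = linear (j ∷ (j ∸ n) ∷ n ∷ []) (λ j x n → x ⊕ n ≡′ j ⇒ # 1 ⊕ j ≤′ 2 ⊗ n ⇒ ⊢ # 1 ⊕ x ≤′ n) (m∸n+n≡m n≤j) j<2n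

    empty : ∀ {f μ : ℕ → ℕ} → f ≡ μ → Low μ → EncodesOutput ∅ f
    empty refl low v = trans (low (toℕ v) (toℕ<n v)) (cong indicator (sym (lookup-replicate v false)))

corollary6 : Σ[ P ∈ Program ] Σ[ c ∈ ℕ ]
    (∀ {n : ℕ} (G : Graph n) → Connected G → Cubic G →
    (H : HamiltonianCycle G) →
    (inp : ℕ → ℕ) → EncodesInput G H inp →
    Σ[ S ∈ Subset n ] Σ[ final ∈ State ] Σ[ t ∈ ℕ ]
    (Run inp (c * n) P initial final t
    × t ≤ c * n
    × EncodesOutput S (mem final)
    × IsConnectedMaximumPDS G S))
corollary6 = algorithm , cost algorithm , λ {n} G connected cubic H inp enc →
  -- The time constant also bounds the words: every sum formed is at most 10 n, and `cost algorithm`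
  -- is at least 10 by evaluation.
  let open Verification connected cubic H inp enc (cost algorithm * n) (*-monoˡ-≤ n (≤ᵇ⇒≤ 10 (cost algorithm) _))
      final , t , run , t≤ , S , encodes , optimal = algorithm-correct
  in S , final , t , run , t≤ , encodes , optimal
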